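{- For every $\alpha\in(0,1/32)$ there exist $\varepsilon>0$ and $n_0$ such that if $D$ is a directed graph on $2n\ge 2n_0$ vertices, $D$ is not $\alpha$-extremal, and $\delta^0(D)\ge(1-\varepsilon)n$, then $D$ contains an anti-directed Hamiltonian cycle.
   Context: Directed graphs are loopless, with $E(D)\subseteq V(D)\times V(D)$; $\delta^0(D)$ is the minimum of the minimum out-degree and the minimum in-degree. $\Delta^+(A,B)=\max_{a\in A}|N^+(a)\cap B|$ and $\Delta^-(B,A)=\max_{b\in B}|N^-(b)\cap A|$. A directed graph $D$ on $2n$ vertices is $\alpha$-extremal if there exist $A,B\subseteq V(D)$ with $(1-\alpha)n\le|A|,|B|\le(1+\alpha)n$, $\Delta^+(A,B)\le\alpha n$ and $\Delta^-(B,A)\le\alpha n$. An anti-directed Hamiltonian cycle is a spanning subgraph whose underlying graph is a cycle and in which no two consecutive edges form a directed path. -}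

module Defs where

open import Data.Nat as ℕ using (ℕ; zero; suc; _≤_)
open import Data.Integer using (+_)
open import Data.Rational as ℚ using (ℚ; _/_; 1ℚ; _-_; _*_; _+_)
open import Data.Fin using (Fin; toℕ)
open import Data.Fin.Subset using (Subset; _∈_; ∣_∣)
open import Data.Fin.Permutation using (Permutation′; _⟨$⟩ʳ_)
open import Data.List using (List; length; filterᵇ)
open import Data.List.Relation.Unary.All using (All)
open import Data.Bool using (Bool; true; false; _∧_; T)
open import Data.Vec using (lookup)
open import Data.Nat.DivMod using (_mod_)
open import Data.Product using (Σ; _×_; ∃)
open import Relation.Binary.PropositionalEquality using (_≡_; _≢_)
open import Data.Empty using (⊥)

⟦_⟧ : ℕ → ℚ
⟦ k ⟧ = + k / 1

verts : (m : ℕ) → List (Fin m)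
verts m = Data.List.tabulate (λ i → i)

record Digraph (m : ℕ) : Set where
  field
    E       : Fin m → Fin m → Bool
    loopless : (v : Fin m) → E v v ≡ false
open Digraph public

outdegIn : ∀ {m} → Digraph m → Fin m → Subset m → ℕ
outdegIn D v B = length (filterᵇ (λ w → lookup B w ∧ E D v w) (verts _))

indegIn : ∀ {m} → Digraph m → Fin m → Subset m → ℕ
indegIn D v A = length (filterᵇ (λ w → lookup A w ∧ E D w v) (verts _))

outdeg : ∀ {m} → Digraph m → Fin m → ℕ
outdeg D v = length (filterᵇ (λ w → E D v w) (verts _))

indeg : ∀ {m} → Digraph m → Fin m → ℕ
indeg D v = length (filterᵇ (λ w → E D w v) (verts _))

MinSemiDeg≥ : ∀ {m} → Digraph m → ℚ → Set
MinSemiDeg≥ {m} D d = (v : Fin m) → (d ℚ.≤ ⟦ outdeg D v ⟧) × (d ℚ.≤ ⟦ indeg D v ⟧)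

Extremal : (α : ℚ) (n : ℕ) → Digraph (2 ℕ.* n) → Set
Extremal α n D = Σ (Subset (2 ℕ.* n)) λ A → Σ (Subset (2 ℕ.* n)) λ B →
    ((1ℚ - α) * ⟦ n ⟧ ℚ.≤ ⟦ ∣ A ∣ ⟧) × (⟦ ∣ A ∣ ⟧ ℚ.≤ (1ℚ + α) * ⟦ n ⟧)
  × ((1ℚ - α) * ⟦ n ⟧ ℚ.≤ ⟦ ∣ B ∣ ⟧) × (⟦ ∣ B ∣ ⟧ ℚ.≤ (1ℚ + α) * ⟦ n ⟧)
  × ((a : Fin (2 ℕ.* n)) → a ∈ A → ⟦ outdegIn D a B ⟧ ℚ.≤ α * ⟦ n ⟧)
  × ((b : Fin (2 ℕ.* n)) → b ∈ B → ⟦ indegIn D b A ⟧ ℚ.≤ α * ⟦ n ⟧)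

next : ∀ {m} → Fin m → Fin m
next {suc k} i = suc (toℕ i) mod suc k

OrientedEdge : ∀ {m} → Digraph m → Bool → Fin m → Fin m → Set
OrientedEdge D true  u v = T (E D u v)
OrientedEdge D false u v = T (E D v u)

-- An anti-directed Hamiltonian cycle: a cyclic ordering σ of all m ≥ 3
-- vertices, with the i-th cycle edge {σ i, σ (i+1)} present in D in
-- orientation o i, and consecutive edges having opposite orientations
-- (so no two consecutive edges form a directed path).
AntiDirHamCycle : ∀ {m} → Digraph m → Set
AntiDirHamCycle {m} D = (3 ≤ m) × Σ (Permutation′ m) λ σ → Σ (Fin m → Bool) λ o →
    ((i : Fin m) → OrientedEdge D (o i) (σ ⟨$⟩ʳ i) (σ ⟨$⟩ʳ next i))
  × ((i : Fin m) → o i ≢ o (next i))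

{-# OPTIONS --safe #-}
-- An anti-directed Hamiltonian cycle is a Hamiltonian cycle of the bipartite graph of edges from X to Y, for a
-- partition of the vertices into two halves X and Y.  A conditional-expectation (exponential potential) argument
-- yields a partition that halves all out- and in-neighbourhoods, all differences N⁺(a) ∖ N⁺(a₀) and all clusters
-- {a : |N⁺(a) ∖ N⁺(a₀)| small}.  If the bipartite graph had two large sets with few edges between them, one vertex
-- a₀ of the first set would determine a cluster A and B = V ∖ N⁺(a₀) witnessing extremality of the digraph; so
-- every pair of large sets spans many edges ("expansion").  Expansion gives augmenting paths of length five, hence
-- a perfect matching; contracting it leaves a digraph F in which a directed Hamiltonian cycle is sought.
--
-- In F, the vertices z, w of a path a → z → w → b with a → b can be taken out and used as a link p → z → w → q.
-- Every pair (p, q) is served by a positive proportion of the edges z → w, so a greedy choice of few such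
-- gadgets serves all pairs; several disjoint rounds form one absorbing path.  The remaining vertices are covered by
-- boundedly many paths: among too many paths two are short, and either two paths can be merged, or exchanging
-- tails with a short path lowers the sum of the squared lengths, or expansion provides an edge between two
-- different paths that allows four paths to be recombined into three.  The absorber then links everything into a cycle.
module Submission where

open import Defs

-- No partition balances every set of vertices, so the sets A and B that violate expansion, unknown
-- until the halves are fixed, cannot be put among the sets to be balanced. This is why the
-- witnesses of extremality must be clusters and neighbourhoods named by one or two vertices: there
-- are only polynomially many, and they can be listed before the halves are chosen. Real proportions
-- are avoided: `n ≤ 2 * a + g` reads a ≥ (n - g)/2, and all losses are added up in such slacks. One
-- unit `u`, a fixed small proportion of n, bounds at once the degree defect εn, the discrepancy of
-- the partition, the size of the absorber and the length of a short path. Expansion lives on the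
-- larger scale 26 m u, where m = 72 k², k is the denominator of α and 26 m² u ≤ n ≤ 52 m² u. Since
-- `u` is linear in n, there is room for an exponent ι that is linear in n as well, where a
-- logarithm of n would do: the potential and the absorber only ask for 10 n² < 2^ι, and no
-- logarithm appears.

-- From rational inequalities to inequalities between natural numbers

module Rational where
  open import Data.Nat as ℕ using (ℕ; zero; suc)
  import Data.Nat.Properties as ℕ
  open import Data.Integer as ℤ using (+_)
  import Data.Integer.Properties as ℤ
  open import Data.Rational
  open import Data.Rational.Properties
  open import Data.Rational.Solver
  import Data.Rational.Unnormalised as ℚᵘ
  import Data.Rational.Unnormalised.Properties as ℚᵘ
  open import Data.Product using (Σ; _×_; _,_)
  open import Relation.Binary.PropositionalEquality

  private
    unit : ℕ → ℚᵘ.ℚᵘ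
    unit a = ℚᵘ.mkℚᵘ (+ a) 0

    toℚᵘ-⟦⟧ : ∀ a → toℚᵘ ⟦ a ⟧ ℚᵘ.≃ unit a
    toℚᵘ-⟦⟧ a = toℚᵘ-fromℚᵘ (unit a)

  ⟦⟧-+ : ∀ a b → ⟦ a ℕ.+ b ⟧ ≡ ⟦ a ⟧ + ⟦ b ⟧
  ⟦⟧-+ a b = toℚᵘ-injective (ℚᵘ.≃-trans (toℚᵘ-⟦⟧ (a ℕ.+ b)) (ℚᵘ.≃-sym (ℚᵘ.≃-trans (toℚᵘ-homo-+ ⟦ a ⟧ ⟦ b ⟧)
    (ℚᵘ.≃-trans (ℚᵘ.+-cong (toℚᵘ-⟦⟧ a) (toℚᵘ-⟦⟧ b))
      (ℚᵘ.*≡* (cong (ℤ._* + 1) (cong₂ ℤ._+_ (ℤ.*-identityʳ (+ a)) (ℤ.*-identityʳ (+ b)))))))))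

  ⟦⟧-* : ∀ a b → ⟦ a ℕ.* b ⟧ ≡ ⟦ a ⟧ * ⟦ b ⟧
  ⟦⟧-* a b = toℚᵘ-injective (ℚᵘ.≃-trans (toℚᵘ-⟦⟧ (a ℕ.* b)) (ℚᵘ.≃-sym (ℚᵘ.≃-trans (toℚᵘ-homo-* ⟦ a ⟧ ⟦ b ⟧)
    (ℚᵘ.≃-trans (ℚᵘ.*-cong (toℚᵘ-⟦⟧ a) (toℚᵘ-⟦⟧ b)) (ℚᵘ.*≡* (cong (ℤ._* + 1) (sym (ℤ.pos-* a b))))))))

  ⟦⟧-mono : ∀ {a b} → a ℕ.≤ b → ⟦ a ⟧ ≤ ⟦ b ⟧
  ⟦⟧-mono {a} {b} h = toℚᵘ-cancel-≤ (ℚᵘ.≤-respˡ-≃ (ℚᵘ.≃-sym (toℚᵘ-⟦⟧ a)) (ℚᵘ.≤-respʳ-≃ (ℚᵘ.≃-sym (toℚᵘ-⟦⟧ b))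
    (ℚᵘ.*≤* (ℤ.*-monoʳ-≤-nonNeg (+ 1) (ℤ.+≤+ h)))))

  ⟦⟧-cancel : ∀ {a b} → ⟦ a ⟧ ≤ ⟦ b ⟧ → a ℕ.≤ b
  ⟦⟧-cancel {a} {b} h with ℚᵘ.≤-respˡ-≃ (toℚᵘ-⟦⟧ a) (ℚᵘ.≤-respʳ-≃ (toℚᵘ-⟦⟧ b) (toℚᵘ-mono-≤ h))
  ... | ℚᵘ.*≤* le = ℤ.drop‿+≤+ (subst₂ ℤ._≤_ (ℤ.*-identityʳ (+ a)) (ℤ.*-identityʳ (+ b)) le)

  ⟦suc⟧-positive : ∀ k → Positive ⟦ suc k ⟧
  ⟦suc⟧-positive k = normalize-pos (suc k) 1

  unit-fraction : ∀ k → Σ ℚ λ ε → 0ℚ < ε × ⟦ suc k ⟧ * ε ≡ ⟦ 1 ⟧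
  unit-fraction k = 1/ ⟦ suc k ⟧ , positive⁻¹ _ {{1/pos⇒pos ⟦ suc k ⟧}} , *-inverseʳ ⟦ suc k ⟧
    where
    instance
      positive-k : Positive ⟦ suc k ⟧
      positive-k = ⟦suc⟧-positive k
      nonZero-k : NonZero ⟦ suc k ⟧
      nonZero-k = pos⇒nonZero ⟦ suc k ⟧

  positive-fraction : ∀ α → 0ℚ < α → Σ ℕ λ k → Σ ℕ λ p → ⟦ suc k ⟧ * α ≡ ⟦ suc p ⟧
  positive-fraction α@(mkℚ (+ suc p) k _) _ = k , p , toℚᵘ-injective (ℚᵘ.≃-trans (toℚᵘ-homo-* ⟦ suc k ⟧ α)
    (ℚᵘ.≃-trans (ℚᵘ.*-cong (toℚᵘ-⟦⟧ (suc k)) (ℚᵘ.≃-refl {toℚᵘ α}))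
      (ℚᵘ.≃-trans (ℚᵘ.*≡* eq) (ℚᵘ.≃-sym (toℚᵘ-⟦⟧ (suc p))))))
    where
    eq : (+ suc k ℤ.* + suc p) ℤ.* + 1 ≡ + suc p ℤ.* + (1 ℕ.* suc k)
    eq = trans (ℤ.*-identityʳ _) (trans (ℤ.*-comm (+ suc k) (+ suc p)) (cong (λ m → + suc p ℤ.* + m) (sym (ℕ.*-identityˡ (suc k)))))
  positive-fraction (mkℚ (+ zero) k _) (*<* (ℤ.+<+ ()))
  positive-fraction (mkℚ ℤ.-[1+ _ ] k _) (*<* ())

  scaled : ∀ k {p} α y n → ⟦ k ⟧ * α ≡ ⟦ p ⟧ → ⟦ k ⟧ * (⟦ y ⟧ + α * ⟦ n ⟧) ≡ ⟦ k ℕ.* y ℕ.+ p ℕ.* n ⟧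
  scaled k {p} α y n h = begin
    ⟦ k ⟧ * (⟦ y ⟧ + α * ⟦ n ⟧) ≡⟨ *-distribˡ-+ ⟦ k ⟧ ⟦ y ⟧ (α * ⟦ n ⟧) ⟩
    ⟦ k ⟧ * ⟦ y ⟧ + ⟦ k ⟧ * (α * ⟦ n ⟧) ≡⟨ cong₂ _+_ (⟦⟧-* k y) (*-assoc ⟦ k ⟧ α ⟦ n ⟧) ⟨
    ⟦ k ℕ.* y ⟧ + ⟦ k ⟧ * α * ⟦ n ⟧ ≡⟨ cong (λ z → ⟦ k ℕ.* y ⟧ + z * ⟦ n ⟧) h ⟩
    ⟦ k ℕ.* y ⟧ + ⟦ p ⟧ * ⟦ n ⟧ ≡⟨ cong (λ z → ⟦ k ℕ.* y ⟧ + z) (⟦⟧-* p n) ⟨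
    ⟦ k ℕ.* y ⟧ + ⟦ p ℕ.* n ⟧ ≡⟨ ⟦⟧-+ (k ℕ.* y) (p ℕ.* n) ⟨
    ⟦ k ℕ.* y ℕ.+ p ℕ.* n ⟧ ∎
    where open ≡-Reasoning

  -- As α = (p + 1)/(k + 1) is at least 1/(k + 1), a deviation of n/(k + 1) is within αn.
  -- Extremality is therefore always produced with the parameter 1/(k + 1), which needs no
  -- numerator.
  scaled-≤ : ∀ {k p α x y n} → ⟦ suc k ⟧ * α ≡ ⟦ suc p ⟧ → suc k ℕ.* x ℕ.≤ suc k ℕ.* y ℕ.+ n → ⟦ x ⟧ ≤ ⟦ y ⟧ + α * ⟦ n ⟧
  scaled-≤ {k} {p} {α} {x} {y} {n} h le = *-cancelˡ-≤-pos ⟦ suc k ⟧ {{⟦suc⟧-positive k}}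
    (subst₂ _≤_ (⟦⟧-* (suc k) x) (sym (scaled (suc k) {suc p} α y n h))
      (⟦⟧-mono {suc k ℕ.* x} {suc k ℕ.* y ℕ.+ suc p ℕ.* n} (ℕ.≤-trans le (ℕ.+-monoʳ-≤ (suc k ℕ.* y) (ℕ.m≤m+n n (p ℕ.* n))))))

  unscaled-≤ : ∀ {k ε x y n} → ⟦ suc k ⟧ * ε ≡ ⟦ 1 ⟧ → ⟦ x ⟧ ≤ ⟦ y ⟧ + ε * ⟦ n ⟧ → suc k ℕ.* x ℕ.≤ suc k ℕ.* y ℕ.+ n
  unscaled-≤ {k} {ε} {x} {y} {n} h le = subst (λ m → suc k ℕ.* x ℕ.≤ suc k ℕ.* y ℕ.+ m) (ℕ.*-identityˡ n)
    (⟦⟧-cancel {suc k ℕ.* x} {suc k ℕ.* y ℕ.+ 1 ℕ.* n} (subst₂ _≤_ (sym (⟦⟧-* (suc k) x)) (scaled (suc k) {1} ε y n h)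
      (*-monoˡ-≤-nonNeg ⟦ suc k ⟧ {{pos⇒nonNeg ⟦ suc k ⟧ {{⟦suc⟧-positive k}}}} le)))

  minus-≤ : ∀ {α u v} → u ≤ v + α * u → (1ℚ - α) * u ≤ v
  minus-≤ {α} {u} {v} h = subst₂ _≤_ (lhs α u) (rhs (α * u) v) (+-monoˡ-≤ (- (α * u)) h)
    where
    open +-*-Solver
    lhs : ∀ α u → u + - (α * u) ≡ (1ℚ - α) * u
    lhs = solve 2 (λ α u → u :+ :- (α :* u) := (con 1ℚ :- α) :* u) refl
    rhs : ∀ w v → v + w + - w ≡ v
    rhs = solve 2 (λ w v → v :+ w :+ :- w := v) refl

  ≤-minus : ∀ {ε u v} → (1ℚ - ε) * u ≤ v → u ≤ v + ε * u
  ≤-minus {ε} {u} {v} h = subst (_≤ v + ε * u) (lhs ε u) (+-monoˡ-≤ (ε * u) h)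
    where
    open +-*-Solver
    lhs : ∀ α u → (1ℚ - α) * u + α * u ≡ u
    lhs = solve 2 (λ α u → (con 1ℚ :- α) :* u :+ α :* u := u) refl

  plus-≡ : ∀ α u → u + α * u ≡ (1ℚ + α) * u
  plus-≡ = solve 2 (λ α u → u :+ α :* u := (con 1ℚ :+ α) :* u) refl
    where open +-*-Solver

module AntiDirected where
  import Algebra.Properties.CommutativeMonoid.Sum
  import Algebra.Solver.CommutativeMonoid as CM
  open import Data.Bool using (Bool; true; false; _∧_; _∨_; not; T; if_then_else_)
  open import Data.Bool.Properties using (∧-assoc; T?; T-≡)
  open import Data.Empty using (⊥; ⊥-elim)
  open import Data.Fin as Fin using (Fin; toℕ; fromℕ<; punchOut; splitAt; _↑ˡ_; _↑ʳ_)
  import Data.Fin.Properties as Fin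
  open import Data.Fin.Permutation as Perm using (Permutation′; permutation; _⟨$⟩ʳ_; _⟨$⟩ˡ_; inverseˡ; inverseʳ; _∘ₚ_)
  import Data.Fin.Permutation.Components as PC
  import Data.Fin.Subset as Sub
  open import Data.List using (List; []; _∷_; _++_; length; filterᵇ; map; concatMap; cartesianProduct; allFin)
  open import Data.List.Membership.Propositional using (_∈_; _∉_; find; lose)
  open import Data.List.Membership.Propositional.Properties
    using (∈-allFin; ∈-∃++; ∈-++⁻; ∈-++⁺ˡ; ∈-++⁺ʳ; ∈-map⁺; ∈-filter⁺; ∈-concatMap⁺; ∈-concatMap⁻; ∈-cartesianProduct⁺)
  open import Data.List.Properties using (map-tabulate; length-tabulate; length-map; length-++; ++-assoc)
  open import Data.List.Relation.Binary.Permutation.Propositional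
    using (_↭_; prep; swap; ↭-sym; ↭-trans; ↭-reflexive) renaming (refl to ↭refl; trans to ↭trans)
  open import Data.List.Relation.Binary.Permutation.Propositional.Properties hiding (++-assoc)
  open import Data.List.Relation.Unary.Any using (here; there)
  open import Data.Nat
  open import Data.Nat.DivMod using (_%_; _/_; m/n*n≤m; m≡m%n+[m/n]*n; m%n<n; m<n⇒m%n≡m; n%n≡0; /-monoˡ-≤; m*n/n≡m)
  open import Data.Nat.Properties
  open import Data.Nat.Tactic.RingSolver using (solve-∀)
  open import Data.Product using (Σ; _×_; _,_; proj₁; proj₂)
  open import Data.Rational as ℚ using (ℚ; 0ℚ; 1ℚ)
  import Data.Rational.Properties as ℚ
  open import Data.Sum using (_⊎_; inj₁; inj₂)
  open import Data.Vec using (tabulate; lookup) renaming (_∷_ to _∷ᵥ_)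
  open import Data.Vec.Properties using (lookup∘tabulate; []=⇒lookup)
  open import Function using (Equivalence)
  open import Relation.Binary.PropositionalEquality
  open import Relation.Nullary using (¬_; Dec; does; yes; no; contradiction)
  open import Relation.Nullary.Decidable using (dec-true)
  module Sum = Algebra.Properties.CommutativeMonoid.Sum +-0-commutativeMonoid

  -- Sums and counts over finite lists

  module Counting where

    private variable
      A B : Set

    -- From L ≤ R, an identity b + L ≡ a + R + s certifies a ≤ b.
    lin : ∀ {a b L R} s → L ≤ R → b + L ≡ a + R + s → a ≤ b
    lin {a} {b} {L} {R} s h eq = +-cancelʳ-≤ L a b (begin
      a + L ≤⟨ +-monoʳ-≤ a h ⟩
      a + R ≤⟨ m≤m+n (a + R) s ⟩
      a + R + s ≡⟨ eq ⟨
      b + L ∎)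
      where open ≤-Reasoning

    infixr 5 _⊹_
    _⊹_ : ∀ {a b c d} → a ≤ b → c ≤ d → a + c ≤ b + d
    _⊹_ = +-mono-≤

    ⟨_⟩ : Bool → ℕ
    ⟨ true ⟩ = 1
    ⟨ false ⟩ = 0

    ⟨⟩≤1 : ∀ b → ⟨ b ⟩ ≤ 1
    ⟨⟩≤1 true = ≤-refl
    ⟨⟩≤1 false = z≤n

    Σℓ : (A → ℕ) → List A → ℕ
    Σℓ f [] = 0
    Σℓ f (x ∷ xs) = f x + Σℓ f xs

    Σℓ-mono : {f g : A → ℕ} → (∀ x → f x ≤ g x) → ∀ xs → Σℓ f xs ≤ Σℓ g xs
    Σℓ-mono h [] = z≤n
    Σℓ-mono h (x ∷ xs) = h x ⊹ Σℓ-mono h xs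

    Σℓ-mono∈ : {f g : A → ℕ} (xs : List A) → (∀ x → x ∈ xs → f x ≤ g x) → Σℓ f xs ≤ Σℓ g xs
    Σℓ-mono∈ [] h = z≤n
    Σℓ-mono∈ (x ∷ xs) h = h x (here refl) ⊹ Σℓ-mono∈ xs (λ y m → h y (there m))

    Σℓ-+ : (f g : A → ℕ) → ∀ xs → Σℓ (λ x → f x + g x) xs ≡ Σℓ f xs + Σℓ g xs
    Σℓ-+ f g [] = refl
    Σℓ-+ f g (x ∷ xs) rewrite Σℓ-+ f g xs = interchange (f x) (g x) (Σℓ f xs) (Σℓ g xs)
      where
      interchange : ∀ a b c d → a + b + (c + d) ≡ a + c + (b + d)
      interchange = solve-∀

    Σℓ-* : (c : ℕ) (f : A → ℕ) → ∀ xs → Σℓ (λ x → c * f x) xs ≡ c * Σℓ f xs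
    Σℓ-* c f [] = sym (*-zeroʳ c)
    Σℓ-* c f (x ∷ xs) rewrite Σℓ-* c f xs = sym (*-distribˡ-+ c (f x) (Σℓ f xs))

    Σℓ-const : (c : ℕ) (xs : List A) → Σℓ (λ _ → c) xs ≡ c * length xs
    Σℓ-const c [] = sym (*-zeroʳ c)
    Σℓ-const c (x ∷ xs) rewrite Σℓ-const c xs = sym (*-suc c (length xs))

    Σℓ-≤-const : {f : A → ℕ} (c : ℕ) (xs : List A) → (∀ x → x ∈ xs → f x ≤ c) → Σℓ f xs ≤ c * length xs
    Σℓ-≤-const c xs h = ≤-trans (Σℓ-mono∈ xs h) (≤-reflexive (Σℓ-const c xs))

    Σℓ-≥-const : {f : A → ℕ} (c : ℕ) (xs : List A) → (∀ x → x ∈ xs → c ≤ f x) → c * length xs ≤ Σℓ f xs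
    Σℓ-≥-const c xs h = ≤-trans (≤-reflexive (sym (Σℓ-const c xs))) (Σℓ-mono∈ xs h)

    Σℓ-++ : (f : A → ℕ) (xs ys : List A) → Σℓ f (xs ++ ys) ≡ Σℓ f xs + Σℓ f ys
    Σℓ-++ f [] ys = refl
    Σℓ-++ f (x ∷ xs) ys rewrite Σℓ-++ f xs ys = sym (+-assoc (f x) _ _)

    Σℓ-↭ : (f : A → ℕ) {xs ys : List A} → xs ↭ ys → Σℓ f xs ≡ Σℓ f ys
    Σℓ-↭ f ↭refl = refl
    Σℓ-↭ f (prep x p) = cong (f x +_) (Σℓ-↭ f p)
    Σℓ-↭ f (swap {xs} {ys} x y p) rewrite Σℓ-↭ f p = exch (f x) (f y) (Σℓ f ys)
      where
      exch : ∀ a b c → a + (b + c) ≡ b + (a + c)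
      exch = solve-∀
    Σℓ-↭ f (↭trans p q) = trans (Σℓ-↭ f p) (Σℓ-↭ f q)

    Σℓ-map : (f : B → ℕ) (g : A → B) (xs : List A) → Σℓ f (map g xs) ≡ Σℓ (λ x → f (g x)) xs
    Σℓ-map f g [] = refl
    Σℓ-map f g (x ∷ xs) = cong (f (g x) +_) (Σℓ-map f g xs)

    Σℓ-comm : (f : A → B → ℕ) (xs : List A) (ys : List B) →
      Σℓ (λ x → Σℓ (f x) ys) xs ≡ Σℓ (λ y → Σℓ (λ x → f x y) xs) ys
    Σℓ-comm f [] ys = sym (trans (Σℓ-const 0 ys) refl)
    Σℓ-comm f (x ∷ xs) ys rewrite Σℓ-comm f xs ys = sym (Σℓ-+ (f x) (λ y → Σℓ (λ x → f x y) xs) ys)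

    Σℓ-∈ : (f : A → ℕ) {x : A} {xs : List A} → x ∈ xs → f x ≤ Σℓ f xs
    Σℓ-∈ f {xs = _ ∷ xs} (here refl) = m≤m+n _ _
    Σℓ-∈ f {xs = y ∷ xs} (there m) = ≤-trans (Σℓ-∈ f m) (m≤n+m _ (f y))

    Σℓ-max : (f : A → ℕ) (x : A) (xs : List A) → Σ A λ y → Σℓ f xs ≤ length xs * f y
    Σℓ-max f x [] = x , z≤n
    Σℓ-max f x (y ∷ xs) with Σℓ-max f y xs
    ... | z , h with ≤-total (f y) (f z)
    ... | inj₁ le = z , +-mono-≤ le h
    ... | inj₂ ge = y , +-monoʳ-≤ (f y) (≤-trans h (*-monoʳ-≤ (length xs) ge))

    cnt : (A → Bool) → List A → ℕ
    cnt p = Σℓ (λ x → ⟨ p x ⟩)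

    cnt≡length-filterᵇ : (p : A → Bool) (xs : List A) → cnt p xs ≡ length (filterᵇ p xs)
    cnt≡length-filterᵇ p [] = refl
    cnt≡length-filterᵇ p (x ∷ xs) with p x
    ... | true = cong suc (cnt≡length-filterᵇ p xs)
    ... | false = cnt≡length-filterᵇ p xs

    cnt-≤-length : (p : A → Bool) (xs : List A) → cnt p xs ≤ length xs
    cnt-≤-length p xs = ≤-trans (Σℓ-≤-const 1 xs (λ x _ → ⟨⟩≤1 (p x))) (≤-reflexive (*-identityˡ _))

    cnt-∃ : (p : A → Bool) (xs : List A) → 0 < cnt p xs → Σ A λ x → x ∈ xs × p x ≡ true
    cnt-∃ p (x ∷ xs) h with p x in eq
    ... | true = x , here refl , eq
    ... | false with cnt-∃ p xs h
    ... | y , m , e = y , there m , e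

    ∧-elim : ∀ a {b} → a ∧ b ≡ true → a ≡ true × b ≡ true
    ∧-elim true e = refl , e

    ∧-intro : ∀ {a b} → a ≡ true → b ≡ true → a ∧ b ≡ true
    ∧-intro refl refl = refl

    not-elim : ∀ {a} → not a ≡ true → a ≡ false
    not-elim {false} _ = refl

    true≢false : ∀ {a} → a ≡ true → a ≡ false → ⊥
    true≢false refl ()

    ⟨⟩-mono : ∀ {a b} → (a ≡ true → b ≡ true) → ⟨ a ⟩ ≤ ⟨ b ⟩
    ⟨⟩-mono {false} h = z≤n
    ⟨⟩-mono {true} h rewrite h refl = ≤-refl

    ⟨⟩-split : ∀ a b → ⟨ a ⟩ ≤ ⟨ a ∧ not b ⟩ + ⟨ b ⟩
    ⟨⟩-split false b = z≤n
    ⟨⟩-split true false = ≤-refl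
    ⟨⟩-split true true = ≤-refl

    cnt-mono : {p q : A → Bool} → (∀ x → p x ≡ true → q x ≡ true) → ∀ xs → cnt p xs ≤ cnt q xs
    cnt-mono h = Σℓ-mono (λ x → ⟨⟩-mono (h x))

    cnt-split : (p q : A → Bool) → ∀ xs → cnt p xs ≤ cnt (λ x → p x ∧ not (q x)) xs + cnt q xs
    cnt-split p q xs = ≤-trans (Σℓ-mono (λ x → ⟨⟩-split (p x) (q x)) xs)
      (≤-reflexive (Σℓ-+ (λ x → ⟨ p x ∧ not (q x) ⟩) (λ x → ⟨ q x ⟩) xs))

    cnt-split≡ : (p q : A → Bool) → ∀ xs → cnt (λ x → p x ∧ q x) xs + cnt (λ x → p x ∧ not (q x)) xs ≡ cnt p xs
    cnt-split≡ p q [] = refl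
    cnt-split≡ p q (x ∷ xs) with p x | q x
    ... | true | true = cong suc (cnt-split≡ p q xs)
    ... | true | false = trans (+-suc _ _) (cong suc (cnt-split≡ p q xs))
    ... | false | _ = cnt-split≡ p q xs

    cnt-not : (p : A → Bool) → ∀ xs → cnt p xs + cnt (λ x → not (p x)) xs ≡ length xs
    cnt-not p [] = refl
    cnt-not p (x ∷ xs) with p x
    ... | true = cong suc (cnt-not p xs)
    ... | false = trans (+-suc _ _) (cong suc (cnt-not p xs))

    <⇒≤ᵇ≡true : ∀ {a b} → a ≤ b → (a ≤ᵇ b) ≡ true
    <⇒≤ᵇ≡true {a} {b} h with a ≤ᵇ b | ≤⇒≤ᵇ h
    ... | true | _ = refl

    ≤ᵇ≡true⇒≤ : ∀ {a b} → (a ≤ᵇ b) ≡ true → a ≤ b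
    ≤ᵇ≡true⇒≤ {a} {b} e = ≤ᵇ⇒≤ a b (subst T (sym e) _)

    ≤ᵇ≡false⇒> : ∀ {a b} → (a ≤ᵇ b) ≡ false → b < a
    ≤ᵇ≡false⇒> {a} {b} e = ≰⇒> λ h → true≢false (<⇒≤ᵇ≡true h) e

    <⇒<ᵇ≡true : ∀ {a b} → a < b → (a <ᵇ b) ≡ true
    <⇒<ᵇ≡true {a} {b} h with a <ᵇ b | <⇒<ᵇ h
    ... | true | _ = refl

    _==_ : ∀ {n} → Fin n → Fin n → Bool
    x == y = does (x Fin.≟ y)

    ==-refl : ∀ {n} (x : Fin n) → (x == x) ≡ true
    ==-refl x = dec-true (x Fin.≟ x) refl

    ==⇒≡ : ∀ {n} (x y : Fin n) → (x == y) ≡ true → x ≡ y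
    ==⇒≡ x y e with x Fin.≟ y
    ... | yes p = p

    _∈ᵇ_ : ∀ {n} → Fin n → List (Fin n) → Bool
    x ∈ᵇ [] = false
    x ∈ᵇ (y ∷ ys) = (x == y) ∨ (x ∈ᵇ ys)

    ∨-introʳ : ∀ a {b} → b ≡ true → a ∨ b ≡ true
    ∨-introʳ true _ = refl
    ∨-introʳ false e = e

    ∈⇒∈ᵇ : ∀ {n} {x : Fin n} {xs} → x ∈ xs → (x ∈ᵇ xs) ≡ true
    ∈⇒∈ᵇ {x = x} (here refl) rewrite ==-refl x = refl
    ∈⇒∈ᵇ {x = x} {y ∷ ys} (there m) = ∨-introʳ (x == y) (∈⇒∈ᵇ m)

    ∈ᵇ⇒∈ : ∀ {n} {x : Fin n} xs → (x ∈ᵇ xs) ≡ true → x ∈ xs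
    ∈ᵇ⇒∈ {x = x} (y ∷ ys) e with x == y in q
    ... | true = here (==⇒≡ x y q)
    ... | false = there (∈ᵇ⇒∈ ys e)


    allFin-suc : ∀ n → allFin (suc n) ≡ Fin.zero ∷ map Fin.suc (allFin n)
    allFin-suc n = cong (Fin.zero ∷_) (sym (map-tabulate (λ i → i) Fin.suc))

    Σℓ-suc : ∀ {n} (f : Fin (suc n) → ℕ) → Σℓ f (allFin (suc n)) ≡ f Fin.zero + Σℓ (λ i → f (Fin.suc i)) (allFin n)
    Σℓ-suc {n} f = trans (cong (Σℓ f) (allFin-suc n)) (cong (f Fin.zero +_) (Σℓ-map f Fin.suc (allFin n)))


    length-allFin : ∀ n → length (allFin n) ≡ n
    length-allFin n = length-tabulate {n = n} (λ i → i)

    # : ∀ {n} → (Fin n → Bool) → ℕ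
    # {n} p = cnt p (allFin n)

    #-== : ∀ {n} (x : Fin n) → # (λ y → y == x) ≤ 1
    #-== {suc n} Fin.zero rewrite Σℓ-suc (λ y → ⟨ y == Fin.zero {n} ⟩) | Σℓ-const 0 (allFin n) = ≤-refl
    #-== {suc n} (Fin.suc x) rewrite Σℓ-suc (λ y → ⟨ y == Fin.suc x ⟩) =
      ≤-trans (cnt-mono {p = λ y → Fin.suc y == Fin.suc x} {q = λ y → y == x} (λ y e → same y e) (allFin n)) (#-== x)
      where
      same : ∀ y → (Fin.suc y == Fin.suc x) ≡ true → (y == x) ≡ true
      same y e with ==⇒≡ (Fin.suc y) (Fin.suc x) e
      ... | refl = ==-refl y

    ⟨∨⟩ : ∀ a b → ⟨ a ∨ b ⟩ ≤ ⟨ a ⟩ + ⟨ b ⟩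
    ⟨∨⟩ true b = m≤m+n 1 ⟨ b ⟩
    ⟨∨⟩ false b = ≤-refl

    #-∈ᵇ : ∀ {n} (ws : List (Fin n)) → # (_∈ᵇ ws) ≤ length ws
    #-∈ᵇ {n} [] = ≤-reflexive (Σℓ-const 0 (allFin n))
    #-∈ᵇ {n} (w ∷ ws) = ≤-trans (Σℓ-mono (λ x → ⟨∨⟩ (x == w) (x ∈ᵇ ws)) (allFin n))
      (≤-trans (≤-reflexive (Σℓ-+ (λ x → ⟨ x == w ⟩) (λ x → ⟨ x ∈ᵇ ws ⟩) (allFin n))) (#-== w ⊹ #-∈ᵇ ws))

    #-avoid : ∀ {n} (p : Fin n → Bool) (ws : List (Fin n)) → # p ≤ # (λ x → p x ∧ not (x ∈ᵇ ws)) + length ws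
    #-avoid p ws = ≤-trans (cnt-split p (_∈ᵇ ws) (allFin _)) (+-monoʳ-≤ _ (#-∈ᵇ ws))

    ∉ᵇ⇒∉ : ∀ {n} {x : Fin n} {xs} → (x ∈ᵇ xs) ≡ false → x ∉ xs
    ∉ᵇ⇒∉ e m = true≢false (∈⇒∈ᵇ m) e

    ∈⇒↭ : {x : A} {xs : List A} → x ∈ xs → Σ (List A) λ ys → xs ↭ x ∷ ys
    ∈⇒↭ {x = x} m with ∈-∃++ m
    ... | ys , zs , refl = ys ++ zs , shift x ys zs

    length-cartesianProduct : (xs : List A) (ys : List B) → length (cartesianProduct xs ys) ≡ length xs * length ys
    length-cartesianProduct [] ys = refl
    length-cartesianProduct (x ∷ xs) ys = trans (length-++ (map (x ,_) ys))
      (cong₂ _+_ (length-map (x ,_) ys) (length-cartesianProduct xs ys))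

    <ᵇ≡true⇒< : ∀ {a b} → (a <ᵇ b) ≡ true → a < b
    <ᵇ≡true⇒< {a} {b} e = <ᵇ⇒< a b (subst T (sym e) _)

  open Counting

  -- Expansion: edges avoiding a small set, and edges that serve many pairs

  -- Deleting at most w elements from a set of size at least (n - r)/2 costs 2w of the slack, which
  -- `g` can afford.
  shave : ∀ {n a b r w g l} → n ≤ 2 * a + r → a ≤ b + l → l ≤ w → r + 2 * w ≤ g → n ≤ 2 * b + g
  shave {n} {a} {b} {r} {w} {g} {l} h1 h2 h3 h4 = lin 0 (h1 ⊹ h2 ⊹ h2 ⊹ h3 ⊹ h3 ⊹ h4) (id n a b r w g l)
    where
    id : ∀ n a b r w g l → 2 * b + g + (n + (a + (a + (l + (l + (r + 2 * w))))))
       ≡ n + (2 * a + r + (b + l + (b + l + (w + (w + g))))) + 0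
    id = solve-∀

  -- Turns the average density (t/n)² into the constant 1/T².
  share : ∀ {T n t u f} → n ≤ T * t → 0 < t → (t * t) * u ≤ n * (n * f) → u ≤ (T * T) * f
  share {T} {n} {t} {u} {f} n≤ 0<t h = *-cancelˡ-≤ (t * t) {{>-nonZero (*-mono-≤ 0<t 0<t)}} (begin
    (t * t) * u ≤⟨ h ⟩
    n * (n * f) ≤⟨ *-mono-≤ n≤ (*-monoˡ-≤ f n≤) ⟩
    (T * t) * ((T * t) * f) ≡⟨ id T t f ⟩
    (t * t) * ((T * T) * f) ∎)
    where
    open ≤-Reasoning
    id : ∀ T t f → (T * t) * ((T * t) * f) ≡ (t * t) * ((T * T) * f)
    id = solve-∀

  positive : ∀ c {u f} → suc u ≤ c * f → 0 < f
  positive c {f = zero} h = ⊥-elim (1+n≰n (≤-trans (≤-trans (s≤s z≤n) h) (≤-reflexive (*-zeroʳ c))))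
  positive c {f = suc _} h = s≤s z≤n

  module Expand {n : ℕ} (F : Fin n → Fin n → Bool) (r g t : ℕ)
    (outdeg≥ : ∀ v → n ≤ 2 * # (F v) + r)
    (indeg≥ : ∀ v → n ≤ 2 * # (λ u → F u v) + r)
    (expand : ∀ A B → n ≤ 2 * # A + g → n ≤ 2 * # B + g →
              t ≤ # (λ a → A a ∧ (t ≤ᵇ # (λ b → B b ∧ F a b))))
    (0<t : 0 < t) where

    V = Fin n

    _∖_ : (V → Bool) → List V → V → Bool
    (A ∖ W) v = A v ∧ not (v ∈ᵇ W)

    expand-avoid : ∀ {w} → r + 2 * w ≤ g → ∀ A B W → length W ≤ w → n ≤ 2 * # A + r → n ≤ 2 * # B + r →
      t ≤ # (λ a → (A ∖ W) a ∧ (t ≤ᵇ # (λ b → (B ∖ W) b ∧ F a b)))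
    expand-avoid slack A B W W≤w hA hB =
      expand (A ∖ W) (B ∖ W) (shave hA (#-avoid A W) W≤w slack) (shave hB (#-avoid B W) W≤w slack)

    abstract
      edge-avoid : ∀ {w} → r + 2 * w ≤ g → ∀ A B W → length W ≤ w → n ≤ 2 * # A + r → n ≤ 2 * # B + r →
        Σ V λ a → Σ V λ b → A a ≡ true × B b ≡ true × F a b ≡ true × a ∉ W × b ∉ W
      edge-avoid slack A B W W≤w hA hB
        with cnt-∃ _ (allFin n) (≤-trans 0<t (expand-avoid slack A B W W≤w hA hB))
      ... | a , _ , ea with ∧-elim ((A ∖ W) a) ea
      ... | ea₁ , ea₂ with ∧-elim (A a) ea₁ | cnt-∃ _ (allFin n) (≤-trans 0<t (≤ᵇ≡true⇒≤ ea₂))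
      ... | Aa , a∉ | b , _ , eb with ∧-elim ((B ∖ W) b) eb
      ... | eb₁ , Fab with ∧-elim (B b) eb₁
      ... | Bb , b∉ = a , b , Aa , Bb , Fab , ∉ᵇ⇒∉ (not-elim a∉) , ∉ᵇ⇒∉ (not-elim b∉)

    links : V → V → V × V → Bool
    links z w (p , q) = F p z ∧ F w q

    good : List V → V × V → V → V → Bool
    good W (p , q) z w = (F p ∖ W) z ∧ (((λ v → F v q) ∖ W) w ∧ F z w)

    -- Expansion from N⁺(p) to N⁻(q), both without W, gives t vertices z that have t partners w
    -- each.
    good-many : ∀ {k} → r + 2 * k ≤ g → ∀ W → length W ≤ k → ∀ pq →
      t * t ≤ Σℓ (λ z → # (good W pq z)) (allFin n)
    good-many slack W W≤ (p , q) = begin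
      t * t ≤⟨ *-monoʳ-≤ t (expand-avoid slack (F p) (λ v → F v q) W W≤ (outdeg≥ p) (indeg≥ q)) ⟩
      t * # rich ≡⟨ Σℓ-* t (λ z → ⟨ rich z ⟩) (allFin n) ⟨
      Σℓ (λ z → t * ⟨ rich z ⟩) (allFin n) ≤⟨ Σℓ-mono pointwise (allFin n) ⟩
      Σℓ (λ z → # (good W (p , q) z)) (allFin n) ∎
      where
      open ≤-Reasoning
      B : V → V → Bool
      B z b = ((λ v → F v q) ∖ W) b ∧ F z b
      rich : V → Bool
      rich z = (F p ∖ W) z ∧ (t ≤ᵇ # (B z))
      pointwise : ∀ z → t * ⟨ rich z ⟩ ≤ # (good W (p , q) z)
      pointwise z with (F p ∖ W) z
      ... | false = ≤-trans (≤-reflexive (*-zeroʳ t)) z≤n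
      ... | true with t ≤ᵇ # (B z) in e
      ... | true = ≤-trans (≤-reflexive (*-identityʳ t)) (≤ᵇ≡true⇒≤ e)
      ... | false = ≤-trans (≤-reflexive (*-zeroʳ t)) z≤n

    Σℓ²-max : (f : V → V → ℕ) → V → Σ V λ z → Σ V λ w → Σℓ (λ z → Σℓ (f z) (allFin n)) (allFin n) ≤ n * (n * f z w)
    Σℓ²-max f v with Σℓ-max (λ z → Σℓ (f z) (allFin n)) v (allFin n)
    ... | z , hz with Σℓ-max (f z) v (allFin n)
    ... | w , hw = z , w , (begin
      Σℓ (λ z → Σℓ (f z) (allFin n)) (allFin n) ≤⟨ hz ⟩
      length (allFin n) * Σℓ (f z) (allFin n) ≤⟨ *-monoʳ-≤ (length (allFin n)) hw ⟩
      length (allFin n) * (length (allFin n) * f z w) ≡⟨ cong (λ l → l * (l * f z w)) (length-allFin n) ⟩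
      n * (n * f z w) ∎)
      where
      open ≤-Reasoning

    good-elim : ∀ W pq z w → good W pq z w ≡ true → (z ∉ W × w ∉ W × F z w ≡ true) × links z w pq ≡ true
    good-elim W (p , q) z w e with ∧-elim ((F p ∖ W) z) e
    ... | e₁ , e₂ with ∧-elim (F p z) e₁ | ∧-elim (((λ v → F v q) ∖ W) w) e₂
    ... | Fpz , z∉ | e₃ , Fzw with ∧-elim (F w q) e₃
    ... | Fwq , w∉ = (∉ᵇ⇒∉ (not-elim z∉) , ∉ᵇ⇒∉ (not-elim w∉) , Fzw) , ∧-intro Fpz Fwq

    link-good : ∀ W z w (U : List (V × V)) → 0 < cnt (λ pq → good W pq z w) U → z ∉ W × w ∉ W × F z w ≡ true
    link-good W z w U 0<f with cnt-∃ _ U 0<f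
    ... | pq , _ , e = proj₁ (good-elim W pq z w e)

    good-total : ∀ {k} → r + 2 * k ≤ g → ∀ W → length W ≤ k → (U : List (V × V)) →
      (t * t) * length U ≤ Σℓ (λ z → Σℓ (λ w → cnt (λ pq → good W pq z w) U) (allFin n)) (allFin n)
    good-total slack W W≤ U = begin
      (t * t) * length U ≤⟨ Σℓ-≥-const (t * t) U (λ pq _ → good-many slack W W≤ pq) ⟩
      Σℓ (λ pq → Σℓ (λ z → # (good W pq z)) (allFin n)) U
        ≡⟨ Σℓ-comm (λ pq z → # (good W pq z)) U (allFin n) ⟩
      Σℓ (λ z → Σℓ (λ pq → # (good W pq z)) U) (allFin n)
        ≤⟨ Σℓ-mono (λ z → ≤-reflexive (Σℓ-comm (λ pq w → ⟨ good W pq z w ⟩) U (allFin n))) (allFin n) ⟩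
      Σℓ (λ z → Σℓ (λ w → cnt (λ pq → good W pq z w) U) (allFin n)) (allFin n) ∎
      where open ≤-Reasoning

    abstract
      -- Double counting: every pair is served by at least t² edges z → w, and there are at most n²
      -- ≤ (T t)² choices of (z, w), so one of them serves a share 1/T² of the open pairs.
      best-link : ∀ {k} T → n ≤ T * t → r + 2 * k ≤ g → ∀ W → length W ≤ k → ∀ x (open-pairs : List (V × V)) →
        Σ V λ z → Σ V λ w → z ∉ W × w ∉ W × F z w ≡ true ×
          length (x ∷ open-pairs) ≤ (T * T) * cnt (links z w) (x ∷ open-pairs)
      best-link {k} T n≤Tt slack W W≤ x xs = pick (Σℓ²-max (λ z w → cnt (λ pq → good W pq z w) (x ∷ xs)) (proj₁ x))
        where
        pick : (Σ V λ z → Σ V λ w → Σℓ (λ z → Σℓ (λ w → cnt (λ pq → good W pq z w) (x ∷ xs)) (allFin n)) (allFin n)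
                  ≤ n * (n * cnt (λ pq → good W pq z w) (x ∷ xs))) →
          Σ V λ z → Σ V λ w → z ∉ W × w ∉ W × F z w ≡ true × length (x ∷ xs) ≤ (T * T) * cnt (links z w) (x ∷ xs)
        pick (z , w , h) = z , w , proj₁ zwF , proj₁ (proj₂ zwF) , proj₂ (proj₂ zwF) ,
          ≤-trans bound (*-monoʳ-≤ (T * T) (cnt-mono (λ pq e → proj₂ (good-elim W pq z w e)) (x ∷ xs)))
          where
          bound : length (x ∷ xs) ≤ (T * T) * cnt (λ pq → good W pq z w) (x ∷ xs)
          bound = share {T} n≤Tt 0<t (≤-trans (good-total slack W W≤ (x ∷ xs)) h)
          zwF : z ∉ W × w ∉ W × F z w ≡ true
          zwF = link-good W z w (x ∷ xs) (positive (T * T) bound)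

  -- With `suc x` = T², u open pairs and f gadgets still allowed, the invariant
  -- `x ^ f * u < suc x ^ f` says u < (1 - 1/T²)^(-f). A gadget leaves at most the fraction x/(x +
  -- 1) of the pairs open, so the invariant passes from f + 1 to f.
  drop-link : ∀ x {c u u′ f} → c + u′ ≡ u → u ≤ suc x * c → x ^ suc f * u < suc x ^ suc f → x ^ f * u′ < suc x ^ f
  drop-link x {c} {_} {u′} {f} refl h₁ h₂ = *-cancelˡ-< (suc x) _ _ (begin-strict
    suc x * (x ^ f * u′) ≡⟨ rearrange x (x ^ f) u′ ⟩
    x ^ f * (suc x * u′) ≤⟨ *-monoʳ-≤ (x ^ f) (lin 0 h₁ (id x c u′)) ⟩
    x ^ f * (x * (c + u′)) ≡⟨ rearrange′ x (x ^ f) (c + u′) ⟩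
    x * x ^ f * (c + u′) <⟨ h₂ ⟩
    suc x * suc x ^ f ∎)
    where
    open ≤-Reasoning
    rearrange : ∀ x y u → suc x * (y * u) ≡ y * (suc x * u)
    rearrange = solve-∀
    rearrange′ : ∀ x y u → y * (x * u) ≡ x * y * u
    rearrange′ = solve-∀
    id : ∀ x c u → x * (c + u) + (c + u) ≡ suc x * u + suc x * c + 0
    id = solve-∀

  -- Walks and the absorbing path

  module Walks {n : ℕ} (F : Fin n → Fin n → Bool) where

    infixr 5 _∷_
    -- The list of a walk contains its last vertex but not its first.
    data Walk : Fin n → List (Fin n) → Fin n → Set where
      [] : ∀ {s} → Walk s [] s
      _∷_ : ∀ {s y L e} → F s y ≡ true → Walk y L e → Walk s (y ∷ L) e

    _⊕_ : ∀ {s L m M e} → Walk s L m → Walk m M e → Walk s (L ++ M) e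
    [] ⊕ q = q
    (x ∷ p) ⊕ q = x ∷ (p ⊕ q)

  module Absorb {n : ℕ} (F : Fin n → Fin n → Bool) (irr : ∀ v → F v v ≡ false) (r g t : ℕ)
    (outdeg≥ : ∀ v → n ≤ 2 * # (F v) + r)
    (indeg≥ : ∀ v → n ≤ 2 * # (λ u → F u v) + r)
    (expand : ∀ A B → n ≤ 2 * # A + g → n ≤ 2 * # B + g →
              t ≤ # (λ a → A a ∧ (t ≤ᵇ # (λ b → B b ∧ F a b))))
    (0<t : 0 < t) where

    open Expand F r g t outdeg≥ indeg≥ expand 0<t

    open Walks F

    -- Stated as extendability to an enumeration of all vertices: the complement `U` comes along,
    -- and in the end it is the set that the paths have to cover.
    Distinct : List V → Set
    Distinct W = Σ (List V) λ U → W ++ U ↭ allFin n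

    distinct-∷ : ∀ {W x} → Distinct W → x ∉ W → Distinct (x ∷ W)
    distinct-∷ {W} {x} (U , p) x∉W with ∈-++⁻ W (∈-resp-↭ (↭-sym p) (∈-allFin x))
    ... | inj₁ m = contradiction m x∉W
    ... | inj₂ m with ∈⇒↭ m
    ... | U′ , q = U′ , ↭-trans (↭-sym (shift x W U′)) (↭-trans (++⁺ˡ W (↭-sym q)) p)

    distinct-↭ : ∀ {W W′} → W ↭ W′ → Distinct W → Distinct W′
    distinct-↭ q (U , p) = U , ↭-trans (++⁺ʳ U (↭-sym q)) p

    F⇒≢ : ∀ {u v} → F u v ≡ true → u ≢ v
    F⇒≢ {u} e refl = true≢false e (irr u)

    ∉-∷ : ∀ {x y : V} {W} → x ≢ y → x ∉ W → x ∉ y ∷ W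
    ∉-∷ ne _ (here e) = ne e
    ∉-∷ _ nm (there m) = nm m

    -- The vertices `c` and `d` attach the gadget to the end `e` of the path built so far: expansion
    -- yields an edge from N⁺(e) to N⁻(a), hence a connection of length three.
    record Gadget (e : V) (z w : V) (W : List V) : Set where
      field
        c d a b : V
        e→c : F e c ≡ true
        c→d : F c d ≡ true
        d→a : F d a ≡ true
        a→z : F a z ≡ true
        w→b : F w b ≡ true
        a→b : F a b ≡ true
        fresh : Distinct (c ∷ d ∷ a ∷ z ∷ w ∷ b ∷ W)

    abstract
      gadget : ∀ {k} → r + 2 * k ≤ g → ∀ e z w W → 4 + length W ≤ k → Distinct W → z ∉ W → w ∉ W →
        F z w ≡ true → Gadget e z w W
      gadget slack e z w W W≤ D z∉ w∉ z→w
        with edge-avoid slack (λ v → F v z) (F w) (z ∷ w ∷ W) (≤-trans (+-monoˡ-≤ (length W) {2} {4} (s≤s (s≤s z≤n))) W≤) (indeg≥ z) (outdeg≥ w)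
      ... | a , b , a→z , w→b , a→b , a∉ , b∉
        with edge-avoid slack (F e) (λ v → F v a) (a ∷ z ∷ w ∷ b ∷ W) W≤ (outdeg≥ e) (indeg≥ a)
      ... | c , d , e→c , d→a , c→d , c∉ , d∉ = record
        { c = c ; d = d ; a = a ; b = b ; e→c = e→c ; c→d = c→d ; d→a = d→a ; a→z = a→z ; w→b = w→b ; a→b = a→b
        ; fresh = distinct-∷ (distinct-∷ D₄ d∉) (∉-∷ (F⇒≢ c→d) c∉) }
        where
        D₂ : Distinct (z ∷ w ∷ W)
        D₂ = distinct-∷ (distinct-∷ D w∉) (∉-∷ (F⇒≢ z→w) z∉)
        D₄ : Distinct (a ∷ z ∷ w ∷ b ∷ W)
        D₄ = distinct-↭ (prep a (shifts (b ∷ []) (z ∷ w ∷ [])))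
               (distinct-∷ (distinct-∷ D₂ b∉) (∉-∷ (F⇒≢ a→b) a∉))

    -- Releasing the link keeps both ends of the walk, so an absorbing segment remains absorbing
    -- inside any longer walk.
    Absorbs : V → List V → V → V × V → Set
    Absorbs s Q e (p , q) = Σ V λ z → Σ V λ w → Σ (List V) λ Q′ →
      Q ↭ z ∷ w ∷ Q′ × Walk s Q′ e × F p z ≡ true × F z w ≡ true × F w q ≡ true

    absorbs-⊕ : ∀ {s L m M e} pq → Walk s L m → Absorbs m M e pq → Absorbs s (L ++ M) e pq
    absorbs-⊕ {L = L} (p , q) wk (z , w , Q′ , perm , wk′ , h) =
      z , w , L ++ Q′ , ↭-trans (++⁺ˡ L perm) (shifts L (z ∷ w ∷ [])) , wk ⊕ wk′ , h

    ⊕-absorbs : ∀ {s L m M e} pq → Absorbs s L m pq → Walk m M e → Absorbs s (L ++ M) e pq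
    ⊕-absorbs {M = M} (p , q) (z , w , Q′ , perm , wk′ , h) wk =
      z , w , Q′ ++ M , ++⁺ʳ M perm , wk′ ⊕ wk , h

    -- Each new gadget serves a fixed proportion of the pairs not yet served.
    abstract
      absorb-all : ∀ {k T x} → n ≤ T * t → T * T ≡ suc x → r + 2 * k ≤ g →
        ∀ f e W (U : List (V × V)) → Distinct W → length W + 6 * f ≤ k → x ^ f * length U < suc x ^ f →
        Σ (List V) λ Q → Σ V λ e′ → Walk e Q e′ × Distinct (Q ++ W) × length Q ≤ 6 * f ×
          (∀ {pq} → pq ∈ U → Absorbs e Q e′ pq)
      absorb-all _ _ _ f e W [] D _ _ = [] , e , [] , D , z≤n , λ ()
      -- For `f = 0` the invariant says that fewer than one pair is open.
      absorb-all {x = x} _ _ _ zero e W (pq ∷ U) D _ h = ⊥-elim (1+n≰n (≤-trans h (s≤s z≤n)))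
      absorb-all {k} {T} {x} n≤ TT slack (suc f) e W (pq ∷ U) D W≤ h
        with best-link T n≤ slack W (≤-trans (m≤m+n (length W) _) W≤) pq U
      ... | z , w , z∉ , w∉ , z→w , cover = extend (gadget slack e z w W (≤-trans (bound (length W) f) W≤) D z∉ w∉ z→w)
        where
        bound : ∀ l f → 4 + l ≤ l + 6 * suc f
        bound l f = lin (2 + 6 * f) (z≤n {0}) (id l f)
          where
          id : ∀ l f → l + 6 * suc f + 0 ≡ 4 + l + 0 + (2 + 6 * f)
          id = solve-∀
        rest : List (V × V)
        rest = filterᵇ (λ uv → not (links z w uv)) (pq ∷ U)
        remaining : x ^ f * length rest < suc x ^ f
        remaining = drop-link x {f = f}
          (trans (cong (cnt (links z w) (pq ∷ U) +_) (sym (cnt≡length-filterᵇ (λ uv → not (links z w uv)) (pq ∷ U))))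
            (cnt-not (links z w) (pq ∷ U)))
          (subst (λ m → length (pq ∷ U) ≤ m * cnt (links z w) (pq ∷ U)) TT cover) h
        extend : Gadget e z w W → Σ (List V) λ Q → Σ V λ e′ → Walk e Q e′ × Distinct (Q ++ W) × length Q ≤ 6 * suc f ×
          (∀ {uv} → uv ∈ pq ∷ U → Absorbs e Q e′ uv)
        extend G = finish (absorb-all {T = T} n≤ TT slack f b (c ∷ d ∷ a ∷ z ∷ w ∷ b ∷ W) rest fresh
            (≤-trans (≤-reflexive (id (length W) f)) W≤) remaining)
          where
          open Gadget G
          id : ∀ l f → 6 + l + 6 * f ≡ l + 6 * suc f
          id = solve-∀
          seg : List V
          seg = c ∷ d ∷ a ∷ z ∷ w ∷ b ∷ []
          path : Walk e seg b
          path = e→c ∷ c→d ∷ d→a ∷ a→z ∷ z→w ∷ w→b ∷ []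
          finish : (Σ (List V) λ Q → Σ V λ e′ → Walk b Q e′ × Distinct (Q ++ seg ++ W) × length Q ≤ 6 * f ×
            (∀ {uv} → uv ∈ rest → Absorbs b Q e′ uv)) →
            Σ (List V) λ Q → Σ V λ e′ → Walk e Q e′ × Distinct (Q ++ W) × length Q ≤ 6 * suc f ×
            (∀ {uv} → uv ∈ pq ∷ U → Absorbs e Q e′ uv)
          finish (Q , e′ , wk , D′ , Q≤ , abs) =
            seg ++ Q , e′ , path ⊕ wk ,
            distinct-↭ (shifts Q seg) D′ ,
            ≤-trans (+-monoʳ-≤ 6 Q≤) (≤-reflexive (id 0 f)) , serve
            where
            serve : ∀ {uv} → uv ∈ pq ∷ U → Absorbs e (seg ++ Q) e′ uv
            serve {u , v} m with links z w (u , v) in eq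
            -- Without z and w the new gadget is traversed as e → c → d → a → b.
            ... | true = ⊕-absorbs (u , v)
              (z , w , c ∷ d ∷ a ∷ b ∷ [] , shifts (c ∷ d ∷ a ∷ []) (z ∷ w ∷ []) , e→c ∷ c→d ∷ d→a ∷ a→b ∷ [] ,
                proj₁ (∧-elim (F u z) eq) , z→w , proj₂ (∧-elim (F u z) eq)) wk
            ... | false = absorbs-⊕ (u , v) path (abs (∈-filter⁺ (λ uv → T? (not (links z w uv))) m (Equivalence.from T-≡ (cong not eq))))

    -- A segment promises a single release: after it, nothing is claimed about the remaining walk.
    -- Each link to be made therefore gets a layer of its own.
    data Absorber : ℕ → V → List V → V → Set where
      [] : ∀ {s} → Absorber 0 s [] s
      layer : ∀ {m s Q x R e} → (∀ pq → Absorbs s Q x pq) → Walk s Q x → Absorber m x R e → Absorber (suc m) s (Q ++ R) e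

    absorber-walk : ∀ {m s Q e} → Absorber m s Q e → Walk s Q e
    absorber-walk [] = []
    absorber-walk (layer _ wk A) = wk ⊕ absorber-walk A

    abstract
      -- Every layer starts with all n² pairs open, whence the condition on `f`; earlier layers are
      -- kept disjoint by moving them into `W`.
      absorber : ∀ {k T x} → n ≤ T * t → T * T ≡ suc x → r + 2 * k ≤ g →
        ∀ f → x ^ f * (n * n) < suc x ^ f →
        ∀ m e W → Distinct W → length W + m * (6 * f) ≤ k →
        Σ (List V) λ Q → Σ V λ e′ → Absorber m e Q e′ × Distinct (Q ++ W) × length Q ≤ m * (6 * f)
      absorber n≤ TT slack f h zero e W D W≤ = [] , e , [] , D , z≤n
      absorber {T = T} {x} n≤ TT slack f h (suc m) e W D W≤
        with absorb-all {T = T} n≤ TT slack f e W (cartesianProduct (allFin n) (allFin n)) D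
               (≤-trans (+-monoʳ-≤ (length W) (m≤m+n (6 * f) _)) W≤)
               (subst (λ l → x ^ f * l < suc x ^ f) (sym size) h)
        where
        size : length (cartesianProduct (allFin n) (allFin n)) ≡ n * n
        size = trans (length-cartesianProduct (allFin n) (allFin n)) (cong₂ _*_ (length-allFin n) (length-allFin n))
      ... | Q , x′ , wk , D′ , Q≤ , abs
        with absorber {T = T} n≤ TT slack f h m x′ (Q ++ W) D′
               (≤-trans (≤-trans (+-monoˡ-≤ (m * (6 * f)) (≤-trans (≤-reflexive (length-++ Q)) (+-monoˡ-≤ (length W) Q≤)))
                 (≤-reflexive (id (6 * f) (length W) (m * (6 * f))))) W≤)
        where
        id : ∀ a b c → a + b + c ≡ b + (a + c)
        id = solve-∀
      ... | R , e′ , A , D″ , R≤ =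
        Q ++ R , e′ , layer (λ { (p , q) → abs (∈-cartesianProduct⁺ (∈-allFin p) (∈-allFin q)) }) wk A ,
        distinct-↭ (↭-trans (shifts R Q) (↭-reflexive (sym (++-assoc Q R W)))) D″ ,
        ≤-trans (≤-reflexive (length-++ Q)) (+-mono-≤ Q≤ R≤)

  -- Auxiliary facts on lists and their rearrangements

  search : {A : Set} (p : A → Bool) (xs : List A) → (Σ A λ x → x ∈ xs × p x ≡ true) ⊎ (∀ x → x ∈ xs → p x ≡ false)
  search p [] = inj₂ λ _ ()
  search p (x ∷ xs) with p x in e | search p xs
  ... | true | _ = inj₁ (x , here refl , e)
  ... | false | inj₁ (y , m , q) = inj₁ (y , there m , q)
  ... | false | inj₂ none = inj₂ λ { _ (here refl) → e ; y (there m) → none y m }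

  -- The first k entries contain at most k hits, so some hit lies behind them.
  cnt-far : {A : Set} (p : A → Bool) (k : ℕ) (xs : List A) → k < cnt p xs →
    Σ (List A) λ L₁ → Σ A λ a → Σ (List A) λ L₂ → xs ≡ L₁ ++ a ∷ L₂ × p a ≡ true × k ≤ length L₁
  cnt-far p zero (x ∷ xs) h with p x in e
  ... | true = [] , x , xs , refl , e , z≤n
  ... | false with cnt-far p zero xs h
  ... | L₁ , a , L₂ , refl , q , _ = x ∷ L₁ , a , L₂ , refl , q , z≤n
  cnt-far p (suc k) (x ∷ xs) h with cnt-far p k xs (s≤s⁻¹ (≤-trans h (+-monoˡ-≤ (cnt p xs) (⟨⟩≤1 (p x)))))
  ... | L₁ , a , L₂ , refl , q , le = x ∷ L₁ , a , L₂ , refl , q , s≤s le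

  concatMap-↭ : {A B : Set} (f : A → List B) {xs ys : List A} → xs ↭ ys → concatMap f xs ↭ concatMap f ys
  concatMap-↭ f ↭refl = ↭refl
  concatMap-↭ f (prep x p) = ++⁺ˡ (f x) (concatMap-↭ f p)
  concatMap-↭ f (swap {xs} x y p) = ↭-trans (shifts (f x) (f y)) (++⁺ˡ (f y) (++⁺ˡ (f x) (concatMap-↭ f p)))
  concatMap-↭ f (↭trans p q) = ↭-trans (concatMap-↭ f p) (concatMap-↭ f q)

  Σℓ-concatMap : {A B : Set} (g : B → ℕ) (f : A → List B) (xs : List A) →
    Σℓ g (concatMap f xs) ≡ Σℓ (λ x → Σℓ g (f x)) xs
  Σℓ-concatMap g f [] = refl
  Σℓ-concatMap g f (x ∷ xs) = trans (Σℓ-++ g (f x) (concatMap f xs)) (cong (Σℓ g (f x) +_) (Σℓ-concatMap g f xs))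

  length-Σℓ : {A : Set} (xs : List A) → length xs ≡ Σℓ (λ _ → 1) xs
  length-Σℓ xs = sym (trans (Σℓ-const 1 xs) (*-identityˡ (length xs)))

  pick-small : {A : Set} (f : A → ℕ) (p : ℕ) (xs : List A) → Σℓ f xs < suc p * length xs →
    Σ A λ x → Σ (List A) λ ys → xs ↭ x ∷ ys × f x ≤ p
  pick-small f p [] h = ⊥-elim (1+n≰n (≤-trans h (≤-trans (≤-reflexive (*-zeroʳ p)) z≤n)))
  pick-small f p (x ∷ xs) h with f x ≤? p
  ... | yes le = x , xs , ↭refl , le
  ... | no gt with pick-small f p xs (+-cancelˡ-< (suc p) _ _
          (≤-trans (s≤s (+-monoˡ-≤ (Σℓ f xs) (≰⇒> gt))) (≤-trans h (≤-reflexive (*-suc (suc p) (length xs))))))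
  ... | y , ys , perm , le = y , x ∷ ys , ↭-trans (prep x perm) (swap x y ↭refl) , le

  module _ {A : Set} where
    open CM (++-commutativeMonoid {A = A})

    perm₃ : (a b c x : List A) → (a ++ c) ++ b ++ x ↭ a ++ b ++ c ++ x
    perm₃ = solve 4 (λ a b c x → (a ⊕ c) ⊕ b ⊕ x ⊜ a ⊕ b ⊕ c ⊕ x) ↭refl

    perm₃′ : (a b c x : List A) → (c ++ b) ++ a ++ x ↭ a ++ b ++ c ++ x
    perm₃′ = solve 4 (λ a b c x → (c ⊕ b) ⊕ a ⊕ x ⊜ a ⊕ b ⊕ c ⊕ x) ↭refl

    perm₅ : (a b c d x : List A) → (a ++ d) ++ b ++ c ++ x ↭ a ++ b ++ (c ++ d) ++ x
    perm₅ = solve 5 (λ a b c d x → (a ⊕ d) ⊕ b ⊕ c ⊕ x ⊜ a ⊕ b ⊕ (c ⊕ d) ⊕ x) ↭refl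

    perm₇ : (a b c d e f x : List A) →
      (a ++ d) ++ (c ++ f) ++ (e ++ b) ++ x ↭ a ++ b ++ (c ++ d) ++ (e ++ f) ++ x
    perm₇ = solve 7 (λ a b c d e f x → (a ⊕ d) ⊕ (c ⊕ f) ⊕ (e ⊕ b) ⊕ x ⊜ a ⊕ b ⊕ (c ⊕ d) ⊕ (e ⊕ f) ⊕ x) ↭refl

  -- The two sides differ by 2b(a - p). Here p is the length of the short path, and a + b that of
  -- the path giving up its tail of length b.
  squares : ∀ p a b → p < a → 0 < b → (p + b) * (p + b) + a * a < p * p + (a + b) * (a + b)
  squares p a b p<a 0<b = begin-strict
    (p + b) * (p + b) + a * a ≡⟨ id₁ p a b ⟩
    p * p + a * a + b * b + 2 * b * p <⟨ +-monoʳ-< (p * p + a * a + b * b) (*-monoʳ-< (2 * b) {{>-nonZero (*-mono-≤ {1} {2} (s≤s z≤n) 0<b)}} p<a) ⟩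
    p * p + a * a + b * b + 2 * b * a ≡⟨ id₂ p a b ⟩
    p * p + (a + b) * (a + b) ∎
    where
    open ≤-Reasoning
    id₁ : ∀ p a b → (p + b) * (p + b) + a * a ≡ p * p + a * a + b * b + 2 * b * p
    id₁ = solve-∀
    id₂ : ∀ p a b → p * p + a * a + b * b + 2 * b * a ≡ p * p + (a + b) * (a + b)
    id₂ = solve-∀

  -- Covering the remaining vertices by boundedly many paths

  module Cover {n : ℕ} (F : Fin n → Fin n → Bool) (irr : ∀ v → F v v ≡ false) (r g t : ℕ)
    (outdeg≥ : ∀ v → n ≤ 2 * # (F v) + r)
    (indeg≥ : ∀ v → n ≤ 2 * # (λ u → F u v) + r)
    (expand : ∀ A B → n ≤ 2 * # A + g → n ≤ 2 * # B + g →
              t ≤ # (λ a → A a ∧ (t ≤ᵇ # (λ b → B b ∧ F a b))))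
    (0<t : 0 < t) where

    open Walks F
    open Absorb F irr r g t outdeg≥ indeg≥ expand 0<t
    open Expand F r g t outdeg≥ indeg≥ expand 0<t

    record Path : Set where
      constructor path
      field
        {head} : V
        {tail} : List V
        {last} : V
        walk : Walk head tail last
    open Path

    vertices : Path → List V
    vertices P = head P ∷ tail P

    len : Path → ℕ
    len P = length (vertices P)

    join : ∀ P Q → F (last P) (head Q) ≡ true → Path
    join P Q e = path (walk P ⊕ (e ∷ walk Q))

    vs : List Path → List V
    vs = concatMap vertices

    energy : List Path → ℕ
    energy = Σℓ (λ P → len P * len P)

    -- The lexicographic order on (number of paths, sum of squared lengths), on which `path-cover`
    -- recurses.
    Better : List Path → Set
    Better Ps = Σ (List Path) λ Qs → vs Qs ↭ vs Ps ×
      (length Qs < length Ps ⊎ (length Qs ≡ length Ps × energy Qs < energy Ps))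

    -- A path can be cut right behind such a vertex; the back part then starts with a vertex
    -- satisfying `q`. For `succs` it is the front part that ends with one.
    preds : (V → Bool) → V → List V → List V
    preds q h [] = []
    preds q h (y ∷ L) = if q y then h ∷ preds q y L else preds q y L

    succs : (V → Bool) → V → List V → List V
    succs q h [] = []
    succs q h (y ∷ L) = if q h then y ∷ succs q y L else succs q y L

    -- Distinct vertices have distinct predecessors on the path. The head has none, which is why
    -- only `L` is counted on the left.
    cnt-preds : ∀ (A q : V → Bool) h L → (∀ {x} → x ∈ preds q h L → A x ≡ true) → cnt q L ≤ cnt A (h ∷ L)
    cnt-preds A q h [] sub = z≤n
    cnt-preds A q h (y ∷ L) sub with q y
    ... | false = ≤-trans (cnt-preds A q y L sub) (m≤n+m _ ⟨ A h ⟩)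
    ... | true = ≤-trans (+-monoʳ-≤ 1 (cnt-preds A q y L (λ m → sub (there m))))
      (+-monoˡ-≤ (cnt A (y ∷ L)) (⟨⟩-mono {true} (λ _ → sub (here refl))))

    -- The counterpart of `cnt-preds`: the last vertex has no successor, and `q l ≡ false` ensures
    -- that it is not counted.
    cnt-succs : ∀ (B q : V → Bool) {h L l} → Walk h L l → q l ≡ false → (∀ {x} → x ∈ succs q h L → B x ≡ true) →
      cnt q (h ∷ L) ≤ cnt B L
    cnt-succs B q [] e sub rewrite e = z≤n
    cnt-succs B q {h} {y ∷ L} (_ ∷ wk) e sub with q h
    ... | false = ≤-trans (cnt-succs B q wk e sub) (m≤n+m _ ⟨ B y ⟩)
    ... | true = +-mono-≤ (⟨⟩-mono {true} (λ _ → sub (here refl))) (cnt-succs B q wk e (λ m → sub (there m)))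

    record Cut (P : Path) (end start : V) : Set where
      constructor cut
      field
        {before after} : List V
        split : vertices P ≡ (head P ∷ before) ++ start ∷ after
        edge : F end start ≡ true
        front : Walk (head P) before end
        back : Walk start after (last P)
    open Cut

    cut-∷ : ∀ {h y L l x a} {wk : Walk y L l} (e : F h y ≡ true) → Cut (path wk) x a → Cut (path (e ∷ wk)) x a
    cut-∷ {h} e (cut s ed fr bk) = cut (cong (h ∷_) s) ed (e ∷ fr) bk

    cut-at : ∀ {h l a} L₁ L₂ (wk : Walk h (L₁ ++ a ∷ L₂) l) →
      Σ V λ x → Σ (Cut (path wk) x a) λ c → before c ≡ L₁ × after c ≡ L₂
    cut-at [] L₂ (e ∷ wk) = _ , cut refl e [] wk , refl , refl
    cut-at (y ∷ L₁) L₂ (e ∷ wk) with cut-at L₁ L₂ wk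
    ... | x , c , refl , refl = x , cut-∷ e c , refl , refl

    preds-cut : ∀ q {h L l x} (wk : Walk h L l) → x ∈ preds q h L → Σ V λ a → q a ≡ true × Cut (path wk) x a
    preds-cut q {L = y ∷ L} (e ∷ wk) m with q y in eq
    preds-cut q {L = y ∷ L} (e ∷ wk) (here refl) | true = y , eq , cut refl e [] wk
    preds-cut q {L = y ∷ L} (e ∷ wk) (there m) | true with preds-cut q wk m
    ... | a , qa , c = a , qa , cut-∷ e c
    preds-cut q {L = y ∷ L} (e ∷ wk) m | false with preds-cut q wk m
    ... | a , qa , c = a , qa , cut-∷ e c

    succs-cut : ∀ q {h L l x} (wk : Walk h L l) → x ∈ succs q h L → Σ V λ b → q b ≡ true × Cut (path wk) b x
    succs-cut q {h} {L = y ∷ L} (e ∷ wk) m with q h in eq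
    succs-cut q {h} {L = y ∷ L} (e ∷ wk) (here refl) | true = h , eq , cut refl e [] wk
    succs-cut q {h} {L = y ∷ L} (e ∷ wk) (there m) | true with succs-cut q wk m
    ... | a , qa , c = a , qa , cut-∷ e c
    succs-cut q {h} {L = y ∷ L} (e ∷ wk) m | false with succs-cut q wk m
    ... | a , qa , c = a , qa , cut-∷ e c

    front-path back-path : ∀ {P x a} → Cut P x a → Path
    front-path c = path (front c)
    back-path c = path (back c)

    len≡ : ∀ {P x a} (c : Cut P x a) → len P ≡ len (front-path c) + len (back-path c)
    len≡ {P} c = trans (cong length (split c)) (length-++ (head P ∷ before c))

    vs-split : ∀ {P x a} (c : Cut P x a) → vertices P ≡ vertices (front-path c) ++ vertices (back-path c)
    vs-split c = split c

    better-via : ∀ {Ps Ps′} → Ps ↭ Ps′ → Better Ps′ → Better Ps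
    better-via {Ps} {Ps′} perm (Qs , q , h) = Qs , ↭-trans q (concatMap-↭ vertices (↭-sym perm)) , measure h
      where
      measure : length Qs < length Ps′ ⊎ (length Qs ≡ length Ps′ × energy Qs < energy Ps′) →
        length Qs < length Ps ⊎ (length Qs ≡ length Ps × energy Qs < energy Ps)
      measure (inj₁ lt) = inj₁ (≤-trans lt (≤-reflexive (↭-length (↭-sym perm))))
      measure (inj₂ (eq , lt)) = inj₂ (trans eq (↭-length (↭-sym perm)) ,
        ≤-trans lt (≤-reflexive (Σℓ-↭ (λ P → len P * len P) (↭-sym perm))))

    append-to-head : ∀ P₁ P₂ R Rs → F (last P₁) (head R) ≡ true → Better (P₁ ∷ P₂ ∷ R ∷ Rs)
    append-to-head P₁ P₂ R Rs e = join P₁ R e ∷ P₂ ∷ Rs ,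
      perm₃ (vertices P₁) (vertices P₂) (vertices R) (vs Rs) , inj₁ ≤-refl

    prepend-to-last : ∀ P₁ P₂ R Rs → F (last R) (head P₂) ≡ true → Better (P₁ ∷ P₂ ∷ R ∷ Rs)
    prepend-to-last P₁ P₂ R Rs e = join R P₂ e ∷ P₁ ∷ Rs ,
      perm₃′ (vertices P₁) (vertices P₂) (vertices R) (vs Rs) , inj₁ ≤-refl

    -- Exchanging tails shortens the longer path, so the sum of the squared lengths drops.
    exchange-tails : ∀ P₁ P₂ R Rs {x a} (c : Cut R x a) → F (last P₁) a ≡ true → len P₁ < len (front-path c) →
      Better (P₁ ∷ P₂ ∷ R ∷ Rs)
    exchange-tails P₁ P₂ R Rs c e lt = join P₁ (back-path c) e ∷ P₂ ∷ front-path c ∷ Rs ,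
      subst (λ l → vs (join P₁ (back-path c) e ∷ P₂ ∷ front-path c ∷ Rs) ↭ vertices P₁ ++ vertices P₂ ++ l ++ vs Rs)
        (sym (vs-split c)) (perm₅ (vertices P₁) (vertices P₂) (vertices (front-path c)) (vertices (back-path c)) (vs Rs)) ,
      inj₂ (refl , drop)
      where
      open ≤-Reasoning
      lenJ : len (join P₁ (back-path c) e) ≡ len P₁ + len (back-path c)
      lenJ = length-++ (vertices P₁)
      move : ∀ a b c d → a + (b + (c + d)) ≡ a + c + (b + d)
      move = solve-∀
      drop : energy (join P₁ (back-path c) e ∷ P₂ ∷ front-path c ∷ Rs) < energy (P₁ ∷ P₂ ∷ R ∷ Rs)
      drop = begin-strict
        energy (join P₁ (back-path c) e ∷ P₂ ∷ front-path c ∷ Rs)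
          ≡⟨ cong (λ l → l * l + (len P₂ * len P₂ + (len (front-path c) * len (front-path c) + energy Rs))) lenJ ⟩
        (len P₁ + len (back-path c)) * (len P₁ + len (back-path c)) +
          (len P₂ * len P₂ + (len (front-path c) * len (front-path c) + energy Rs))
          ≡⟨ move ((len P₁ + len (back-path c)) * (len P₁ + len (back-path c))) (len P₂ * len P₂) (len (front-path c) * len (front-path c)) (energy Rs) ⟩
        (len P₁ + len (back-path c)) * (len P₁ + len (back-path c)) + len (front-path c) * len (front-path c) +
          (len P₂ * len P₂ + energy Rs)
          <⟨ +-monoˡ-< (len P₂ * len P₂ + energy Rs) (squares (len P₁) (len (front-path c)) (len (back-path c)) lt (s≤s z≤n)) ⟩
        len P₁ * len P₁ + (len (front-path c) + len (back-path c)) * (len (front-path c) + len (back-path c)) +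
          (len P₂ * len P₂ + energy Rs)
          ≡⟨ cong (λ l → len P₁ * len P₁ + l * l + (len P₂ * len P₂ + energy Rs)) (sym (len≡ c)) ⟩
        len P₁ * len P₁ + len R * len R + (len P₂ * len P₂ + energy Rs)
          ≡⟨ move (len P₁ * len P₁) (len P₂ * len P₂) (len R * len R) (energy Rs) ⟨
        energy (P₁ ∷ P₂ ∷ R ∷ Rs) ∎

    -- The pieces are paired as P₁ with the back of R, the front of R with the back of S, and the
    -- front of S with P₂.
    cross : ∀ P₁ P₂ R S Rs {x a y b} (c : Cut R x a) (d : Cut S y b) →
      F (last P₁) a ≡ true → F x b ≡ true → F y (head P₂) ≡ true → Better (P₁ ∷ P₂ ∷ R ∷ S ∷ Rs)
    cross P₁ P₂ R S Rs c d e₁ e₂ e₃ =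
      Qs , subst₂ (λ l m → vs Qs ↭ vertices P₁ ++ vertices P₂ ++ l ++ m ++ vs Rs) (sym (vs-split c)) (sym (vs-split d))
        (perm₇ (vertices P₁) (vertices P₂) (vertices (front-path c)) (vertices (back-path c))
          (vertices (front-path d)) (vertices (back-path d)) (vs Rs)) , inj₁ ≤-refl
      where
      Qs : List Path
      Qs = join P₁ (back-path c) e₁ ∷ join (front-path c) (back-path d) e₂ ∷ join (front-path d) P₂ e₃ ∷ Rs

    #-decompose : ∀ q P₁ P₂ Rs W → vs (P₁ ∷ P₂ ∷ Rs) ++ W ↭ allFin n →
      # q ≡ cnt q (vertices P₁) + (cnt q (vertices P₂) + Σℓ (λ R → cnt q (vertices R)) Rs) + cnt q W
    #-decompose q P₁ P₂ Rs W perm =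
      trans (sym (Σℓ-↭ (λ x → ⟨ q x ⟩) perm))
        (trans (Σℓ-++ (λ x → ⟨ q x ⟩) (vs (P₁ ∷ P₂ ∷ Rs)) W)
          (cong (_+ cnt q W) (Σℓ-concatMap (λ x → ⟨ q x ⟩) vertices (P₁ ∷ P₂ ∷ Rs))))

    #-≤ : ∀ q P₁ P₂ Rs W → vs (P₁ ∷ P₂ ∷ Rs) ++ W ↭ allFin n →
      # q ≤ len P₁ + (len P₂ + Σℓ (λ R → cnt q (vertices R)) Rs) + length W
    #-≤ q P₁ P₂ Rs W perm = ≤-trans (≤-reflexive (#-decompose q P₁ P₂ Rs W perm))
      (+-mono-≤ (+-mono-≤ (cnt-≤-length q (vertices P₁)) (+-monoˡ-≤ _ (cnt-≤-length q (vertices P₂)))) (cnt-≤-length q W))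

    #-≥ : ∀ q P₁ P₂ Rs W → vs (P₁ ∷ P₂ ∷ Rs) ++ W ↭ allFin n → Σℓ (λ R → cnt q (vertices R)) Rs ≤ # q
    #-≥ q P₁ P₂ Rs W perm = ≤-trans (≤-trans (≤-trans (m≤n+m _ (cnt q (vertices P₂))) (m≤n+m _ (cnt q (vertices P₁)))) (m≤m+n _ (cnt q W)))
      (≤-reflexive (sym (#-decompose q P₁ P₂ Rs W perm)))

    long : Path → Bool
    long R = t ≤ᵇ len R

    -- Long paths are left out because the edge leaving a source has to end on another path: a
    -- source found by expansion has at least t out-neighbours among the targets, and a path with
    -- fewer than t vertices cannot contain them all.
    sources : (V → Bool) → Path → List V
    sources q R = if long R then [] else preds q (head R) (tail R)

    targets : (V → Bool) → Path → List V
    targets q R = succs q (head R) (tail R)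

    Σlen : ∀ Ps W → vs Ps ++ W ↭ allFin n → Σℓ len Ps ≤ n
    Σlen Ps W perm = begin
      Σℓ len Ps ≤⟨ Σℓ-mono (λ P → ≤-reflexive (length-Σℓ (vertices P))) Ps ⟩
      Σℓ (λ P → Σℓ (λ _ → 1) (vertices P)) Ps ≡⟨ Σℓ-concatMap (λ _ → 1) vertices Ps ⟨
      Σℓ (λ _ → 1) (vs Ps) ≡⟨ length-Σℓ (vs Ps) ⟨
      length (vs Ps) ≤⟨ m≤m+n _ (length W) ⟩
      length (vs Ps) + length W ≡⟨ length-++ (vs Ps) ⟨
      length (vs Ps ++ W) ≡⟨ ↭-length perm ⟩
      length (allFin n) ≡⟨ length-allFin n ⟩
      n ∎
      where open ≤-Reasoning

    few-long : ∀ {T} → n ≤ T * t → ∀ Ps → Σℓ len Ps ≤ n → cnt long Ps ≤ T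
    few-long {T} n≤ Ps h = *-cancelʳ-≤ (cnt long Ps) T t {{>-nonZero 0<t}} (begin
      cnt long Ps * t ≡⟨ *-comm (cnt long Ps) t ⟩
      t * cnt long Ps ≡⟨ Σℓ-* t (λ P → ⟨ long P ⟩) Ps ⟨
      Σℓ (λ P → t * ⟨ long P ⟩) Ps ≤⟨ Σℓ-mono pointwise Ps ⟩
      Σℓ len Ps ≤⟨ h ⟩
      n ≤⟨ n≤ ⟩
      T * t ∎)
      where
      open ≤-Reasoning
      pointwise : ∀ P → t * ⟨ long P ⟩ ≤ len P
      pointwise P with long P in e
      ... | true = ≤-trans (≤-reflexive (*-identityʳ t)) (≤ᵇ≡true⇒≤ e)
      ... | false = ≤-trans (≤-reflexive (*-zeroʳ t)) z≤n

    -- On a short path every `q`-vertex has a predecessor of its own, since the head is not a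
    -- `q`-vertex. A long path contributes no sources, but it carries at most p + 1 of the
    -- `q`-vertices.
    sources-many : ∀ {p} q Rs → (∀ R → R ∈ Rs → q (head R) ≡ false) →
      (∀ R → R ∈ Rs → cnt q (vertices R) ≤ suc p) →
      Σℓ (λ R → cnt q (vertices R)) Rs ≤
      Σℓ (λ R → cnt (_∈ᵇ concatMap (sources q) Rs) (vertices R)) Rs + suc p * cnt long Rs
    sources-many {p} q Rs h₁ h₂ = begin
      Σℓ (λ R → cnt q (vertices R)) Rs ≤⟨ Σℓ-mono∈ Rs pointwise ⟩
      Σℓ (λ R → cnt A (vertices R) + suc p * ⟨ long R ⟩) Rs
        ≡⟨ Σℓ-+ (λ R → cnt A (vertices R)) (λ R → suc p * ⟨ long R ⟩) Rs ⟩
      Σℓ (λ R → cnt A (vertices R)) Rs + Σℓ (λ R → suc p * ⟨ long R ⟩) Rs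
        ≡⟨ cong (Σℓ (λ R → cnt A (vertices R)) Rs +_) (Σℓ-* (suc p) (λ R → ⟨ long R ⟩) Rs) ⟩
      Σℓ (λ R → cnt A (vertices R)) Rs + suc p * cnt long Rs ∎
      where
      open ≤-Reasoning
      A : V → Bool
      A = _∈ᵇ concatMap (sources q) Rs
      pointwise : ∀ R → R ∈ Rs → cnt q (vertices R) ≤ cnt A (vertices R) + suc p * ⟨ long R ⟩
      pointwise R m with long R in e
      ... | true = ≤-trans (h₂ R m) (≤-trans (≤-reflexive (sym (*-identityʳ (suc p)))) (m≤n+m _ (cnt A (vertices R))))
      ... | false rewrite h₁ R m = ≤-trans (cnt-preds A q (head R) (tail R) (λ {x} mx →
          ∈⇒∈ᵇ (∈-concatMap⁺ (sources q) (lose m (subst (λ b → x ∈ (if b then [] else preds q (head R) (tail R))) (sym e) mx)))))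
          (m≤m+n _ _)

    targets-many : ∀ q Rs → (∀ R → R ∈ Rs → q (last R) ≡ false) →
      Σℓ (λ R → cnt q (vertices R)) Rs ≤ Σℓ (λ R → cnt (_∈ᵇ concatMap (targets q) Rs) (vertices R)) Rs
    targets-many q Rs h = Σℓ-mono∈ Rs λ R m →
      ≤-trans (cnt-succs B q (walk R) (h R m) (λ mx → ∈⇒∈ᵇ (∈-concatMap⁺ (targets q) (lose m mx)))) (m≤n+m _ ⟨ B (head R) ⟩)
      where
      B : V → Bool
      B = _∈ᵇ concatMap (targets q) Rs

    -- The degree D is split into its parts a and b on the two short paths, s on the other paths and
    -- l in the reserved set; ℓ counts the long paths.
    sources-large : ∀ {n D A a b p w l s T ℓ R} → n ≤ 2 * D + R → D ≤ a + (b + s) + l → a ≤ p → b ≤ p → l ≤ w →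
      s ≤ A + suc p * ℓ → ℓ ≤ T → R + 2 * w + 4 * p + 2 * (suc p * T) ≤ g → n ≤ 2 * A + g
    sources-large {n} {D} {A} {a} {b} {p} {w} {l} {s} {T} {ℓ} {R} h₁ h₂ h₃ h₄ h₅ h₆ h₇ h₈ =
      lin 0 (h₁ ⊹ *-monoʳ-≤ 2 h₂ ⊹ *-monoʳ-≤ 2 h₃ ⊹ *-monoʳ-≤ 2 h₄ ⊹ *-monoʳ-≤ 2 h₅ ⊹ *-monoʳ-≤ 2 h₆ ⊹ *-monoʳ-≤ 2 (*-monoʳ-≤ (suc p) h₇) ⊹ h₈)
        (id n D A a b p w l s (suc p * T) (suc p * ℓ) R g)
      where
      id : ∀ n D A a b p w l s T ℓ R g →
        2 * A + g + (n + (2 * D + (2 * a + (2 * b + (2 * l + (2 * s + (2 * ℓ + (R + 2 * w + 4 * p + 2 * T))))))))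
        ≡ n + (2 * D + R + (2 * (a + (b + s) + l) + (2 * p + (2 * p + (2 * w + (2 * (A + ℓ) + (2 * T + g))))))) + 0
      id = solve-∀

    -- When no merge and no exchange is possible, the neighbours lost are at most p on each short
    -- path, w in the reserved set and p + 1 on each of at most T long paths. The slack `g` covers
    -- all of this, so sources and targets are large enough for expansion.
    quiet : ∀ {p w T} P₁ P₂ Rs W → n ≤ T * t → r + 2 * w + 4 * p + 2 * (suc p * T) ≤ g →
      vs (P₁ ∷ P₂ ∷ Rs) ++ W ↭ allFin n → len P₁ ≤ p → len P₂ ≤ p → length W ≤ w →
      (∀ R → R ∈ Rs → F (last P₁) (head R) ≡ false) →
      (∀ R → R ∈ Rs → cnt (F (last P₁)) (vertices R) ≤ suc p) →
      (∀ R → R ∈ Rs → F (last R) (head P₂) ≡ false) →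
      Better (P₁ ∷ P₂ ∷ Rs)
    quiet {p} {w} {T} P₁ P₂ Rs W n≤ slack perm s₁ s₂ sW h₁ h₂ h₃ = recombine (cnt-∃ _ (allFin n) (≤-trans 0<t (expand A B A-large B-large)))
      where
      u = last P₁
      v = head P₂
      into : V → Bool
      into x = F x v
      A B : V → Bool
      A = _∈ᵇ concatMap (sources (F u)) Rs
      B = _∈ᵇ concatMap (targets into) Rs
      ΣRs : Σℓ len Rs ≤ n
      ΣRs = ≤-trans (≤-trans (m≤n+m _ (len P₂)) (m≤n+m _ (len P₁))) (Σlen (P₁ ∷ P₂ ∷ Rs) W perm)
      A-large : n ≤ 2 * # A + g
      A-large = sources-large {A = # A} {T = T} (outdeg≥ u) (#-≤ (F u) P₁ P₂ Rs W perm) s₁ s₂ sW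
        (≤-trans (sources-many (F u) Rs h₁ h₂) (+-monoˡ-≤ _ (#-≥ A P₁ P₂ Rs W perm))) (few-long {T} n≤ Rs ΣRs) slack
      B-large : n ≤ 2 * # B + g
      B-large = sources-large {A = # B} {T = T} {ℓ = 0} (indeg≥ v) (#-≤ into P₁ P₂ Rs W perm) s₁ s₂ sW
        (≤-trans (targets-many into Rs h₃) (≤-trans (#-≥ B P₁ P₂ Rs W perm) (m≤m+n _ _))) z≤n slack
      out : V → V → Bool
      out a b = B b ∧ F a b
      recombine : (Σ V λ a → a ∈ allFin n × (A a ∧ (t ≤ᵇ # (out a))) ≡ true) → Better (P₁ ∷ P₂ ∷ Rs)
      recombine (x , _ , e) with ∧-elim (A x) e
      ... | Ax , rich with find (∈-concatMap⁻ (sources (F u)) {xs = Rs} (∈ᵇ⇒∈ _ Ax))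
      ... | R , R∈ , x∈ with long R in short
      ... | false with preds-cut (F u) (walk R) x∈
      ... | a , Fua , c = leave (cnt-∃ _ (allFin n) outside)
        where
        outside : 0 < # (λ b → out x b ∧ not (b ∈ᵇ vertices R))
        outside = +-cancelʳ-< (len R) 0 _ (≤-trans (≤ᵇ≡false⇒> {t} short) (≤-trans (≤ᵇ≡true⇒≤ {t} rich) (#-avoid (out x) (vertices R))))
        leave : (Σ V λ b → b ∈ allFin n × (out x b ∧ not (b ∈ᵇ vertices R)) ≡ true) → Better (P₁ ∷ P₂ ∷ Rs)
        leave (b , _ , e′) with ∧-elim (out x b) e′
        ... | e″ , b∉R with ∧-elim (B b) e″
        ... | Bb , Fxb with find (∈-concatMap⁻ (targets into) {xs = Rs} (∈ᵇ⇒∈ _ Bb))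
        ... | S , S∈ , b∈ with succs-cut into (walk S) b∈
        ... | y , Fyv , d with ∈⇒↭ R∈
        ... | Rs₁ , perm₁ with ∈-resp-↭ perm₁ S∈
        -- S cannot be R, because b was chosen off R.
        ... | here refl = ⊥-elim (∉ᵇ⇒∉ (not-elim b∉R) (subst (b ∈_) (sym (split d)) (∈-++⁺ʳ (head S ∷ before d) (here refl))))
        ... | there S∈₁ with ∈⇒↭ S∈₁
        ... | Rs₂ , perm₂ = better-via (prep P₁ (prep P₂ (↭-trans perm₁ (prep R perm₂)))) (cross P₁ P₂ R S Rs₂ c d Fua Fxb Fyv)

    far-cut : ∀ q P {k} → q (head P) ≡ false → k < cnt q (vertices P) →
      Σ V λ x → Σ V λ a → q a ≡ true × Σ (Cut P x a) λ c → k ≤ len (front-path c)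
    far-cut q P {k} h lt with cnt-far q k (vertices P) lt
    -- A hit at the head would leave an empty front part.
    ... | [] , a , L₂ , refl , qa , _ = ⊥-elim (true≢false qa h)
    ... | y ∷ L₁ , a , L₂ , refl , qa , le with cut-at L₁ L₂ (walk P)
    ... | x , c , refl , _ = x , a , qa , c , le

    abstract
      -- There are more than K paths on n < (p + 1) K vertices. After one path with at most p
      -- vertices is set aside, at least K paths remain, so averaging gives a second one.
      improve : ∀ {p w T K} → n ≤ T * t → r + 2 * w + 4 * p + 2 * (suc p * T) ≤ g → n < suc p * K →
        ∀ Ps W → vs Ps ++ W ↭ allFin n → length W ≤ w → K < length Ps → Better Ps
      improve {p} {w} {T} {K} n≤ slack nK Ps W perm W≤ K<
        with pick-small len p Ps (≤-trans (s≤s (Σlen Ps W perm)) (≤-trans nK (*-monoʳ-≤ (suc p) (<⇒≤ K<))))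
      ... | P₁ , Ps₁ , perm₁ , s₁
        with pick-small len p Ps₁ (≤-trans (s≤s (≤-trans (m≤n+m _ (len P₁))
               (≤-trans (≤-reflexive (sym (Σℓ-↭ len perm₁))) (Σlen Ps W perm))))
               (≤-trans nK (*-monoʳ-≤ (suc p) (s≤s⁻¹ (≤-trans K< (≤-reflexive (↭-length perm₁)))))))
      ... | P₂ , Rs , perm₂ , s₂ = better-via to (events (search (λ R → F u (head R)) Rs)
          (search (λ R → suc (len P₁) <ᵇ cnt (F u) (vertices R)) Rs) (search (λ R → F (last R) v) Rs))
        where
        u v : V
        u = last P₁
        v = head P₂
        to : Ps ↭ P₁ ∷ P₂ ∷ Rs
        to = ↭-trans perm₁ (prep P₁ perm₂)
        pull : ∀ {R} → R ∈ Rs → Σ (List Path) λ Rs′ → P₁ ∷ P₂ ∷ Rs ↭ P₁ ∷ P₂ ∷ R ∷ Rs′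
        pull m with ∈⇒↭ m
        ... | Rs′ , q = Rs′ , prep P₁ (prep P₂ q)
        Event : (Path → Bool) → Set
        Event q = (Σ Path λ R → R ∈ Rs × q R ≡ true) ⊎ (∀ R → R ∈ Rs → q R ≡ false)
        events : Event (λ R → F u (head R)) → Event (λ R → suc (len P₁) <ᵇ cnt (F u) (vertices R)) →
          Event (λ R → F (last R) v) → Better (P₁ ∷ P₂ ∷ Rs)
        events (inj₁ (R , m , e)) _ _ = better-via (proj₂ (pull m)) (append-to-head P₁ P₂ R (proj₁ (pull m)) e)
        events (inj₂ _) _ (inj₁ (R , m , e)) = better-via (proj₂ (pull m)) (prepend-to-last P₁ P₂ R (proj₁ (pull m)) e)
        -- More than `len P₁ + 1` neighbours on R allow a cut with at least `len P₁ + 1` vertices in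
        -- front of it, which makes the exchange strict.
        events (inj₂ none₁) (inj₁ (R , m , e)) (inj₂ _)
          with far-cut (F u) R (none₁ R m) (<ᵇ≡true⇒< e)
        ... | x , a , Fua , c , le = better-via (proj₂ (pull m)) (exchange-tails P₁ P₂ R (proj₁ (pull m)) c Fua le)
        events (inj₂ none₁) (inj₂ none₂) (inj₂ none₃) =
          quiet {T = T} P₁ P₂ Rs W n≤ slack (↭-trans (++⁺ʳ W (concatMap-↭ vertices (↭-sym to))) perm) s₁ s₂ W≤
            none₁ (λ R m → ≤-trans (≮⇒≥ (λ lt → true≢false (<⇒<ᵇ≡true lt) (none₂ R m))) (s≤s s₁)) none₃

    path-cover : ∀ {p w T K} → n ≤ T * t → r + 2 * w + 4 * p + 2 * (suc p * T) ≤ g → n < suc p * K →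
      ∀ U W → U ++ W ↭ allFin n → length W ≤ w → Σ (List Path) λ Ps → vs Ps ↭ U × length Ps ≤ K
    path-cover {p} {w} {T} {K} n≤ slack nK U W perm W≤ =
      reduce (length (map singleton U)) (energy (map singleton U)) (map singleton U) ≤-refl ≤-refl (↭-reflexive (singletons U))
      where
      singleton : V → Path
      singleton x = path {x} []
      singletons : ∀ U → vs (map singleton U) ≡ U
      singletons [] = refl
      singletons (x ∷ U) = cong (x ∷_) (singletons U)
      -- `k` bounds the number of paths and `s` the energy; whenever `k` drops, `s` is reset to the
      -- current energy.
      reduce : ∀ k s Ps → length Ps ≤ k → energy Ps ≤ s → vs Ps ↭ U → Σ (List Path) λ Ps → vs Ps ↭ U × length Ps ≤ K
      continue : ∀ k s Ps → length Ps ≤ k → energy Ps ≤ s → vs Ps ↭ U → Better Ps → Σ (List Path) λ Ps → vs Ps ↭ U × length Ps ≤ K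
      reduce k s Ps k≥ s≥ q with length Ps ≤? K
      ... | yes le = Ps , q , le
      ... | no gt = continue k s Ps k≥ s≥ q (improve {p} {w} {T} {K} n≤ slack nK Ps W (↭-trans (++⁺ʳ W q) perm) W≤ (≰⇒> gt))
      continue (suc k) s Ps k≥ _ q (Qs , q′ , inj₁ lt) =
        reduce k (energy Qs) Qs (s≤s⁻¹ (≤-trans lt k≥)) ≤-refl (↭-trans q′ q)
      continue zero s Ps k≥ _ _ (_ , _ , inj₁ lt) = ⊥-elim (1+n≰n (≤-trans (≤-trans (s≤s z≤n) lt) k≥))
      continue k (suc s) Ps k≥ s≥ q (Qs , q′ , inj₂ (eq , lt)) =
        reduce k s Qs (≤-trans (≤-reflexive eq) k≥) (s≤s⁻¹ (≤-trans lt s≥)) (↭-trans q′ q)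
      continue k zero Ps _ s≥ _ (_ , _ , inj₂ (_ , lt)) = ⊥-elim (1+n≰n (≤-trans (≤-trans (s≤s z≤n) lt) s≥))

  -- A Hamiltonian cycle of the contracted digraph

  module _ {A : Set} where
    open CM (++-commutativeMonoid {A = A})

    perm-close : (r q′ q₂ t b s : List A) → r ++ (q′ ++ q₂) ++ t ++ b ++ s ↭ s ++ r ++ ((b ++ q′) ++ q₂) ++ t ++ []
    perm-close = solve 6 (λ r q′ q₂ t b s → r ⊕ (q′ ⊕ q₂) ⊕ t ⊕ b ⊕ s ⊜ s ⊕ r ⊕ ((b ⊕ q′) ⊕ q₂) ⊕ t ⊕ id) ↭refl

    perm-attach : (s r q′ q₂ t b p x : List A) →
      s ++ (r ++ q′) ++ q₂ ++ (t ++ b ++ p) ++ x ↭ s ++ r ++ ((b ++ q′) ++ q₂) ++ t ++ p ++ x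
    perm-attach = solve 8 (λ s r q′ q₂ t b p x → s ⊕ (r ⊕ q′) ⊕ q₂ ⊕ (t ⊕ b ⊕ p) ⊕ x ⊜
      s ⊕ r ⊕ ((b ⊕ q′) ⊕ q₂) ⊕ t ⊕ p ⊕ x) ↭refl

    perm-all : (q s u : List A) → s ++ [] ++ q ++ [] ++ u ↭ (q ++ s) ++ u
    perm-all = solve 3 (λ q s u → s ⊕ id ⊕ q ⊕ id ⊕ u ⊜ (q ⊕ s) ⊕ u) ↭refl

  module Ham {n : ℕ} (F : Fin n → Fin n → Bool) (irr : ∀ v → F v v ≡ false) (r g t : ℕ)
    (outdeg≥ : ∀ v → n ≤ 2 * # (F v) + r)
    (indeg≥ : ∀ v → n ≤ 2 * # (λ u → F u v) + r)
    (expand : ∀ A B → n ≤ 2 * # A + g → n ≤ 2 * # B + g →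
              t ≤ # (λ a → A a ∧ (t ≤ᵇ # (λ b → B b ∧ F a b))))
    (0<t : 0 < t) where

    open Expand F r g t outdeg≥ indeg≥ expand 0<t using (V)
    open Walks F
    open Absorb F irr r g t outdeg≥ indeg≥ expand 0<t
    open Cover F irr r g t outdeg≥ indeg≥ expand 0<t
    open Path

    assemble : ∀ j Ps {x Q e R T l} s → Absorber (suc (length Ps) + j) x Q e → Walk s R x → Walk e T l →
      Σ (List V) λ L → Walk s L s × L ↭ s ∷ R ++ Q ++ T ++ vs Ps
    assemble j [] {R = R} {T} {l} s (layer {R = Q₂} abs _ A) wR wT with abs (l , s)
    ... | z , w , Q′ , perm , wQ′ , lz , zw , ws =
      R ++ (Q′ ++ Q₂) ++ T ++ z ∷ w ∷ s ∷ [] ,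
      wR ⊕ ((wQ′ ⊕ absorber-walk A) ⊕ (wT ⊕ (lz ∷ zw ∷ ws ∷ []))) ,
      ↭-trans (perm-close R Q′ Q₂ T (z ∷ w ∷ []) (s ∷ []))
        (++⁺ˡ (s ∷ R) (++⁺ʳ (T ++ []) (++⁺ʳ Q₂ (↭-sym perm))))
    assemble j (P ∷ Ps) {R = R} {T} {l} s (layer {R = Q₂} abs _ A) wR wT with abs (l , head P)
    ... | z , w , Q′ , perm , wQ′ , lz , zw , wp
      with assemble j Ps {T = T ++ z ∷ w ∷ vertices P} s A (wR ⊕ wQ′) (wT ⊕ (lz ∷ zw ∷ wp ∷ walk P))
    ... | L , wL , permL = L , wL , ↭-trans permL
      (↭-trans (perm-attach (s ∷ []) R Q′ Q₂ T (z ∷ w ∷ []) (vertices P) (vs Ps))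
        (++⁺ˡ (s ∷ R) (++⁺ʳ (T ++ vertices P ++ vs Ps) (++⁺ʳ Q₂ (↭-sym perm)))))

    -- K + 1 layers suffice, one for each of at most K paths and one to close the cycle; `w` bounds
    -- the whole absorber together with its starting vertex.
    hamiltonian : ∀ {p w T K x f} → n ≤ T * t → T * T ≡ suc x → r + 2 * w + 4 * p + 2 * (suc p * T) ≤ g →
      n < suc p * K → x ^ f * (n * n) < suc x ^ f → 1 + suc K * (6 * f) ≤ w → (s : V) →
      Σ (List V) λ L → Walk s L s × L ↭ allFin n
    hamiltonian {p} {w} {T} {K} {x} {f} n≤ TT slack nK enough small s =
      build (absorber {T = T} n≤ TT (≤-trans (≤-trans (m≤m+n _ (4 * p)) (m≤m+n _ (2 * (suc p * T)))) slack) f enough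
        (suc K) s (s ∷ []) (distinct-∷ (allFin n , ↭refl) λ ()) small)
      where
      build : (Σ (List V) λ Q → Σ V λ e → Absorber (suc K) s Q e × Distinct (Q ++ s ∷ []) × length Q ≤ suc K * (6 * f)) →
        Σ (List V) λ L → Walk s L s × L ↭ allFin n
      build (Q , e , A , (U , perm) , Q≤) = link (path-cover {p} {w} {T} {K} n≤ slack nK U (Q ++ s ∷ [])
        (↭-trans (++-comm U (Q ++ s ∷ [])) perm)
        (≤-trans (≤-reflexive (trans (length-++ Q) (+-comm (length Q) 1))) (≤-trans (s≤s Q≤) small)))
        where
        link : (Σ (List Path) λ Ps → vs Ps ↭ U × length Ps ≤ K) → Σ (List V) λ L → Walk s L s × L ↭ allFin n
        link (Ps , q , le) with assemble (K ∸ length Ps) Ps {T = []} s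
            (subst (λ m → Absorber (suc m) s Q e) (sym (m+[n∸m]≡n le)) A) [] []
        ... | L , wL , permL = L , wL ,
          ↭-trans permL (↭-trans (perm-all Q (s ∷ []) (vs Ps)) (↭-trans (++⁺ˡ (Q ++ s ∷ []) q) perm))

  -- A perfect matching by augmenting paths, and its contraction

  Σℓ≡sum : ∀ {n} (f : Fin n → ℕ) → Σℓ f (allFin n) ≡ Sum.sum f
  Σℓ≡sum {zero} f = refl
  Σℓ≡sum {suc n} f = trans (Σℓ-suc f) (cong (f Fin.zero +_) (Σℓ≡sum (λ i → f (Fin.suc i))))

  #-permute : ∀ {n} (p : Fin n → Bool) (π : Permutation′ n) → # p ≡ # (λ i → p (π ⟨$⟩ʳ i))
  #-permute p π = trans (Σℓ≡sum (λ i → ⟨ p i ⟩))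
    (trans (Sum.sum-permute (λ i → ⟨ p i ⟩) π) (sym (Σℓ≡sum (λ i → ⟨ p (π ⟨$⟩ʳ i) ⟩))))

  cnt-< : {A : Set} {p q : A → Bool} → (∀ x → p x ≡ true → q x ≡ true) →
    ∀ {x} xs → x ∈ xs → p x ≡ false → q x ≡ true → cnt p xs < cnt q xs
  cnt-< {p = p} {q} h (x ∷ xs) (here refl) e₁ e₂ rewrite e₁ | e₂ = s≤s (cnt-mono {p = p} {q} h xs)
  cnt-< {p = p} {q} h (y ∷ xs) (there m) e₁ e₂ = +-mono-≤-< (⟨⟩-mono (h y)) (cnt-< {p = p} {q} h xs m e₁ e₂)

  transpose-ˡ : ∀ {n} (i j : Fin n) → PC.transpose i j i ≡ j
  transpose-ˡ i j with i Fin.≟ i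
  ... | yes _ = refl
  ... | no ne = contradiction refl ne

  transpose-ʳ : ∀ {n} (i j : Fin n) → PC.transpose i j j ≡ i
  transpose-ʳ i j with j Fin.≟ i
  ... | yes e = e
  ... | no _ with j Fin.≟ j
  ... | yes _ = refl
  ... | no ne = contradiction refl ne

  transpose-other : ∀ {n} (i j : Fin n) {k} → k ≢ i → k ≢ j → PC.transpose i j k ≡ k
  transpose-other i j {k} ne₁ ne₂ with k Fin.≟ i
  ... | yes e = contradiction e ne₁
  ... | no _ with k Fin.≟ j
  ... | yes e = contradiction e ne₂
  ... | no _ = refl

  module Matching {n : ℕ} (H : Fin n → Fin n → Bool) (r g t : ℕ)
    (rowdeg≥ : ∀ i → n ≤ 2 * # (H i) + r)
    (coldeg≥ : ∀ j → n ≤ 2 * # (λ i → H i j) + r)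
    (r≤g : r ≤ g)
    (expand : ∀ A B → n ≤ 2 * # A + g → n ≤ 2 * # B + g →
              suc t ≤ # (λ a → A a ∧ (suc t ≤ᵇ # (λ b → B b ∧ H a b)))) where

    unmatched : Permutation′ n → ℕ
    unmatched π = # (λ i → not (H i (π ⟨$⟩ʳ i)))

    rotate : Fin n → Fin n → Fin n → Permutation′ n
    rotate x a c = Perm.transpose x c ∘ₚ Perm.transpose a c

    -- The augmenting path x – π a, a – π c, c – π x of length five (a = c gives one of length three).
    augmented : ∀ π x a c → H x (π ⟨$⟩ʳ x) ≡ false → H x (π ⟨$⟩ʳ a) ≡ true → H a (π ⟨$⟩ʳ c) ≡ true → H c (π ⟨$⟩ʳ x) ≡ true →
      unmatched (rotate x a c ∘ₚ π) < unmatched π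
    augmented π x a c bad xa ac cx = cnt-< keep (allFin n) (∈-allFin x) (cong not hx) (cong not bad)
      where
      τ : Fin n → Fin n
      τ i = rotate x a c ⟨$⟩ʳ i
      τx : τ x ≡ a
      τx = trans (cong (PC.transpose a c) (transpose-ˡ x c)) (transpose-ʳ a c)
      hx : H x (π ⟨$⟩ʳ τ x) ≡ true
      hx = trans (cong (λ k → H x (π ⟨$⟩ʳ k)) τx) xa
      x≢a : x ≢ a
      x≢a refl = true≢false xa bad
      x≢c : x ≢ c
      x≢c refl = true≢false cx bad
      τc : τ c ≡ x
      τc = trans (cong (PC.transpose a c) (transpose-ʳ x c)) (transpose-other a c x≢a x≢c)
      -- Rows other than x, a and c keep their partners, and these three are now matched; hence no
      -- row becomes unmatched.
      keep : ∀ i → not (H i (π ⟨$⟩ʳ τ i)) ≡ true → not (H i (π ⟨$⟩ʳ i)) ≡ true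
      keep i e = cases (i Fin.≟ x) (i Fin.≟ c) (i Fin.≟ a)
        where
        matched : ∀ {k} → τ i ≡ k → H i (π ⟨$⟩ʳ k) ≡ true → ⊥
        matched τi h = true≢false (trans (cong (λ k → H i (π ⟨$⟩ʳ k)) τi) h) (not-elim e)
        cases : Dec (i ≡ x) → Dec (i ≡ c) → Dec (i ≡ a) → not (H i (π ⟨$⟩ʳ i)) ≡ true
        cases (yes i≡x) _ _ = cong not (subst (λ k → H k (π ⟨$⟩ʳ k) ≡ false) (sym i≡x) bad)
        cases (no _) (yes i≡c) _ = ⊥-elim (matched (trans (cong τ i≡c) τc) (subst (λ k → H k (π ⟨$⟩ʳ x) ≡ true) (sym i≡c) cx))
        cases (no i≢x) (no i≢c) (yes i≡a) = ⊥-elim (matched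
          (trans (cong (PC.transpose a c) (transpose-other x c i≢x i≢c)) (trans (cong (PC.transpose a c) i≡a) (transpose-ˡ a c)))
          (subst (λ k → H k (π ⟨$⟩ʳ c) ≡ true) (sym i≡a) ac))
        cases (no i≢x) (no i≢c) (no i≢a) = subst (λ k → not (H i (π ⟨$⟩ʳ k)) ≡ true)
          (trans (cong (PC.transpose a c) (transpose-other x c i≢x i≢c)) (transpose-other a c i≢a i≢c)) e

    relax : ∀ {a b} → n ≤ 2 * a + r → a ≡ b → n ≤ 2 * b + g
    relax {a} h refl = ≤-trans h (+-monoʳ-≤ (2 * a) r≤g)

    -- Expansion joins a row a whose partner is a neighbour of x to a column b whose partner c is a
    -- neighbour of the column `π x`.
    augment : ∀ π x → H x (π ⟨$⟩ʳ x) ≡ false → Σ (Permutation′ n) λ π′ → unmatched π′ < unmatched π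
    augment π x bad = pick (cnt-∃ _ (allFin n) (≤-trans (s≤s z≤n) (expand A B
        (relax (rowdeg≥ x) (#-permute (H x) π))
        (relax (coldeg≥ (π ⟨$⟩ʳ x)) (#-permute (λ c → H c (π ⟨$⟩ʳ x)) (Perm.flip π))))))
      where
      A B : Fin n → Bool
      A a = H x (π ⟨$⟩ʳ a)
      B b = H (π ⟨$⟩ˡ b) (π ⟨$⟩ʳ x)
      pick : (Σ (Fin n) λ a → a ∈ allFin n × (A a ∧ (suc t ≤ᵇ # (λ b → B b ∧ H a b))) ≡ true) →
        Σ (Permutation′ n) λ π′ → unmatched π′ < unmatched π
      pick (a , _ , e) with ∧-elim (A a) e
      ... | Aa , rich with cnt-∃ _ (allFin n) (≤-trans (s≤s z≤n) (≤ᵇ≡true⇒≤ {suc t} rich))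
      ... | b , _ , e′ with ∧-elim (B b) e′
      ... | Bb , Hab = rotate x a c ∘ₚ π , augmented π x a c bad Aa (trans (cong (H a) (inverseʳ π)) Hab) Bb
        where
        c : Fin n
        c = π ⟨$⟩ˡ b

    matching : Σ (Permutation′ n) λ π → ∀ i → H i (π ⟨$⟩ʳ i) ≡ true
    matching = go (unmatched Perm.id) Perm.id ≤-refl
      where
      go : ∀ k π → unmatched π ≤ k → Σ (Permutation′ n) λ π → ∀ i → H i (π ⟨$⟩ʳ i) ≡ true
      continue : ∀ k π → unmatched π ≤ k → (Σ (Permutation′ n) λ π′ → unmatched π′ < unmatched π) →
        Σ (Permutation′ n) λ π → ∀ i → H i (π ⟨$⟩ʳ i) ≡ true
      go k π k≥ with search (λ i → not (H i (π ⟨$⟩ʳ i))) (allFin n)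
      ... | inj₂ none = π , λ i → un-not (none i (∈-allFin i))
        where
        un-not : ∀ {a} → not a ≡ false → a ≡ true
        un-not {true} _ = refl
      ... | inj₁ (x , _ , e) = continue k π k≥ (augment π x (not-elim e))
      continue zero π k≥ (π′ , lt) = ⊥-elim (1+n≰n (≤-trans (≤-trans (s≤s z≤n) lt) k≥))
      continue (suc k) π k≥ (π′ , lt) = go k π′ (s≤s⁻¹ (≤-trans lt k≥))

    module Contract (π : Permutation′ n) where

      -- A step of `F` is an edge from row i to the partner of j, followed by the matching edge back
      -- to row j. Excluding i = j costs at most one neighbour per vertex: `r` grows by 2, and the
      -- expansion constant drops from `suc t` to `t`.
      F : Fin n → Fin n → Bool
      F i j = H i (π ⟨$⟩ʳ j) ∧ not (i == j)

      F-irr : ∀ v → F v v ≡ false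
      F-irr v rewrite ==-refl v = ∧-falseʳ (H v (π ⟨$⟩ʳ v))
        where
        ∧-falseʳ : ∀ a → a ∧ false ≡ false
        ∧-falseʳ true = refl
        ∧-falseʳ false = refl

      ==-sym : ∀ (x y : Fin n) → (x == y) ≡ true → (y == x) ≡ true
      ==-sym x y e with ==⇒≡ x y e
      ... | refl = e

      #-≢ : ∀ (p : Fin n → Bool) x → # p ≤ # (λ y → p y ∧ not (x == y)) + 1
      #-≢ p x = ≤-trans (cnt-split p (x ==_) (allFin n))
        (+-monoʳ-≤ _ (≤-trans (cnt-mono (==-sym x) (allFin n)) (#-== x)))

      #-≢′ : ∀ (p : Fin n → Bool) x → # p ≤ # (λ y → p y ∧ not (y == x)) + 1
      #-≢′ p x = ≤-trans (cnt-split p (_== x) (allFin n)) (+-monoʳ-≤ _ (#-== x))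

      lose-one : ∀ {n a b} → n ≤ 2 * a + r → a ≤ b + 1 → n ≤ 2 * b + (r + 2)
      lose-one {n} {a} {b} h₁ h₂ = lin 0 (h₁ ⊹ *-monoʳ-≤ 2 h₂) (id n a b r)
        where
        id : ∀ n a b r → 2 * b + (r + 2) + (n + 2 * a) ≡ n + (2 * a + r + 2 * (b + 1)) + 0
        id = solve-∀

      F-outdeg : ∀ v → n ≤ 2 * # (F v) + (r + 2)
      F-outdeg v = lose-one (rowdeg≥ v) (≤-trans (≤-reflexive (#-permute (H v) π)) (#-≢ (λ j → H v (π ⟨$⟩ʳ j)) v))

      F-indeg : ∀ v → n ≤ 2 * # (λ u → F u v) + (r + 2)
      F-indeg v = lose-one (coldeg≥ (π ⟨$⟩ʳ v)) (#-≢′ (λ i → H i (π ⟨$⟩ʳ v)) v)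

      F-expand : ∀ A B → n ≤ 2 * # A + g → n ≤ 2 * # B + g →
        t ≤ # (λ a → A a ∧ (t ≤ᵇ # (λ b → B b ∧ F a b)))
      F-expand A B hA hB = ≤-trans (n≤1+n t) (≤-trans
        (expand A (λ b → B (π ⟨$⟩ˡ b)) hA (subst (λ m → n ≤ 2 * m + g) (#-permute B (Perm.flip π)) hB))
        (cnt-mono step (allFin n)))
        where
        transfer : ∀ a → # (λ b → B (π ⟨$⟩ˡ b) ∧ H a b) ≤ # (λ b → B b ∧ F a b) + 1
        transfer a = begin
          # (λ b → B (π ⟨$⟩ˡ b) ∧ H a b) ≡⟨ #-permute (λ b → B (π ⟨$⟩ˡ b) ∧ H a b) π ⟩
          # (λ j → B (π ⟨$⟩ˡ (π ⟨$⟩ʳ j)) ∧ H a (π ⟨$⟩ʳ j))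
            ≤⟨ cnt-mono (λ j e → subst (λ k → B k ∧ H a (π ⟨$⟩ʳ j) ≡ true) (inverseˡ π) e) (allFin n) ⟩
          # (λ j → B j ∧ H a (π ⟨$⟩ʳ j)) ≤⟨ #-≢ (λ j → B j ∧ H a (π ⟨$⟩ʳ j)) a ⟩
          # (λ j → (B j ∧ H a (π ⟨$⟩ʳ j)) ∧ not (a == j)) + 1
            ≤⟨ +-monoˡ-≤ 1 (cnt-mono (λ j e → trans (sym (∧-assoc (B j) (H a (π ⟨$⟩ʳ j)) (not (a == j)))) e) (allFin n)) ⟩
          # (λ j → B j ∧ F a j) + 1 ∎
          where open ≤-Reasoning
        step : ∀ a → A a ∧ (suc t ≤ᵇ # (λ b → B (π ⟨$⟩ˡ b) ∧ H a b)) ≡ true → A a ∧ (t ≤ᵇ # (λ b → B b ∧ F a b)) ≡ true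
        step a e with ∧-elim (A a) e
        ... | Aa , rich = ∧-intro Aa (<⇒≤ᵇ≡true (+-cancelʳ-≤ 1 t _
          (≤-trans (≤-reflexive (+-comm t 1)) (≤-trans (≤ᵇ≡true⇒≤ {suc t} rich) (transfer a)))))

  -- A balanced partition by conditional expectations

  -- Bernoulli's inequality (1 + 1/q)^k ≥ 1 + k/q with denominators cleared.
  power-gain : ∀ q k → q ^ k * (q + k) ≤ suc q ^ k * q
  power-gain q zero = ≤-reflexive (id q)
    where
    id : ∀ q → 1 * (q + 0) ≡ 1 * q
    id = solve-∀
  power-gain q (suc k) = begin
    q * q ^ k * (q + suc k) ≤⟨ m≤m+n _ (q ^ k * k) ⟩
    q * q ^ k * (q + suc k) + q ^ k * k ≡⟨ id₁ q k (q ^ k) ⟩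
    suc q * (q ^ k * (q + k)) ≤⟨ *-monoʳ-≤ (suc q) (power-gain q k) ⟩
    suc q * (suc q ^ k * q) ≡⟨ *-assoc (suc q) (suc q ^ k) q ⟨
    suc q * suc q ^ k * q ∎
    where
    open ≤-Reasoning
    id₁ : ∀ q k z → q * z * (q + suc k) + z * k ≡ suc q * (z * (q + k))
    id₁ = solve-∀

  -- Bernoulli's inequality (1 - 1/(y + 1))^k ≥ 1 - k/(y + 1) with denominators cleared.
  power-loss : ∀ y k → suc y ^ k * suc y ≤ y ^ k * suc y + k * suc y ^ k
  power-loss y zero = m≤m+n _ 0
  power-loss y (suc k) = begin
    suc y * suc y ^ k * suc y ≡⟨ id₁ y (suc y ^ k) ⟩
    y * (suc y ^ k * suc y) + suc y ^ k * suc y ≤⟨ +-monoˡ-≤ _ (*-monoʳ-≤ y (power-loss y k)) ⟩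
    y * (y ^ k * suc y + k * suc y ^ k) + suc y ^ k * suc y ≤⟨ m≤m+n _ (k * suc y ^ k) ⟩
    y * (y ^ k * suc y + k * suc y ^ k) + suc y ^ k * suc y + k * suc y ^ k ≡⟨ id₂ y k (y ^ k) (suc y ^ k) ⟩
    y * y ^ k * suc y + suc k * (suc y * suc y ^ k) ∎
    where
    open ≤-Reasoning
    id₁ : ∀ y z → suc y * z * suc y ≡ y * (z * suc y) + z * suc y
    id₁ = solve-∀
    id₂ : ∀ y k a z → y * (a * suc y + k * z) + z * suc y + k * z ≡ y * a * suc y + suc k * (suc y * z)
    id₂ = solve-∀

  doubling : ∀ q → 0 < q → 2 * q ^ q ≤ suc q ^ q
  doubling q 0<q = *-cancelʳ-≤ (2 * q ^ q) (suc q ^ q) q {{>-nonZero 0<q}}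
    (≤-trans (≤-reflexive (id q (q ^ q))) (power-gain q q))
    where
    id : ∀ q z → 2 * z * q ≡ z * (q + q)
    id = solve-∀

  *-^ : ∀ a b k → (a * b) ^ k ≡ a ^ k * b ^ k
  *-^ a b zero = refl
  *-^ a b (suc k) rewrite *-^ a b k = id a b (a ^ k) (b ^ k)
    where
    id : ∀ a b c d → a * b * (c * d) ≡ a * c * (b * d)
    id = solve-∀

  doubling-^ : ∀ q i → 0 < q → 2 ^ i * q ^ (q * i) ≤ suc q ^ (q * i)
  doubling-^ q i 0<q = begin
    2 ^ i * q ^ (q * i) ≡⟨ cong (2 ^ i *_) (^-*-assoc q q i) ⟨
    2 ^ i * (q ^ q) ^ i ≡⟨ *-^ 2 (q ^ q) i ⟨
    (2 * q ^ q) ^ i ≤⟨ ^-monoˡ-≤ i (doubling q 0<q) ⟩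
    (suc q ^ q) ^ i ≡⟨ ^-*-assoc (suc q) q i ⟩
    suc q ^ (q * i) ∎
    where open ≤-Reasoning

  -- With Q = (1 + x)² = y + 1 this is (1 − 1/Q)ˣ (1 + 1/(1 + x)) ≥ 1, because (Q − x)(2 + x) = (1 + x) Q + 1.
  balance : ∀ x → let y = x * (2 + x) in suc y ^ x * suc x ≤ y ^ x * (2 + x)
  balance x = *-cancelˡ-≤ (suc y) (lin (Z) (*-monoˡ-≤ (2 + x) (power-loss y x)) (id x (y ^ x) Z))
    where
    y Z : ℕ
    y = x * (2 + x)
    Z = suc y ^ x
    id : ∀ x a Z → suc (x * (2 + x)) * (a * (2 + x)) + (Z * suc (x * (2 + x))) * (2 + x)
      ≡ suc (x * (2 + x)) * (Z * suc x) + (a * suc (x * (2 + x)) + x * Z) * (2 + x) + Z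
    id = solve-∀

  -- The j-th power of `balance` has x j factors y/(y + 1); dropping those beyond N helps, since
  -- each is at most 1.
  balance-^ : ∀ x j N → N ≤ x * j → let y = x * (2 + x) in suc y ^ N * suc x ^ j ≤ y ^ N * (2 + x) ^ j
  balance-^ x j N N≤ = *-cancelʳ-≤ _ _ (suc y ^ D) {{>-nonZero (m^n>0 (suc y) D)}} (begin
    suc y ^ N * suc x ^ j * suc y ^ D ≡⟨ id (suc y ^ N) (suc x ^ j) (suc y ^ D) ⟩
    suc y ^ N * suc y ^ D * suc x ^ j ≡⟨ cong (_* suc x ^ j) (full (suc y)) ⟩
    (suc y ^ x) ^ j * suc x ^ j ≡⟨ *-^ (suc y ^ x) (suc x) j ⟨
    (suc y ^ x * suc x) ^ j ≤⟨ ^-monoˡ-≤ j (balance x) ⟩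
    (y ^ x * (2 + x)) ^ j ≡⟨ *-^ (y ^ x) (2 + x) j ⟩
    (y ^ x) ^ j * (2 + x) ^ j ≡⟨ cong (_* (2 + x) ^ j) (full y) ⟨
    y ^ N * y ^ D * (2 + x) ^ j ≤⟨ *-monoˡ-≤ _ (*-monoʳ-≤ (y ^ N) (^-monoˡ-≤ D (n≤1+n y))) ⟩
    y ^ N * suc y ^ D * (2 + x) ^ j ≡⟨ id (y ^ N) (suc y ^ D) ((2 + x) ^ j) ⟩
    y ^ N * (2 + x) ^ j * suc y ^ D ∎)
    where
    open ≤-Reasoning
    y D : ℕ
    y = x * (2 + x)
    D = x * j ∸ N
    full : ∀ b → b ^ N * b ^ D ≡ (b ^ x) ^ j
    full b = trans (sym (^-distribˡ-+-* b N D)) (trans (cong (b ^_) (m+[n∸m]≡n N≤)) (sym (^-*-assoc b x j)))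
    id : ∀ a b c → a * b * c ≡ a * c * b
    id = solve-∀

  -- With δ = 1/(1 + x) this is (1 + δ)^P (1 - δ)^N ≥ 2^i for a surplus P - N of at least j + (1 +
  -- x) i. N factors of each kind combine to (1 - δ²)^N, which (1 + δ)^j outweighs by `balance-^`,
  -- and (1 + δ)^((1 + x) i) is at least 2^i.
  drift : ∀ x i j N P Z → N ≤ x * j → N + (j + suc x * i) ≤ P →
    2 ^ i * suc x ^ (P + N + Z) ≤ (2 + x) ^ P * x ^ N * suc x ^ Z
  drift x i j N P Z N≤ P≥ = begin
    2 ^ i * suc x ^ (P + N + Z) ≡⟨ cong (λ k → 2 ^ i * suc x ^ k) exponent ⟩
    2 ^ i * suc x ^ (2 * N + j + suc x * i + e + Z)
      ≡⟨ cong (2 ^ i *_) (trans (expand₄ (suc x) (2 * N) j (suc x * i) e Z) (cong (λ k → k * suc x ^ j * suc x ^ (suc x * i) * suc x ^ e * suc x ^ Z) square)) ⟩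
    2 ^ i * (suc y ^ N * suc x ^ j * suc x ^ (suc x * i) * suc x ^ e * suc x ^ Z)
      ≡⟨ id₁ (2 ^ i) (suc y ^ N * suc x ^ j) (suc x ^ (suc x * i)) (suc x ^ e) (suc x ^ Z) ⟩
    (suc y ^ N * suc x ^ j) * (2 ^ i * suc x ^ (suc x * i)) * suc x ^ e * suc x ^ Z
      ≤⟨ *-monoˡ-≤ (suc x ^ Z) (*-mono-≤ (*-mono-≤ (balance-^ x j N N≤) (doubling-^ (suc x) i (s≤s z≤n))) (^-monoˡ-≤ e (n≤1+n (suc x)))) ⟩
    (y ^ N * (2 + x) ^ j) * (2 + x) ^ (suc x * i) * (2 + x) ^ e * suc x ^ Z
      ≡⟨ cong (λ k → k * (2 + x) ^ j * (2 + x) ^ (suc x * i) * (2 + x) ^ e * suc x ^ Z) (*-^ x (2 + x) N) ⟩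
    (x ^ N * (2 + x) ^ N * (2 + x) ^ j) * (2 + x) ^ (suc x * i) * (2 + x) ^ e * suc x ^ Z
      ≡⟨ id₂ (x ^ N) ((2 + x) ^ N) ((2 + x) ^ j) ((2 + x) ^ (suc x * i)) ((2 + x) ^ e) (suc x ^ Z) ⟩
    (2 + x) ^ N * (2 + x) ^ j * (2 + x) ^ (suc x * i) * (2 + x) ^ e * x ^ N * suc x ^ Z
      ≡⟨ cong (λ k → k * x ^ N * suc x ^ Z) gather ⟩
    (2 + x) ^ P * x ^ N * suc x ^ Z ∎
    where
    open ≤-Reasoning
    y e : ℕ
    y = x * (2 + x)
    e = P ∸ (N + (j + suc x * i))
    P≡ : N + (j + suc x * i) + e ≡ P
    P≡ = m+[n∸m]≡n P≥
    exponent : P + N + Z ≡ 2 * N + j + suc x * i + e + Z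
    exponent = trans (cong (λ k → k + N + Z) (sym P≡)) (id N j (suc x * i) e Z)
      where
      id : ∀ N j q e Z → N + (j + q) + e + N + Z ≡ 2 * N + j + q + e + Z
      id = solve-∀
    expand₄ : ∀ b c d f e Z → b ^ (c + d + f + e + Z) ≡ b ^ c * b ^ d * b ^ f * b ^ e * b ^ Z
    expand₄ b c d f e Z rewrite ^-distribˡ-+-* b (c + d + f + e) Z | ^-distribˡ-+-* b (c + d + f) e
      | ^-distribˡ-+-* b (c + d) f | ^-distribˡ-+-* b c d = refl
    square : suc x ^ (2 * N) ≡ suc y ^ N
    square = trans (sym (^-*-assoc (suc x) 2 N)) (cong (_^ N) (id x))
      where
      id : ∀ x → suc x * (suc x * 1) ≡ suc (x * (2 + x))
      id = solve-∀
    gather : (2 + x) ^ N * (2 + x) ^ j * (2 + x) ^ (suc x * i) * (2 + x) ^ e ≡ (2 + x) ^ P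
    gather = trans (sym (gather₄ (2 + x) N j (suc x * i) e)) (cong ((2 + x) ^_) P≡)
      where
      gather₄ : ∀ b N j q e → b ^ (N + (j + q) + e) ≡ b ^ N * b ^ j * b ^ q * b ^ e
      gather₄ b N j q e rewrite ^-distribˡ-+-* b (N + (j + q)) e | ^-distribˡ-+-* b N (j + q) | ^-distribˡ-+-* b j q =
        cong (_* b ^ e) (sym (*-assoc (b ^ N) (b ^ j) (b ^ q)))
    id₁ : ∀ a b c d e → a * (b * c * d * e) ≡ b * (a * c) * d * e
    id₁ = solve-∀
    id₂ : ∀ a b c d e f → (a * b * c) * d * e * f ≡ b * c * d * e * a * f
    id₂ = solve-∀

  module Orient {V : Set} (x : ℕ) where

    factor : Bool → Bool → ℕ
    factor true false = 2 + x
    factor false true = x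
    factor true true = 1 + x
    factor false false = 1 + x

    factor-sum : ∀ a b → factor a b + factor b a ≡ 2 * suc x
    factor-sum true true = cong (suc x +_) (sym (+-identityʳ (suc x)))
    factor-sum false false = cong (suc x +_) (sym (+-identityʳ (suc x)))
    factor-sum true false = id x
      where
      id : ∀ x → 2 + x + x ≡ 2 * suc x
      id = solve-∀
    factor-sum false true = id x
      where
      id : ∀ x → x + (2 + x) ≡ 2 * suc x
      id = solve-∀

    -- Each half receives one vertex of every pair, so both halves have m positions whatever `s` is.
    first second : ∀ {m} → (Fin m → V) → (Fin m → V) → (Fin m → Bool) → Fin m → V
    first l r s i = if s i then l i else r i
    second l r s i = if s i then r i else l i

    -- (1 + x)ᵐ times the product of 1 ± 1/(1 + x) over the positions that S separates.
    weight : ∀ {m} → (V → Bool) → (Fin m → V) → (Fin m → V) → ℕ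
    weight {zero} S f g = 1
    weight {suc m} S f g = factor (S (f Fin.zero)) (S (g Fin.zero)) * weight S (λ i → f (Fin.suc i)) (λ i → g (Fin.suc i))

    cons : ∀ {m} → Bool → (Fin m → Bool) → Fin (suc m) → Bool
    cons b s Fin.zero = b
    cons b s (Fin.suc i) = s i

    -- The two factors of a position sum to 2 (1 + x), so one of its two orientations does not increase the potential.
    orient : ∀ {m} (l r : Fin m → V) (fam : List (V → Bool)) (a : (V → Bool) → ℕ) →
      Σ (Fin m → Bool) λ s → Σℓ (λ S → a S * weight S (first l r s) (second l r s)) fam ≤ suc x ^ m * Σℓ a fam
    orient {zero} l r fam a = (λ ()) , ≤-trans (Σℓ-mono (λ S → ≤-reflexive (*-identityʳ (a S))) fam) (≤-reflexive (sym (+-identityʳ _)))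
    orient {suc m} l r fam a = choose (≤-total total₁ total₂)
      where
      l₀ r₀ : V
      l₀ = l Fin.zero
      r₀ = r Fin.zero
      -- The coefficient of S carries the factors of the positions already decided.
      a₁ a₂ : (V → Bool) → ℕ
      a₁ S = a S * factor (S l₀) (S r₀)
      a₂ S = a S * factor (S r₀) (S l₀)
      total₁ total₂ : ℕ
      total₁ = Σℓ a₁ fam
      total₂ = Σℓ a₂ fam
      both : total₁ + total₂ ≡ 2 * (suc x * Σℓ a fam)
      both = begin-equality
        total₁ + total₂ ≡⟨ Σℓ-+ a₁ a₂ fam ⟨
        Σℓ (λ S → a₁ S + a₂ S) fam ≡⟨ ≤-antisym (Σℓ-mono (λ S → ≤-reflexive (pointwise S)) fam) (Σℓ-mono (λ S → ≤-reflexive (sym (pointwise S))) fam) ⟩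
        Σℓ (λ S → 2 * suc x * a S) fam ≡⟨ Σℓ-* (2 * suc x) a fam ⟩
        2 * suc x * Σℓ a fam ≡⟨ *-assoc 2 (suc x) (Σℓ a fam) ⟩
        2 * (suc x * Σℓ a fam) ∎
        where
        open ≤-Reasoning
        pointwise : ∀ S → a₁ S + a₂ S ≡ 2 * suc x * a S
        pointwise S = trans (sym (*-distribˡ-+ (a S) (factor (S l₀) (S r₀)) (factor (S r₀) (S l₀))))
          (trans (cong (a S *_) (factor-sum (S l₀) (S r₀))) (*-comm (a S) (2 * suc x)))
      half : ∀ {u v w} → u ≤ v → u + v ≡ 2 * w → u ≤ w
      half {u} {v} {w} u≤v eq = *-cancelˡ-≤ 2 (≤-trans (+-monoʳ-≤ u (≤-trans (≤-reflexive (+-identityʳ u)) u≤v)) (≤-reflexive eq))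
      finish : ∀ b (a′ : (V → Bool) → ℕ) →
        (∀ S s → a S * weight S (first l r (cons b s)) (second l r (cons b s)) ≡
          a′ S * weight S (first (λ i → l (Fin.suc i)) (λ i → r (Fin.suc i)) s) (second (λ i → l (Fin.suc i)) (λ i → r (Fin.suc i)) s)) →
        Σℓ a′ fam ≤ suc x * Σℓ a fam →
        Σ (Fin (suc m) → Bool) λ s → Σℓ (λ S → a S * weight S (first l r s) (second l r s)) fam ≤ suc x ^ suc m * Σℓ a fam
      finish b a′ eq le with orient (λ i → l (Fin.suc i)) (λ i → r (Fin.suc i)) fam a′
      ... | s , h = cons b s , (begin
        Σℓ (λ S → a S * weight S (first l r (cons b s)) (second l r (cons b s))) fam ≤⟨ Σℓ-mono (λ S → ≤-reflexive (eq S s)) fam ⟩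
        _ ≤⟨ h ⟩
        suc x ^ m * Σℓ a′ fam ≤⟨ *-monoʳ-≤ (suc x ^ m) le ⟩
        suc x ^ m * (suc x * Σℓ a fam) ≡⟨ id (suc x) (suc x ^ m) (Σℓ a fam) ⟩
        suc x ^ suc m * Σℓ a fam ∎)
        where
        open ≤-Reasoning
        id : ∀ a b c → b * (a * c) ≡ a * b * c
        id = solve-∀
      choose : total₁ ≤ total₂ ⊎ total₂ ≤ total₁ →
        Σ (Fin (suc m) → Bool) λ s → Σℓ (λ S → a S * weight S (first l r s) (second l r s)) fam ≤ suc x ^ suc m * Σℓ a fam
      choose (inj₁ le) = finish true a₁ (λ S s → sym (*-assoc (a S) _ _)) (half le both)
      choose (inj₂ ge) = finish false a₂ (λ S s → sym (*-assoc (a S) _ _)) (half ge (trans (+-comm total₂ total₁) both))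

    #-suc : ∀ {m} (p : Fin (suc m) → Bool) → # p ≡ ⟨ p Fin.zero ⟩ + # (λ i → p (Fin.suc i))
    #-suc p = Σℓ-suc (λ i → ⟨ p i ⟩)

    -- P counts the positions where only the first vertex lies in S, N those where only the second
    -- does, and Z the others; P - N is thus the discrepancy of S.
    weight-shape : ∀ {m} S (f g : Fin m → V) → Σ ℕ λ P → Σ ℕ λ N → Σ ℕ λ Z →
      weight S f g ≡ (2 + x) ^ P * x ^ N * suc x ^ Z × P + N + Z ≡ m ×
      # (λ i → S (f i)) + N ≡ # (λ i → S (g i)) + P
    weight-shape {zero} S f g = 0 , 0 , 0 , refl , refl , refl
    weight-shape {suc m} S f g
      rewrite #-suc (λ i → S (f i)) | #-suc (λ i → S (g i))
      with weight-shape S (λ i → f (Fin.suc i)) (λ i → g (Fin.suc i)) | S (f Fin.zero) | S (g Fin.zero)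
    ... | P , N , Z , w , s , d | true | true = P , N , suc Z , trans (cong (suc x *_) w) (id (2 + x) x (suc x) ((2 + x) ^ P) (x ^ N) (suc x ^ Z)) ,
          trans (+-suc (P + N) Z) (cong suc s) , cong suc d
      where
      id : ∀ p n z a b c → z * (a * b * c) ≡ a * b * (z * c)
      id = solve-∀
    ... | P , N , Z , w , s , d | false | false = P , N , suc Z , trans (cong (suc x *_) w) (id (2 + x) x (suc x) ((2 + x) ^ P) (x ^ N) (suc x ^ Z)) ,
          trans (+-suc (P + N) Z) (cong suc s) , d
      where
      id : ∀ p n z a b c → z * (a * b * c) ≡ a * b * (z * c)
      id = solve-∀
    ... | P , N , Z , w , s , d | true | false = suc P , N , Z , trans (cong ((2 + x) *_) w) (id (2 + x) ((2 + x) ^ P) (x ^ N) (suc x ^ Z)) ,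
          cong suc s , trans (cong suc d) (sym (+-suc _ P))
      where
      id : ∀ p a b c → p * (a * b * c) ≡ p * a * b * c
      id = solve-∀
    ... | P , N , Z , w , s , d | false | true = P , suc N , Z , trans (cong (x *_) w) (id x ((2 + x) ^ P) (x ^ N) (suc x ^ Z)) ,
          trans (cong (_+ Z) (+-suc P N)) (cong suc s) , trans (+-suc _ N) (cong suc d)
      where
      id : ∀ n a b c → n * (a * b * c) ≡ a * (n * b) * c
      id = solve-∀

    -- The potential starts at the size of the family, so in the end no member has a normalised
    -- weight of 2^i or more, and `drift` bounds its surplus. The bound is one-sided: to bound the
    -- surplus in the second half, the complement of a set has to be a member.
    concentrate : ∀ {m} i j (l r : Fin m → V) (fam : List (V → Bool)) → m ≤ x * j → length fam < 2 ^ i →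
      Σ (Fin m → Bool) λ s → ∀ S → S ∈ fam →
        # (λ k → S (first l r s k)) ≤ # (λ k → S (second l r s k)) + (j + suc x * i)
    concentrate {m} i j l r fam m≤ few with orient l r fam (λ _ → 1)
    ... | s , h = s , bound
      where
      f g : Fin m → V
      f = first l r s
      g = second l r s
      weight< : ∀ S → S ∈ fam → weight S f g < 2 ^ i * suc x ^ m
      weight< S S∈ = begin-strict
        weight S f g ≡⟨ +-identityʳ (weight S f g) ⟨
        1 * weight S f g ≤⟨ Σℓ-∈ (λ S → 1 * weight S f g) S∈ ⟩
        Σℓ (λ S → 1 * weight S f g) fam ≤⟨ h ⟩
        suc x ^ m * Σℓ (λ _ → 1) fam ≡⟨ *-comm (suc x ^ m) _ ⟩
        Σℓ (λ _ → 1) fam * suc x ^ m ≡⟨ cong (_* suc x ^ m) (trans (Σℓ-const 1 fam) (*-identityˡ (length fam))) ⟩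
        length fam * suc x ^ m <⟨ *-monoˡ-< (suc x ^ m) {{>-nonZero (m^n>0 (suc x) m)}} few ⟩
        2 ^ i * suc x ^ m ∎
        where open ≤-Reasoning
      bound : ∀ S → S ∈ fam → # (λ k → S (f k)) ≤ # (λ k → S (g k)) + (j + suc x * i)
      bound S S∈ = ≮⇒≥ (λ lt → n≮n _ (impossible lt (weight-shape S f g)))
        where
        impossible : # (λ k → S (g k)) + (j + suc x * i) < # (λ k → S (f k)) →
          (Σ ℕ λ P → Σ ℕ λ N → Σ ℕ λ Z → weight S f g ≡ (2 + x) ^ P * x ^ N * suc x ^ Z × P + N + Z ≡ m ×
            # (λ i → S (f i)) + N ≡ # (λ i → S (g i)) + P) → weight S f g < weight S f g
        impossible lt (P , N , Z , w , sum , d) = ≤-trans (weight< S S∈) (begin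
          2 ^ i * suc x ^ m ≡⟨ cong (λ k → 2 ^ i * suc x ^ k) (sym sum) ⟩
          2 ^ i * suc x ^ (P + N + Z) ≤⟨ drift x i j N P Z N≤ P≥ ⟩
          (2 + x) ^ P * x ^ N * suc x ^ Z ≡⟨ w ⟨
          weight S f g ∎)
          where
          open ≤-Reasoning
          N≤ : N ≤ x * j
          N≤ = ≤-trans (≤-trans (m≤n+m N P) (≤-trans (m≤m+n (P + N) Z) (≤-reflexive sum))) m≤
          id : ∀ N e a b P → P + (suc (a + e) + (b + N)) ≡ N + e + (b + (a + P)) + 1
          id = solve-∀
          P≥ : N + (j + suc x * i) ≤ P
          P≥ = lin 1 (lt ⊹ ≤-reflexive d) (id N (j + suc x * i) (# (λ k → S (g k))) (# (λ k → S (f k))) P)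

  -- Without expansion the digraph would be extremal

  -- Meant for p = N(a), q = N(a₀) and r = B: B and N(a₀) nearly partition the second half, so if
  -- N(a) also has little in B, then a has few neighbours that a₀ lacks.
  cnt-inner : {A : Set} (p q r : A → Bool) → ∀ xs →
    cnt (λ x → p x ∧ not (q x)) xs ≤ cnt (λ x → r x ∧ p x) xs + cnt (λ x → not (r x) ∧ not (q x)) xs
  cnt-inner p q r xs = ≤-trans (Σℓ-mono (λ x → pointwise (p x) (q x) (r x)) xs)
    (≤-reflexive (Σℓ-+ (λ x → ⟨ r x ∧ p x ⟩) (λ x → ⟨ not (r x) ∧ not (q x) ⟩) xs))
    where
    pointwise : ∀ p q r → ⟨ p ∧ not q ⟩ ≤ ⟨ r ∧ p ⟩ + ⟨ not r ∧ not q ⟩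
    pointwise false q r = z≤n
    pointwise true q false = ≤-refl
    pointwise true true true = z≤n
    pointwise true false true = ≤-refl

  cnt-outer : {A : Set} (q r : A → Bool) → ∀ xs →
    cnt (λ x → not (r x) ∧ not (q x)) xs + (cnt q xs + cnt r xs) ≤ length xs + cnt (λ x → r x ∧ q x) xs
  cnt-outer q r xs = begin
    Σℓ f xs + (cnt q xs + cnt r xs) ≡⟨ cong (Σℓ f xs +_) (Σℓ-+ (λ x → ⟨ q x ⟩) (λ x → ⟨ r x ⟩) xs) ⟨
    Σℓ f xs + Σℓ (λ x → ⟨ q x ⟩ + ⟨ r x ⟩) xs ≡⟨ Σℓ-+ f (λ x → ⟨ q x ⟩ + ⟨ r x ⟩) xs ⟨
    Σℓ (λ x → f x + (⟨ q x ⟩ + ⟨ r x ⟩)) xs ≤⟨ Σℓ-mono (λ x → pointwise (q x) (r x)) xs ⟩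
    Σℓ (λ x → 1 + ⟨ r x ∧ q x ⟩) xs ≡⟨ Σℓ-+ (λ _ → 1) (λ x → ⟨ r x ∧ q x ⟩) xs ⟩
    Σℓ (λ _ → 1) xs + cnt (λ x → r x ∧ q x) xs ≡⟨ cong (_+ cnt (λ x → r x ∧ q x) xs) (trans (Σℓ-const 1 xs) (*-identityˡ _)) ⟩
    length xs + cnt (λ x → r x ∧ q x) xs ∎
    where
    open ≤-Reasoning
    f = λ x → ⟨ not (r x) ∧ not (q x) ⟩
    pointwise : ∀ q r → ⟨ not r ∧ not q ⟩ + (⟨ q ⟩ + ⟨ r ⟩) ≤ 1 + ⟨ r ∧ q ⟩
    pointwise false false = ≤-refl
    pointwise true false = ≤-refl
    pointwise false true = ≤-refl
    pointwise true true = ≤-refl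

  cnt-cover : {A : Set} (p q : A → Bool) → ∀ xs → cnt p xs + cnt q xs ≤ cnt (λ x → q x ∧ p x) xs + length xs
  cnt-cover p q xs = ≤-trans (m≤n+m _ (cnt (λ x → not (q x) ∧ not (p x)) xs)) (≤-trans (cnt-outer p q xs) (≤-reflexive (+-comm (length xs) _)))

  module Arith where
    few-rich : ∀ {n a c d t g} → n ≤ 2 * a + g → c + d ≡ a → c < t → n ≤ 2 * d + (g + 2 * t)
    few-rich {n} {_} {c} {d} {t} {g} h refl lt = lin 2 (h ⊹ *-monoʳ-≤ 2 lt) (id n c d t g)
      where
      id : ∀ n c d t g → 2 * d + (g + 2 * t) + (n + 2 * suc c) ≡ n + (2 * (c + d) + g + 2 * t) + 2
      id = solve-∀

    -- The origin of `β`. Balance gives D ≤ 2y + d for the private neighbours, y of them in the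
    -- second half; and y ≤ i + q, where i is the part of N(a) in B and q counts what lies outside
    -- both B (of size b) and N(a₀) (of size h).
    few-private : ∀ {n D x y b q h i t s d g} → D ≡ x + y → x ≤ y + d → y ≤ i + q → i < t → q + (h + b) ≤ n + t →
      n ≤ 2 * h + (s + d) → n ≤ 2 * b + g → D ≤ 4 * t + g + s + 2 * d
    few-private {n} {_} {x} {y} {b} {q} {h} {i} {t} {s} {d} {g} refl h₁ h₂ h₃ h₄ h₅ h₆ =
      lin 2 (h₁ ⊹ *-monoʳ-≤ 2 h₂ ⊹ *-monoʳ-≤ 2 h₃ ⊹ *-monoʳ-≤ 2 h₄ ⊹ h₅ ⊹ h₆) (id n x y b q h i t s d g)
      where
      id : ∀ n x y b q h i t s d g →
        4 * t + g + s + 2 * d + (x + (2 * y + (2 * suc i + (2 * (q + (h + b)) + (n + n)))))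
        ≡ x + y + (y + d + (2 * (i + q) + (2 * t + (2 * (n + t) + (2 * h + (s + d) + (2 * b + g)))))) + 2
      id = solve-∀

    degree-≤ : ∀ {n D x y b q t d g} → D ≡ x + y → x ≤ y + d → q + (y + b) ≤ n + t → n ≤ 2 * b + g → D ≤ n + (g + 2 * t + d)
    degree-≤ {n} {_} {x} {y} {b} {q} {t} {d} {g} refl h₁ h₂ h₃ =
      lin (2 * q) (h₁ ⊹ *-monoʳ-≤ 2 h₂ ⊹ h₃) (id n x y b q t d g)
      where
      id : ∀ n x y b q t d g → n + (g + 2 * t + d) + (x + (2 * (q + (y + b)) + n))
        ≡ x + y + (y + d + (2 * (n + t) + (2 * b + g))) + 2 * q
      id = solve-∀

    near-≥ : ∀ {n N x y a d t g} → N ≡ x + y → x ≤ y + d → a ≤ x → n ≤ 2 * a + (g + 2 * t) → n ≤ N + (g + 2 * t + d)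
    near-≥ {n} {_} {x} {y} {a} {d} {t} {g} refl h₁ h₂ h₃ = lin 0 (h₁ ⊹ *-monoʳ-≤ 2 h₂ ⊹ h₃) (id n x y a d t g)
      where
      id : ∀ n x y a d t g → x + y + (g + 2 * t + d) + (x + (2 * a + n)) ≡ n + (y + d + (2 * x + (2 * a + (g + 2 * t)))) + 0
      id = solve-∀

    complement-≥ : ∀ {n D B e} → D + B ≡ 2 * n → D ≤ n + e → n ≤ B + e
    complement-≥ {n} {D} {B} {e} h₁ h₂ = lin 0 (h₂ ⊹ ≤-reflexive (sym h₁)) (id n D B e)
      where
      id : ∀ n D B e → B + e + (D + 2 * n) ≡ n + (n + e + (D + B)) + 0
      id = solve-∀

    complement-≤ : ∀ {n D B s} → D + B ≡ 2 * n → n ≤ D + s → B ≤ n + s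
    complement-≤ {n} {D} {B} {s} h₁ h₂ = lin 0 (h₂ ⊹ ≤-reflexive h₁) (id n D B s)
      where
      id : ∀ n D B s → n + s + (n + (D + B)) ≡ B + (D + s + 2 * n) + 0
      id = solve-∀

    scale-≥ : ∀ {n B k E} → n ≤ B + E → 2 * k * E ≤ n → k * n ≤ k * B + n
    scale-≥ {n} {B} {k} {E} h₁ h₂ = lin (k * E) (*-monoʳ-≤ k h₁ ⊹ h₂) (id n B k E)
      where
      id : ∀ n B k E → k * B + n + (k * n + 2 * k * E) ≡ k * n + (k * (B + E) + n) + k * E
      id = solve-∀

    scale-≤ : ∀ {n B k s l} → B ≤ n + s + l → 2 * k * s ≤ n → 2 * k * l ≤ n → k * B ≤ k * n + n
    scale-≤ {n} {B} {k} {s} {l} h₁ h₂ h₃ = *-cancelˡ-≤ 2 (lin 0 (*-monoʳ-≤ 2 (*-monoʳ-≤ k h₁) ⊹ h₂ ⊹ h₃) (id n B k s l))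
      where
      id : ∀ n B k s l → 2 * (k * n + n) + (2 * (k * B) + (2 * k * s + 2 * k * l))
        ≡ 2 * (k * B) + (2 * (k * (n + s + l)) + (n + n)) + 0
      id = solve-∀

    nonempty : ∀ {n B k E} → 0 < n → 0 < k → n ≤ 2 * B + E → 2 * k * E ≤ n → 0 < B
    nonempty {n} {zero} {suc k} {E} 0<n _ h₁ h₂ = ⊥-elim (1+n≰n (≤-trans 0<n (lin (2 * k * E) (*-monoʳ-≤ 2 h₁ ⊹ h₂) (id n k E))))
      where
      id : ∀ n k E → 0 + (2 * n + 2 * suc k * E) ≡ n + (2 * (0 + E) + n) + 2 * k * E
      id = solve-∀
    nonempty {B = suc B} _ _ _ _ = s≤s z≤n

  private-nbr : ∀ {m} → (Fin m → Fin m → Bool) → Fin m → Fin m → Fin m → Bool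
  private-nbr E a₀ a w = E a w ∧ not (E a₀ w)

  near : ∀ {m} → (Fin m → Fin m → Bool) → ℕ → Fin m → Fin m → Bool
  near E β a₀ a = # (private-nbr E a₀ a) ≤ᵇ β

  -- Here 1/k is the parameter of extremality, s the degree defect, d the discrepancy of the
  -- partition, and g and t are the slack and the constant of the expansion to be shown.
  module Transfer {n m : ℕ} (E : Fin m → Fin m → Bool) (fx fy : Fin n → Fin m) (k s d g t : ℕ) (m≡ : m ≡ 2 * n)
    (0<n : 0 < n) (0<k : 0 < k)
    (halves : ∀ (S : Fin m → Bool) → # S ≡ # (λ i → S (fx i)) + # (λ i → S (fy i)))
    (outdeg≥ : ∀ v → n ≤ # (E v) + s)
    (indeg≥ : ∀ v → n ≤ # (λ u → E u v) + s)
    (small : 2 * k * ((g + 2 * t + d) + 4 * k * (4 * t + g + s + 2 * d)) ≤ n)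
    (small′ : 2 * k * s ≤ n)
    (non-extremal : ∀ (A B : Fin m → Bool) →
      k * n ≤ k * # A + n → k * # A ≤ k * n + n → k * n ≤ k * # B + n → k * # B ≤ k * n + n →
      (∀ a → A a ≡ true → k * # (λ w → B w ∧ E a w) ≤ n) →
      (∀ b → B b ≡ true → k * # (λ w → A w ∧ E w b) ≤ n) → ⊥)
    where

    V : Set
    V = Fin m

    -- `e` is the error in the size of the cluster and in the out-degree of its centre, `β` the
    -- number of private neighbours allowed in the cluster.
    e β : ℕ
    e = g + 2 * t + d
    β = 4 * t + g + s + 2 * d

    e≤ : 2 * k * e ≤ n
    e≤ = ≤-trans (*-monoʳ-≤ (2 * k) (m≤m+n e _)) small

    module Cluster (a₀ : V) (A₀-large : n ≤ # (near E β a₀) + e) (a₀-degree : # (E a₀) ≤ n + e) where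

      A₀ B₀ B₁ : V → Bool
      A₀ = near E β a₀
      B₀ w = not (E a₀ w)

      l : ℕ
      l = _/_ n (2 * k) {{>-nonZero (*-mono-≤ {1} {2} (s≤s z≤n) 0<k)}}

      inA₀ : V → ℕ
      inA₀ b = # (λ w → A₀ w ∧ E w b)

      -- The members of A₀ send few edges into B₀, but single vertices of B₀ may still receive many.
      -- Extremality restricts these in-degrees too, so the vertices receiving more than n/(2k)
      -- edges are discarded.
      poor : V → Bool
      poor b = inA₀ b ≤ᵇ l

      B₁ b = B₀ b ∧ poor b

      l-≤ : 2 * k * l ≤ n
      l-≤ = ≤-trans (≤-reflexive (*-comm (2 * k) l)) (m/n*n≤m n (2 * k) {{>-nonZero (*-mono-≤ {1} {2} (s≤s z≤n) 0<k)}})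

      l-> : n ≤ 2 * k * suc l
      l-> = ≤-trans (≤-reflexive (m≡m%n+[m/n]*n n (2 * k) {{nz}}))
        (≤-trans (+-monoˡ-≤ (l * (2 * k)) (<⇒≤ (m%n<n n (2 * k) {{nz}}))) (≤-reflexive (*-comm (suc l) (2 * k))))
        where
        nz : NonZero (2 * k)
        nz = >-nonZero (*-mono-≤ {1} {2} (s≤s z≤n) 0<k)

      B₀-total : # (E a₀) + # B₀ ≡ 2 * n
      B₀-total = trans (cnt-not (E a₀) (allFin m)) (trans (length-allFin m) m≡)

      bad : V → Bool
      bad b = B₀ b ∧ not (poor b)

      few-from : ∀ a → A₀ a ≡ true → # (λ w → B₀ w ∧ E a w) ≤ β
      few-from a e = ≤-trans (cnt-mono (λ w e′ → flip-∧ (E a w) (B₀ w) e′) (allFin m)) (≤ᵇ≡true⇒≤ {# (private-nbr E a₀ a)} e)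
        where
        flip-∧ : ∀ p q → q ∧ p ≡ true → p ∧ q ≡ true
        flip-∧ true true _ = refl
        flip-∧ p false ()

      -- Double counting of the edges from A₀ to B₀: each source sends at most `β`, each bad vertex
      -- receives at least `suc l`.
      edge-count : suc l * # bad ≤ β * m
      edge-count = begin
        suc l * # bad ≡⟨ Σℓ-* (suc l) (λ b → ⟨ bad b ⟩) (allFin m) ⟨
        Σℓ (λ b → suc l * ⟨ bad b ⟩) (allFin m) ≤⟨ Σℓ-mono per-target (allFin m) ⟩
        Σℓ (λ b → # (λ w → edge w b)) (allFin m) ≡⟨ Σℓ-comm (λ b w → ⟨ edge w b ⟩) (allFin m) (allFin m) ⟩
        Σℓ (λ w → # (edge w)) (allFin m) ≤⟨ Σℓ-≤-const β (allFin m) (λ w _ → per-source w) ⟩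
        β * length (allFin m) ≡⟨ cong (β *_) (length-allFin m) ⟩
        β * m ∎
        where
        open ≤-Reasoning
        edge : V → V → Bool
        edge w b = A₀ w ∧ (B₀ b ∧ E w b)
        per-source : ∀ w → # (edge w) ≤ β
        per-source w with A₀ w in eq
        ... | true = few-from w eq
        ... | false = ≤-trans (≤-reflexive (Σℓ-const 0 (allFin m))) z≤n
        per-target : ∀ b → suc l * ⟨ bad b ⟩ ≤ # (λ w → edge w b)
        per-target b with B₀ b | poor b in eq
        ... | true | false = ≤-trans (≤-reflexive (*-identityʳ (suc l))) (≤ᵇ≡false⇒> {inA₀ b} eq)
        ... | true | true = ≤-trans (≤-reflexive (*-zeroʳ l)) z≤n
        ... | false | _ = ≤-trans (≤-reflexive (*-zeroʳ l)) z≤n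

      bad-few : # bad ≤ 4 * k * β
      bad-few = *-cancelʳ-≤ (# bad) (4 * k * β) n {{>-nonZero 0<n}} (begin
        # bad * n ≤⟨ *-monoʳ-≤ (# bad) l-> ⟩
        # bad * (2 * k * suc l) ≡⟨ id₁ (# bad) k (suc l) ⟩
        2 * k * (suc l * # bad) ≤⟨ *-monoʳ-≤ (2 * k) edge-count ⟩
        2 * k * (β * m) ≡⟨ cong (λ m → 2 * k * (β * m)) m≡ ⟩
        2 * k * (β * (2 * n)) ≡⟨ id₂ k β n ⟩
        4 * k * β * n ∎)
        where
        open ≤-Reasoning
        id₁ : ∀ b k l → b * (2 * k * l) ≡ 2 * k * (l * b)
        id₁ = solve-∀
        id₂ : ∀ k b n → 2 * k * (b * (2 * n)) ≡ 4 * k * b * n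
        id₂ = solve-∀

      B₁-large : n ≤ # B₁ + (e + 4 * k * β)
      B₁-large = lin 0 (Arith.complement-≥ {n} {# (E a₀)} {# B₀} {e} B₀-total a₀-degree
          ⊹ ≤-reflexive (sym (cnt-split≡ B₀ poor (allFin m))) ⊹ bad-few)
        (id n (# B₀) (# B₁) (# bad) e (4 * k * β))
        where
        id : ∀ n b c d e f → c + (e + f) + (n + (b + d)) ≡ n + (b + e + ((c + d) + f)) + 0
        id = solve-∀

      B₁-≤ : # B₁ ≤ n + s + 0
      B₁-≤ = ≤-trans (cnt-mono {q = B₀} (λ b e → proj₁ (∧-elim (B₀ b) e)) (allFin m))
        (≤-trans (Arith.complement-≤ {n} {# (E a₀)} B₀-total (outdeg≥ a₀)) (m≤m+n _ 0))

      -- Any b in B₁ has at least n - s in-neighbours, of which at most l lie in A₀; this leaves 2n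
      -- - (n - s) + l places for A₀.
      A₀-≤ : # A₀ ≤ n + s + l
      A₀-≤ with cnt-∃ B₁ (allFin m) (Arith.nonempty {n} {# B₁} {k} 0<n 0<k (≤-trans B₁-large (+-monoˡ-≤ _ (m≤m+n (# B₁) _))) small)
      ... | b , _ , B₁b = lin 0
        (cnt-cover (λ w → E w b) A₀ (allFin m) ⊹ indeg≥ b ⊹ ≤ᵇ≡true⇒≤ {inA₀ b} (proj₂ (∧-elim (B₀ b) B₁b))
          ⊹ ≤-reflexive (trans (length-allFin m) m≡))
        (id n (# (λ w → E w b)) (# A₀) (inA₀ b) l s (length (allFin m)))
        where
        id : ∀ n i a x l s L → n + s + l + (i + a + (n + (x + L))) ≡ a + (x + L + (i + s + (l + 2 * n))) + 0
        id = solve-∀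

      contradict : ⊥
      contradict = non-extremal A₀ B₁
        (Arith.scale-≥ {n} {# A₀} {k} {e} A₀-large e≤)
        (Arith.scale-≤ {n} {# A₀} {k} {s} {l} A₀-≤ small′ l-≤)
        (Arith.scale-≥ {n} {# B₁} {k} B₁-large small)
        (Arith.scale-≤ {n} {# B₁} {k} {s} {0} B₁-≤ small′ (≤-trans (≤-reflexive (*-zeroʳ (2 * k))) z≤n))
        (λ a A₀a → ≤-trans (*-monoʳ-≤ k (≤-trans (cnt-mono {q = λ w → B₀ w ∧ E a w}
            (λ w e → ∧-intro (proj₁ (∧-elim (B₀ w) (proj₁ (∧-elim (B₁ w) e)))) (proj₂ (∧-elim (B₁ w) e))) (allFin m))
            (few-from a A₀a))) kβ≤)
        (λ b B₁b → ≤-trans (*-monoʳ-≤ k (≤ᵇ≡true⇒≤ {inA₀ b} (proj₂ (∧-elim (B₀ b) B₁b)))) kl≤)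
        where
        kβ≤ : k * β ≤ n
        kβ≤ = ≤-trans (lin (k * (k * β) * 7 + 2 * k * e) (*-monoʳ-≤ β (*-monoʳ-≤ k 0<k)) (id k β e)) small
          where
          id : ∀ k β e → 2 * k * (e + 4 * k * β) + β * (k * 1) ≡ k * β + β * (k * k) + (k * (k * β) * 7 + 2 * k * e)
          id = solve-∀
        kl≤ : k * l ≤ n
        kl≤ = ≤-trans (≤-trans (m≤m+n (k * l) (k * l)) (≤-reflexive (id k l))) l-≤
          where
          id : ∀ k l → k * l + k * l ≡ 2 * k * l
          id = solve-∀

    H : Fin n → Fin n → Bool
    H i j = E (fx i) (fy j)

    module Balanced
      (out-bal : ∀ v → # (λ i → E v (fx i)) ≤ # (λ i → E v (fy i)) + d)
      (in-bal : ∀ v → # (λ i → E (fy i) v) ≤ # (λ i → E (fx i) v) + d)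
      (private-bal : ∀ a₀ a → # (λ i → private-nbr E a₀ a (fx i)) ≤ # (λ i → private-nbr E a₀ a (fy i)) + d)
      (near-bal : ∀ a₀ → # (λ i → near E β a₀ (fx i)) ≤ # (λ i → near E β a₀ (fy i)) + d) where

      H-row : ∀ i → n ≤ 2 * # (H i) + (s + d)
      H-row i = lin 0 (outdeg≥ (fx i) ⊹ ≤-reflexive (halves (E (fx i))) ⊹ out-bal (fx i))
        (id n (# (E (fx i))) (# (λ j → E (fx i) (fx j))) (# (H i)) s d)
        where
        id : ∀ n D x y s d → 2 * y + (s + d) + (n + (D + x)) ≡ n + (D + s + (x + y + (y + d))) + 0
        id = solve-∀

      H-col : ∀ j → n ≤ 2 * # (λ i → H i j) + (s + d)
      H-col j = lin 0 (indeg≥ (fy j) ⊹ ≤-reflexive (halves (λ u → E u (fy j))) ⊹ in-bal (fy j))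
        (id n (# (λ u → E u (fy j))) (# (λ i → H i j)) (# (λ i → E (fy i) (fy j))) s d)
        where
        id : ∀ n D x y s d → 2 * x + (s + d) + (n + (D + y)) ≡ n + (D + s + (x + y + (x + d))) + 0
        id = solve-∀

      -- If fewer than t vertices of A send t edges into B, the set A′ of the others is still nearly
      -- half of the first half. Each of them may serve as a₀, and all of A′ lies in its cluster; as
      -- clusters are balanced, this one has nearly n vertices.
      H-expand : ∀ A B → n ≤ 2 * # A + g → n ≤ 2 * # B + g →
        t ≤ # (λ a → A a ∧ (t ≤ᵇ # (λ b → B b ∧ H a b)))
      H-expand A B A-large B-large = ≮⇒≥ λ few → absurd few (cnt-∃ A′ (allFin n)
        (Arith.nonempty {n} {# A′} {k} {g + 2 * t} 0<n 0<k (A′-large few)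
          (≤-trans (*-monoʳ-≤ (2 * k) (m≤m+n (g + 2 * t) d)) e≤)))
        where
        into : Fin n → ℕ
        into a = # (λ b → B b ∧ H a b)
        A′ : Fin n → Bool
        A′ a = A a ∧ not (t ≤ᵇ into a)
        A′-large : # (λ a → A a ∧ (t ≤ᵇ into a)) < t → n ≤ 2 * # A′ + (g + 2 * t)
        A′-large few = Arith.few-rich {n} {# A} {# (λ a → A a ∧ (t ≤ᵇ into a))} {# A′} A-large
          (cnt-split≡ A (λ a → t ≤ᵇ into a) (allFin n)) few
        into< : ∀ i → A′ i ≡ true → into i < t
        into< i e = ≤ᵇ≡false⇒> {t} (not-elim (proj₂ (∧-elim (A i) e)))
        absurd : # (λ a → A a ∧ (t ≤ᵇ into a)) < t → (Σ (Fin n) λ i → i ∈ allFin n × A′ i ≡ true) → ⊥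
        absurd few (i₀ , _ , A′i₀) = Cluster.contradict a₀ A₀-large a₀-degree
          where
          a₀ : V
          a₀ = fx i₀
          outside : ℕ
          outside = # (λ b → not (B b) ∧ not (H i₀ b))
          outside-≤ : outside + (# (H i₀) + # B) ≤ n + t
          outside-≤ = ≤-trans (cnt-outer (H i₀) B (allFin n))
            (+-mono-≤ (≤-reflexive (length-allFin n)) (<⇒≤ (into< i₀ A′i₀)))
          close : ∀ i → A′ i ≡ true → near E β a₀ (fx i) ≡ true
          close i A′i = <⇒≤ᵇ≡true (Arith.few-private {n} {# (private-nbr E a₀ (fx i))} {b = # B} {q = outside} {h = # (H i₀)} {i = into i}
            (halves (private-nbr E a₀ (fx i))) (private-bal a₀ (fx i))
            (cnt-inner (H i) (H i₀) B (allFin n)) (into< i A′i) outside-≤ (H-row i₀) B-large)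
          A₀-large : n ≤ # (near E β a₀) + e
          A₀-large = Arith.near-≥ {n} {# (near E β a₀)} {a = # A′} {d} {t} {g} (halves (near E β a₀)) (near-bal a₀) (cnt-mono {p = A′} close (allFin n)) (A′-large few)
          -- In the second half N⁺(a₀) nearly misses B, so it has hardly more than n/2 vertices
          -- there and, by balance, hardly more in the first half.
          a₀-degree : # (E a₀) ≤ n + e
          a₀-degree = Arith.degree-≤ {n} {# (E a₀)} {b = # B} {q = outside} (halves (E a₀)) (out-bal a₀) outside-≤ B-large

  -- Choice of the parameters

  -- G = t + 1 = 26 m u is the scale of the expansion property.
  module _ (k m u t : ℕ) (m≡ : m ≡ 72 * (k * k)) (G≡ : suc t ≡ 26 * m * u) (0<k : 0 < k) (0<u : 0 < u) where

    0<m : 0 < m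
    0<m = subst (0 <_) (sym m≡) (*-mono-≤ {1} {72} (s≤s z≤n) (*-mono-≤ 0<k 0<k))

    26u≤G : 26 * u ≤ suc t
    26u≤G = ≤-trans (≤-reflexive (cong (_* u) (sym (*-identityʳ 26))))
      (≤-trans (*-monoˡ-≤ u (*-monoʳ-≤ 26 0<m)) (≤-reflexive (sym G≡)))

    u≤G : u ≤ suc t
    u≤G = ≤-trans (m≤m+n u (25 * u)) 26u≤G

    -- The origin of 72: for u ≤ G the left side is at most (8k + 64k²) G ≤ 72 k² G.
    transfer-slack : ∀ {n} → 26 * m * m * u ≤ n →
      2 * k * ((suc t + 2 * suc t + u) + 4 * k * (4 * suc t + suc t + u + 2 * u)) ≤ n
    transfer-slack h = ≤-trans (grow k (suc t) u 0<k u≤G)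
      (≤-trans (≤-reflexive (trans (cong₂ _*_ (sym m≡) G≡) (id m u))) h)
      where
      id : ∀ m u → m * (26 * m * u) ≡ 26 * m * m * u
      id = solve-∀
      grow : ∀ k G u → 0 < k → u ≤ G → 2 * k * ((G + 2 * G + u) + 4 * k * (4 * G + G + u + 2 * u)) ≤ 72 * (k * k) * G
      grow (suc j) G u _ le = lin (8 * G * (suc j * j)) (*-monoʳ-≤ (2 * suc j + 24 * (suc j * suc j)) le) (eq j G u)
        where
        eq : ∀ j G u → 72 * (suc j * suc j) * G + (2 * suc j + 24 * (suc j * suc j)) * u
          ≡ 2 * suc j * ((G + 2 * G + u) + 4 * suc j * (4 * G + G + u + 2 * u)) + (2 * suc j + 24 * (suc j * suc j)) * G
            + 8 * G * (suc j * j)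
        eq = solve-∀

    degree-slack : ∀ {n} → 26 * m * m * u ≤ n → 2 * k * u ≤ n
    degree-slack h = ≤-trans (*-monoˡ-≤ u (≤-trans (grow k 0<k) (≤-trans (≤-reflexive (trans (sym m≡) (sym (*-identityˡ m))))
      (*-monoˡ-≤ m {1} {26 * m} (*-mono-≤ {1} {26} (s≤s z≤n) 0<m))))) h
      where
      grow : ∀ k → 0 < k → 2 * k ≤ 72 * (k * k)
      grow (suc j) _ = lin (suc j * (70 + 72 * j)) z≤n (eq j)
        where
        eq : ∀ j → 72 * (suc j * suc j) + 0 ≡ 2 * suc j + 0 + suc j * (70 + 72 * j)
        eq = solve-∀

    0<t : 0 < t
    0<t = s≤s⁻¹ (≤-trans (*-mono-≤ {2} {26} (s≤s (s≤s z≤n)) 0<u) 26u≤G)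

    -- n is at most 2m (t + 1); taking T = 4m pays for the passage from t + 1 to t.
    n≤Tt : ∀ {n} → n ≤ 2 * (26 * m * m) * u → n ≤ 4 * m * t
    n≤Tt {n} h = ≤-trans h (≤-trans (≤-reflexive (trans (id m u) (cong (2 * m *_) (sym G≡)))) (halve t 0<t))
      where
      id : ∀ m u → 2 * (26 * m * m) * u ≡ 2 * m * (26 * m * u)
      id = solve-∀
      halve : ∀ t → 0 < t → 2 * m * suc t ≤ 4 * m * t
      halve (suc j) _ = lin (2 * m * j) z≤n (eq m j)
        where
        eq : ∀ m j → 4 * m * suc j + 0 ≡ 2 * m * suc (suc j) + 0 + 2 * m * j
        eq = solve-∀

    -- The origin of 26. This is the slack condition of `hamiltonian` for r = 2u + 2, w = p = u and
    -- T = 4m, and for m = u = 1 both sides equal 26.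
    cover-slack : (u + u + 2) + 2 * u + 4 * u + 2 * (suc u * (4 * m)) ≤ suc t
    cover-slack = ≤-trans (grow m u 0<m 0<u) (≤-reflexive (sym G≡))
      where
      grow : ∀ m u → 0 < m → 0 < u → (u + u + 2) + 2 * u + 4 * u + 2 * (suc u * (4 * m)) ≤ 26 * m * u
      grow (suc a) (suc b) _ _ = lin (18 * a * b + 10 * a + 10 * b) z≤n (eq a b)
        where
        eq : ∀ a b → 26 * suc a * suc b + 0 ≡
          (suc b + suc b + 2) + 2 * suc b + 4 * suc b + 2 * (suc (suc b) * (4 * suc a)) + 0 + (18 * a * b + 10 * a + 10 * b)
        eq = solve-∀

  n<2^n : ∀ n → n < 2 ^ n
  n<2^n zero = s≤s z≤n
  n<2^n (suc n) = ≤-trans (+-mono-≤ {1} (≤-trans (s≤s z≤n) (n<2^n n)) (n<2^n n)) (≤-reflexive (cong (2 ^ n +_) (sym (+-identityʳ (2 ^ n)))))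

  -- As ι is linear in κ, the crude bound κ < 2^κ is enough: 10 n² ≤ κ³ < 2^(3κ).
  square-< : ∀ {n a κ ι} → n ≤ a * κ → 10 * (a * a) ≤ κ → ι ≡ 3 * κ → 10 * (n * n) < 2 ^ ι
  square-< {n} {a} {κ} h₁ h₂ refl = begin-strict
    10 * (n * n) ≤⟨ *-monoʳ-≤ 10 (*-mono-≤ h₁ h₁) ⟩
    10 * (a * κ * (a * κ)) ≡⟨ id a κ ⟩
    10 * (a * a) * (κ * κ) ≤⟨ *-monoˡ-≤ (κ * κ) h₂ ⟩
    κ * (κ * κ) <⟨ *-mono-< (n<2^n κ) (*-mono-< (n<2^n κ) (n<2^n κ)) ⟩
    2 ^ κ * (2 ^ κ * 2 ^ κ) ≡⟨ trans (cong (2 ^ κ *_) (cong (2 ^ κ *_) (sym (*-identityʳ (2 ^ κ))))) (trans (^-*-assoc 2 κ 3) (cong (2 ^_) (*-comm κ 3))) ⟩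
    2 ^ (3 * κ) ∎
    where
    open ≤-Reasoning
    id : ∀ a κ → 10 * (a * κ * (a * κ)) ≡ 10 * (a * a) * (κ * κ)
    id = solve-∀

  -- Reading a closed walk as an anti-directed Hamiltonian cycle

  -- Pigeonhole: if f identified p with another point, every value would have a preimage other than
  -- p, and `Fin (suc m)` would embed into `Fin m`.
  section⇒injective : ∀ {m} (f g : Fin m → Fin m) → (∀ y → f (g y) ≡ y) → ∀ {p p′} → f p ≡ f p′ → p ≡ p′
  section⇒injective {suc m} f g fg {p} {p′} eq with p Fin.≟ p′
  ... | yes e = e
  ... | no p≢p′ = ⊥-elim (1+n≰n (Fin.injective⇒≤ {f = h} h-injective))
    where
    avoid : ∀ y → Σ (Fin (suc m)) λ x → p ≢ x × f x ≡ y
    avoid y with p Fin.≟ g y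
    ... | yes e = p′ , p≢p′ , trans (sym eq) (trans (cong f e) (fg y))
    ... | no ne = g y , ne , fg y
    h : Fin (suc m) → Fin m
    h y = punchOut (proj₁ (proj₂ (avoid y)))
    h-injective : ∀ {y y′} → h y ≡ h y′ → y ≡ y′
    h-injective {y} {y′} e = trans (sym (proj₂ (proj₂ (avoid y)))) (trans (cong f
      (Fin.punchOut-injective (proj₁ (proj₂ (avoid y))) (proj₁ (proj₂ (avoid y′))) e)) (proj₂ (proj₂ (avoid y′))))

  section⇒permutation : ∀ {m} (f g : Fin m → Fin m) → (∀ y → f (g y) ≡ y) → Permutation′ m
  section⇒permutation f g fg = permutation f g fg (λ x → section⇒injective f g fg (fg (f x)))

  odd : ℕ → Bool
  odd zero = false
  odd (suc c) = not (odd c)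

  not-≢ : ∀ b → b ≢ not b
  not-≢ true ()
  not-≢ false ()

  not-not : ∀ b → not (not b) ≡ b
  not-not true = refl
  not-not false = refl

  odd-double : ∀ n → odd (n + (n + 0)) ≡ false
  odd-double zero = refl
  odd-double (suc n) rewrite +-suc n (n + 0) = trans (not-not (odd (n + (n + 0)))) (odd-double n)

  module Alternate {n m : ℕ} (E : Fin m → Fin m → Bool) (fx fy : Fin n → Fin m) (default : Fin m) where

    Edge : Bool → Fin m → Fin m → Set
    Edge true u v = E u v ≡ true
    Edge false u v = E v u ≡ true

    -- Even positions lie in the second half: a matching edge is traversed backwards from `fy i` to
    -- `fx i`, and an edge of `F` leads on to the next `fy j`. Positions below `double L` never meet
    -- the default.
    interleave : List (Fin n) → ℕ → Fin m
    interleave [] _ = default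
    interleave (i ∷ L) zero = fy i
    interleave (i ∷ L) (suc zero) = fx i
    interleave (i ∷ L) (suc (suc c)) = interleave L c

    double : ∀ {A : Set} → List A → ℕ
    double L = length L + (length L + 0)

    double-∷ : ∀ {A : Set} (x : A) L → double (x ∷ L) ≡ suc (suc (double L))
    double-∷ x L = cong suc (+-suc (length L) (length L + 0))

    interleave-fx : ∀ {i} L → i ∈ L → Σ ℕ λ c → c < double L × interleave L c ≡ fx i
    interleave-fx (i ∷ L) (here refl) = 1 , ≤-trans (s≤s (s≤s z≤n)) (≤-reflexive (sym (double-∷ i L))) , refl
    interleave-fx (j ∷ L) (there m) with interleave-fx L m
    ... | c , lt , e = suc (suc c) , ≤-trans (s≤s (s≤s lt)) (≤-reflexive (sym (double-∷ j L))) , e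

    interleave-fy : ∀ {i} L → i ∈ L → Σ ℕ λ c → c < double L × interleave L c ≡ fy i
    interleave-fy (i ∷ L) (here refl) = 0 , s≤s z≤n , refl
    interleave-fy (j ∷ L) (there m) with interleave-fy L m
    ... | c , lt , e = suc (suc c) , ≤-trans (s≤s (s≤s lt)) (≤-reflexive (sym (double-∷ j L))) , e

    module _ (F : Fin n → Fin n → Bool) (F⇒E : ∀ {i j} → F i j ≡ true → E (fx i) (fy j) ≡ true)
      (matched : ∀ i → E (fx i) (fy i) ≡ true) where

      open Walks F

      inner-edge : ∀ {s e} L → Walk s L e → ∀ c → suc c < double L → Edge (odd c) (interleave L c) (interleave L (suc c))
      inner-edge (i ∷ L) wk zero lt = matched i
      inner-edge (i ∷ []) wk (suc zero) (s≤s (s≤s ()))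
      inner-edge (i ∷ j ∷ L) (_ ∷ e ∷ _) (suc zero) lt = F⇒E e
      inner-edge (i ∷ L) (_ ∷ wk) (suc (suc c)) lt rewrite not-not (odd c) =
        inner-edge L wk c (s≤s⁻¹ (s≤s⁻¹ (≤-trans lt (≤-reflexive (double-∷ i L)))))

      last-vertex : ∀ {s e} i L → Walk s (i ∷ L) e → ∀ c → suc c ≡ double (i ∷ L) → interleave (i ∷ L) c ≡ fx e
      last-vertex i [] (_ ∷ []) (suc zero) eq = refl
      last-vertex i (j ∷ L) (_ ∷ wk) (suc (suc c)) eq =
        last-vertex j L wk c (suc-injective (suc-injective (trans eq (double-∷ i (j ∷ L)))))
      last-vertex i (j ∷ L) wk (suc zero) eq with trans eq (double-∷ i (j ∷ L))
      ... | ()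
      last-vertex i L wk zero eq with trans eq (double-∷ i L)
      ... | ()

      -- The walk returns to s, so its initial step, which leaves s, is the edge that closes the
      -- cycle.
      last-edge : ∀ {s} L → 0 < length L → Walk s L s → ∀ c → suc c ≡ double L → Edge true (interleave L c) (interleave L 0)
      last-edge (i ∷ L) _ wk@(e ∷ _) c eq = subst (λ v → E v (fy i) ≡ true) (sym (last-vertex i L wk c eq)) (F⇒E e)

  toℕ-next-< : ∀ {m} (p : Fin (suc m)) → suc (toℕ p) < suc m → toℕ (next p) ≡ suc (toℕ p)
  toℕ-next-< {m} p lt = trans (Fin.toℕ-fromℕ< _) (m<n⇒m%n≡m lt)

  toℕ-next-≡ : ∀ {m} (p : Fin (suc m)) → suc (toℕ p) ≡ suc m → toℕ (next p) ≡ 0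
  toℕ-next-≡ {m} p eq = trans (Fin.toℕ-fromℕ< _) (trans (cong (_% suc m) eq) (n%n≡0 (suc m)))

  module Close {n′ : ℕ} (D : Digraph (2 * suc n′)) (fx fy : Fin (suc n′) → Fin (2 * suc n′))
    (F : Fin (suc n′) → Fin (suc n′) → Bool) (F⇒E : ∀ {i j} → F i j ≡ true → E D (fx i) (fy j) ≡ true)
    (matched : ∀ i → E D (fx i) (fy i) ≡ true)
    (onto : ∀ v → (Σ (Fin (suc n′)) λ i → fx i ≡ v) ⊎ (Σ (Fin (suc n′)) λ i → fy i ≡ v)) where

    open Walks F
    open Alternate (E D) fx fy (fx Fin.zero)

    close : 3 ≤ 2 * suc n′ → ∀ {s} L → Walk s L s → L ↭ allFin (suc n′) → AntiDirHamCycle D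
    close 3≤ {s} L wk perm = 3≤ , section⇒permutation at position at-position , orientation , edges , alternates
      where
      size : double L ≡ 2 * suc n′
      size = cong (λ l → l + (l + 0)) (trans (↭-length perm) (length-allFin (suc n′)))
      at : Fin (2 * suc n′) → Fin (2 * suc n′)
      at p = interleave L (toℕ p)
      orientation : Fin (2 * suc n′) → Bool
      orientation p = odd (toℕ p)
      locate : ∀ v → Σ ℕ λ c → c < double L × interleave L c ≡ v
      locate v with onto v
      ... | inj₁ (i , refl) = interleave-fx L (∈-resp-↭ (↭-sym perm) (∈-allFin i))
      ... | inj₂ (i , refl) = interleave-fy L (∈-resp-↭ (↭-sym perm) (∈-allFin i))
      bound : ∀ v → proj₁ (locate v) < 2 * suc n′
      bound v = ≤-trans (proj₁ (proj₂ (locate v))) (≤-reflexive size)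
      position : Fin (2 * suc n′) → Fin (2 * suc n′)
      position v = fromℕ< (bound v)
      at-position : ∀ v → at (position v) ≡ v
      at-position v = trans (cong (interleave L) (Fin.toℕ-fromℕ< (bound v))) (proj₂ (proj₂ (locate v)))
      toT : ∀ {b} → b ≡ true → T b
      toT refl = _
      oriented : ∀ b {u v} → Edge b u v → OrientedEdge D b u v
      oriented true e = toT e
      oriented false e = toT e
      nonempty : 0 < length L
      nonempty = ≤-trans (s≤s z≤n) (≤-reflexive (sym (trans (↭-length perm) (length-allFin (suc n′)))))
      Position : Fin (2 * suc n′) → Set
      Position p = (suc (toℕ p) < 2 * suc n′ × toℕ (next p) ≡ suc (toℕ p)) ⊎ (suc (toℕ p) ≡ 2 * suc n′ × toℕ (next p) ≡ 0)
      locate-next : ∀ p → Position p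
      locate-next p with m≤n⇒m<n∨m≡n (Fin.toℕ<n p)
      ... | inj₁ lt = inj₁ (lt , toℕ-next-< p lt)
      ... | inj₂ eq = inj₂ (eq , toℕ-next-≡ p eq)
      -- The length is even, so the orientation by parity alternates across the seam as well.
      odd-last : ∀ p → suc (toℕ p) ≡ 2 * suc n′ → odd (toℕ p) ≡ true
      odd-last p eq with odd (toℕ p) | trans (cong odd eq) (odd-double (suc n′))
      ... | true | _ = refl
      edges : ∀ p → OrientedEdge D (orientation p) (at p) (at (next p))
      edges p with locate-next p
      ... | inj₁ (lt , e) rewrite e = oriented (odd (toℕ p))
        (inner-edge F F⇒E matched L wk (toℕ p) (≤-trans lt (≤-reflexive (sym size))))
      ... | inj₂ (eq , e) rewrite e | odd-last p eq =
        toT (last-edge F F⇒E matched L nonempty wk (toℕ p) (trans eq (sym size)))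
      alternates : ∀ p → orientation p ≢ orientation (next p)
      alternates p with locate-next p
      ... | inj₁ (lt , e) rewrite e = not-≢ (odd (toℕ p))
      ... | inj₂ (eq , e) rewrite e | odd-last p eq = λ ()

  -- Pairing the vertices, and the family of sets to be balanced

  Σℓ-+-split : ∀ a {b} (f : Fin (a + b) → ℕ) →
    Σℓ f (allFin (a + b)) ≡ Σℓ (λ i → f (i ↑ˡ b)) (allFin a) + Σℓ (λ j → f (a ↑ʳ j)) (allFin b)
  Σℓ-+-split zero f = refl
  Σℓ-+-split (suc a) {b} f = begin-equality
    Σℓ f (allFin (suc a + b)) ≡⟨ Σℓ-suc f ⟩
    f Fin.zero + Σℓ (λ i → f (Fin.suc i)) (allFin (a + b)) ≡⟨ cong (f Fin.zero +_) (Σℓ-+-split a (λ i → f (Fin.suc i))) ⟩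
    f Fin.zero + (Σℓ (λ i → f (Fin.suc (i ↑ˡ b))) (allFin a) + Σℓ (λ j → f (Fin.suc (a ↑ʳ j))) (allFin b))
      ≡⟨ +-assoc (f Fin.zero) _ _ ⟨
    f Fin.zero + Σℓ (λ i → f (Fin.suc (i ↑ˡ b))) (allFin a) + Σℓ (λ j → f (Fin.suc (a ↑ʳ j))) (allFin b)
      ≡⟨ cong (_+ Σℓ (λ j → f (Fin.suc (a ↑ʳ j))) (allFin b)) (Σℓ-suc (λ i → f (i ↑ˡ b))) ⟨
    Σℓ (λ i → f (i ↑ˡ b)) (allFin (suc a)) + Σℓ (λ j → f (suc a ↑ʳ j)) (allFin b) ∎
    where open ≤-Reasoning

  left right : ∀ {n} → Fin n → Fin (2 * n)
  left {n} i = i ↑ˡ (n + 0)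
  right {n} i = n ↑ʳ (i ↑ˡ 0)

  left-right : ∀ {n} (v : Fin (2 * n)) → (Σ (Fin n) λ i → left i ≡ v) ⊎ (Σ (Fin n) λ i → right i ≡ v)
  left-right {n} v with splitAt n v | Fin.join-splitAt n (n + 0) v
  ... | inj₁ i | e = inj₁ (i , e)
  ... | inj₂ j | e with splitAt n j | Fin.join-splitAt n 0 j
  ... | inj₁ i | e′ = inj₂ (i , trans (cong (n ↑ʳ_) e′) e)

  #-left-right : ∀ {n} (S : Fin (2 * n) → Bool) → # S ≡ # (λ i → S (left {n} i)) + # (λ i → S (right {n} i))
  #-left-right {n} S = trans (Σℓ-+-split n (λ v → ⟨ S v ⟩)) (cong (# (λ i → S (left {n} i)) +_)
    (trans (Σℓ-+-split n (λ j → ⟨ S (n ↑ʳ j) ⟩)) (+-identityʳ _)))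

  module Halves {n x : ℕ} (s : Fin n → Bool) where
    open Orient {Fin (2 * n)} x

    fx fy : Fin n → Fin (2 * n)
    fx = first left right s
    fy = second left right s

    halves : ∀ (S : Fin (2 * n) → Bool) → # S ≡ # (λ i → S (fx i)) + # (λ i → S (fy i))
    halves S = trans (#-left-right {n} S) (trans (sym (Σℓ-+ (λ i → ⟨ S (left {n} i) ⟩) (λ i → ⟨ S (right {n} i) ⟩) (allFin n)))
      (trans (≤-antisym (Σℓ-mono (λ i → ≤-reflexive (swapped i)) (allFin n)) (Σℓ-mono (λ i → ≤-reflexive (sym (swapped i))) (allFin n)))
        (Σℓ-+ (λ i → ⟨ S (fx i) ⟩) (λ i → ⟨ S (fy i) ⟩) (allFin n))))
      where
      swapped : ∀ i → ⟨ S (left {n} i) ⟩ + ⟨ S (right {n} i) ⟩ ≡ ⟨ S (fx i) ⟩ + ⟨ S (fy i) ⟩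
      swapped i with s i
      ... | true = refl
      ... | false = +-comm ⟨ S (left {n} i) ⟩ ⟨ S (right {n} i) ⟩

    onto : ∀ v → (Σ (Fin n) λ i → fx i ≡ v) ⊎ (Σ (Fin n) λ i → fy i ≡ v)
    onto v with left-right {n} v
    onto v | inj₁ (i , e) with s i in eq
    ... | true = inj₁ (i , trans (cong (λ b → if b then left i else right i) eq) e)
    ... | false = inj₂ (i , trans (cong (λ b → if b then right i else left i) eq) e)
    onto v | inj₂ (i , e) with s i in eq
    ... | true = inj₂ (i , trans (cong (λ b → if b then right i else left i) eq) e)
    ... | false = inj₁ (i , trans (cong (λ b → if b then left i else right i) eq) e)

  -- In-neighbourhoods enter through their complements, because `concentrate` bounds the surplus in
  -- the first half, while the column degrees need a bound on the surplus of in-neighbours in the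
  -- second.
  family : ∀ {m} → (Fin m → Fin m → Bool) → ℕ → List (Fin m → Bool)
  family {m} E β =
    map E (allFin m) ++ map (λ v u → not (E u v)) (allFin m) ++ map (near E β) (allFin m) ++
    map (λ (a₀ , a) → private-nbr E a₀ a) (cartesianProduct (allFin m) (allFin m))

  length-family : ∀ {m} (E : Fin m → Fin m → Bool) β → length (family E β) ≡ m + (m + (m + m * m))
  length-family {m} E β = trans (length-++ (map E (allFin m))) (cong₂ _+_ (all E)
    (trans (length-++ (map (λ v u → not (E u v)) (allFin m))) (cong₂ _+_ (all (λ v u → not (E u v)))
      (trans (length-++ (map (near E β) (allFin m))) (cong₂ _+_ (all (near E β))
        (trans (length-map (λ (a₀ , a) → private-nbr E a₀ a) (cartesianProduct (allFin m) (allFin m)))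
          (trans (length-cartesianProduct (allFin m) (allFin m)) (cong₂ _*_ (length-allFin m) (length-allFin m)))))))))
    where
    all : {B : Set} (f : Fin m → B) → length (map f (allFin m)) ≡ m
    all f = trans (length-map f (allFin m)) (length-allFin m)

  family-size : ∀ n → 0 < n → 2 * n + (2 * n + (2 * n + 2 * n * (2 * n))) ≤ 10 * (n * n)
  family-size (suc j) _ = lin (6 * j * suc j) z≤n (eq j)
    where
    eq : ∀ j → 10 * (suc j * suc j) + 0 ≡ 2 * suc j + (2 * suc j + (2 * suc j + 2 * suc j * (2 * suc j))) + 0 + 6 * j * suc j
    eq = solve-∀

  -- Assembling the cycle for one digraph

  module Cycle (k m u t ι xM F : ℕ) (m≡ : m ≡ 72 * (k * k)) (G≡ : suc t ≡ 26 * m * u) (0<k : 0 < k) (0<u : 0 < u) (0<ι : 0 < ι)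
    (M≡ : 4 * m * (4 * m) ≡ suc xM)
    (F≡ : F ≡ 6 * (suc (2 * (26 * m * m)) * suc xM))
    (u≡ : u ≡ 2 * (suc (4 * (26 * m * m)) * (F * ι)))
    {n′ : ℕ}
    (n-lower : 26 * m * m * u ≤ suc n′) (n-upper : suc n′ ≤ 2 * (26 * m * m) * u) (few : 10 * (suc n′ * suc n′) < 2 ^ ι)
    (D : Digraph (2 * suc n′))
    (outdeg≥ : ∀ v → suc n′ ≤ # (E D v) + u)
    (indeg≥ : ∀ v → suc n′ ≤ # (λ w → E D w v) + u)
    (non-extremal : ∀ (A B : Fin (2 * suc n′) → Bool) →
      k * suc n′ ≤ k * # A + suc n′ → k * # A ≤ k * suc n′ + suc n′ → k * suc n′ ≤ k * # B + suc n′ → k * # B ≤ k * suc n′ + suc n′ →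
      (∀ a → A a ≡ true → k * # (λ w → B w ∧ E D a w) ≤ suc n′) →
      (∀ b → B b ≡ true → k * # (λ w → A w ∧ E D w b) ≤ suc n′) → ⊥)
    where

    n : ℕ
    n = suc n′

    C x β : ℕ
    C = 26 * m * m
    x = 4 * C
    β = 4 * suc t + suc t + u + 2 * u

    0<F : 0 < F
    0<F = subst (0 <_) (sym F≡) (s≤s z≤n)

    0<m′ : 0 < m
    0<m′ = 0<m k m u t m≡ G≡ 0<k 0<u

    -- This fixes x = 4C: the number j = (1 + x) F ι is half of u, and n ≤ 2C u = 4C j.
    n≤xj : n ≤ x * (suc x * (F * ι))
    n≤xj = ≤-trans n-upper (≤-reflexive (trans (cong (2 * C *_) u≡) (id C (suc x * (F * ι)))))
      where
      id : ∀ C j → 2 * C * (2 * j) ≡ 4 * C * j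
      id = solve-∀

    -- One half of u pays for j, the other for the term (1 + x) ι.
    drift≤u : suc x * (F * ι) + suc x * ι ≤ u
    drift≤u = ≤-trans (+-monoʳ-≤ (suc x * (F * ι)) (*-monoʳ-≤ (suc x) (≤-trans (≤-reflexive (sym (*-identityˡ ι))) (*-monoˡ-≤ ι 0<F))))
      (≤-reflexive (trans (cong (suc x * (F * ι) +_) (sym (+-identityʳ _))) (sym u≡)))

    -- The reason for the factor `F` in u: there are 2C + 1 layers of xM ι gadgets with six vertices
    -- each, and `suc xM` in place of `xM` makes room for the starting vertex.
    absorbers-fit : 1 + suc (2 * C) * (6 * (xM * ι)) ≤ u
    absorbers-fit = ≤-trans (grow (2 * C) xM ι 0<ι) (≤-trans (≤-reflexive (cong (_* ι) (sym F≡)))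
      (≤-trans (≤-trans (m≤m+n (F * ι) (x * (F * ι))) (m≤m+n _ _)) (≤-reflexive (sym u≡))))
      where
      grow : ∀ K z ι → 0 < ι → 1 + suc K * (6 * (z * ι)) ≤ 6 * (suc K * suc z) * ι
      grow K z (suc i) _ = lin (5 + 6 * i + 6 * K * suc i) z≤n (eq K z i)
        where
        eq : ∀ K z i → 6 * (suc K * suc z) * suc i + 0 ≡ 1 + suc K * (6 * (z * suc i)) + 0 + (5 + 6 * i + 6 * K * suc i)
        eq = solve-∀

    0<xM : 0 < xM
    0<xM = s≤s⁻¹ (≤-trans (*-mono-≤ {2} {4 * m} {1} {4 * m} (*-mono-≤ {2} {4} (s≤s (s≤s z≤n)) 0<m′) (*-mono-≤ {1} {4} (s≤s z≤n) 0<m′)) (≤-reflexive M≡))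

    -- Because (1 + 1/xM)^(xM ι) ≥ 2^ι, which exceeds n².
    rounds-enough : xM ^ (xM * ι) * (n * n) < suc xM ^ (xM * ι)
    rounds-enough = begin-strict
      xM ^ (xM * ι) * (n * n) <⟨ *-monoʳ-< (xM ^ (xM * ι)) {{>-nonZero (m^n>0 xM {{>-nonZero 0<xM}} (xM * ι))}} (≤-trans (s≤s (m≤m+n (n * n) (9 * (n * n)))) few) ⟩
      xM ^ (xM * ι) * 2 ^ ι ≡⟨ *-comm _ (2 ^ ι) ⟩
      2 ^ ι * xM ^ (xM * ι) ≤⟨ doubling-^ xM ι 0<xM ⟩
      suc xM ^ (xM * ι) ∎
      where open ≤-Reasoning

    open Orient {Fin (2 * n)} x

    Balanced-by : ℕ → (Fin n → Bool) → Set
    Balanced-by d s = ∀ S → S ∈ family (E D) β →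
      # (λ i → S (first left right s i)) ≤ # (λ i → S (second left right s i)) + d

    balanced : Σ (Fin n → Bool) (Balanced-by u)
    balanced = widen (concentrate {m = n} ι (suc x * (F * ι)) left right (family (E D) β) n≤xj
      (≤-trans (s≤s (≤-trans (≤-reflexive (length-family (E D) β)) (family-size n (s≤s z≤n)))) few))
      where
      widen : Σ (Fin n → Bool) (Balanced-by (suc x * (F * ι) + suc x * ι)) → Σ (Fin n → Bool) (Balanced-by u)
      widen (s , h) = s , λ S m → ≤-trans (h S m) (+-monoʳ-≤ (# (λ i → S (second left right s i))) drift≤u)

    conclude : Σ (Fin n → Bool) (Balanced-by u) → 3 ≤ 2 * n → AntiDirHamCycle D
    conclude (s , bal) 3≤ = finish matching
      where
      open Halves {n} {x} s
      member-priv : ∀ a₀ a → private-nbr (E D) a₀ a ∈ family (E D) β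
      member-priv a₀ a = ∈-++⁺ʳ (map (E D) (allFin (2 * n))) (∈-++⁺ʳ (map (λ v u → not (E D u v)) (allFin (2 * n)))
        (∈-++⁺ʳ (map (near (E D) β) (allFin (2 * n))) (∈-map⁺ (λ (a₀ , a) → private-nbr (E D) a₀ a)
          (∈-cartesianProduct⁺ (∈-allFin a₀) (∈-allFin a)))))
      member-near : ∀ a₀ → near (E D) β a₀ ∈ family (E D) β
      member-near a₀ = ∈-++⁺ʳ (map (E D) (allFin (2 * n))) (∈-++⁺ʳ (map (λ v u → not (E D u v)) (allFin (2 * n)))
        (∈-++⁺ˡ (∈-map⁺ (near (E D) β) (∈-allFin a₀))))
      member-in : ∀ v → (λ u → not (E D u v)) ∈ family (E D) β
      member-in v = ∈-++⁺ʳ (map (E D) (allFin (2 * n))) (∈-++⁺ˡ (∈-map⁺ (λ v u → not (E D u v)) (∈-allFin v)))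
      -- Both halves have n vertices, so a surplus of non-in-neighbours in the first half is a
      -- surplus of in-neighbours in the second.
      in-bal : ∀ v → # (λ i → E D (fy i) v) ≤ # (λ i → E D (fx i) v) + u
      in-bal v = lin 0 (bal _ (member-in v) ⊹ ≤-reflexive (trans (cnt-not (λ i → E D (fy i) v) (allFin n)) (sym (cnt-not (λ i → E D (fx i) v) (allFin n)))))
        (id (# (λ i → E D (fx i) v)) (# (λ i → not (E D (fx i) v))) (# (λ i → E D (fy i) v)) (# (λ i → not (E D (fy i) v))) u)
        where
        id : ∀ a a′ b b′ u → a + u + (a′ + (b + b′)) ≡ b + (b′ + u + (a + a′)) + 0
        id = solve-∀
      open Transfer {n} {2 * n} (E D) fx fy k u u (suc t) (suc t) refl (s≤s z≤n) 0<k halves outdeg≥ indeg≥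
        (transfer-slack k m u t m≡ G≡ 0<k 0<u n-lower) (degree-slack k m u t m≡ G≡ 0<k 0<u n-lower) non-extremal using (H; module Balanced)
      open Balanced (λ v → bal _ (∈-++⁺ˡ (∈-map⁺ (E D) (∈-allFin v)))) in-bal (λ a₀ a → bal _ (member-priv a₀ a)) (λ a₀ → bal _ (member-near a₀))
      open Matching H (u + u) (suc t) t H-row H-col
        (≤-trans (≤-trans (≤-reflexive (cong (u +_) (sym (+-identityʳ u)))) (*-monoˡ-≤ u {2} {26} (s≤s (s≤s z≤n)))) (26u≤G k m u t m≡ G≡ 0<k 0<u)) H-expand
      finish : (Σ _ λ π → ∀ i → H i (π ⟨$⟩ʳ i) ≡ true) → AntiDirHamCycle D
      finish (π , matched) = cycle (Ham.hamiltonian F′ F-irr (u + u + 2) (suc t) t F-outdeg F-indeg F-expand 0<t′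
          {p = u} {w = u} {T = 4 * m} {K = 2 * C} {x = xM} {f = xM * ι}
          (n≤Tt k m u t m≡ G≡ 0<k 0<u n-upper) M≡ (cover-slack k m u t m≡ G≡ 0<k 0<u) n<
          rounds-enough absorbers-fit Fin.zero)
        where
        open Contract π renaming (F to F′)
        0<t′ : 0 < t
        0<t′ = 0<t k m u t m≡ G≡ 0<k 0<u
        n< : n < suc u * (2 * C)
        n< = ≤-trans (s≤s n-upper) (≤-trans (≤-reflexive (cong suc (*-comm (2 * C) u)))
          (+-monoˡ-≤ (u * (2 * C)) (*-mono-≤ {1} {2} (s≤s z≤n) (*-mono-≤ {1} {26 * m} (*-mono-≤ {1} {26} (s≤s z≤n) 0<m′) 0<m′))))
        open Walks F′ using (Walk)
        F′⇒E : ∀ {i j} → F′ i j ≡ true → E D (fx i) (fy (π ⟨$⟩ʳ j)) ≡ true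
        F′⇒E {i} {j} e = proj₁ (∧-elim (H i (π ⟨$⟩ʳ j)) e)
        onto′ : ∀ v → (Σ (Fin n) λ i → fx i ≡ v) ⊎ (Σ (Fin n) λ i → fy (π ⟨$⟩ʳ i) ≡ v)
        onto′ v with onto v
        ... | inj₁ h = inj₁ h
        ... | inj₂ (j , h) = inj₂ (π ⟨$⟩ˡ j , trans (cong fy (inverseʳ π)) h)
        cycle : (Σ (List (Fin n)) λ L → Walk Fin.zero L Fin.zero × L ↭ allFin n) → AntiDirHamCycle D
        cycle (L , wk , perm) = Close.close D fx (λ i → fy (π ⟨$⟩ʳ i)) F′ F′⇒E matched onto′ 3≤ L wk perm

    anti-directed-cycle : 3 ≤ 2 * n → AntiDirHamCycle D
    anti-directed-cycle = conclude balanced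

  -- Translating degrees and extremality; the choice of ε and n₀

  outdeg≡ : ∀ {m} (D : Digraph m) v → outdeg D v ≡ # (E D v)
  outdeg≡ D v = sym (cnt≡length-filterᵇ (E D v) (verts _))

  indeg≡ : ∀ {m} (D : Digraph m) v → indeg D v ≡ # (λ w → E D w v)
  indeg≡ D v = sym (cnt≡length-filterᵇ (λ w → E D w v) (verts _))

  ∣tabulate∣ : ∀ {m} (A : Fin m → Bool) → Sub.∣ tabulate A ∣ ≡ # A
  ∣tabulate∣ {zero} A = refl
  ∣tabulate∣ {suc m} A = trans (∣∷∣ (A Fin.zero) (tabulate (λ i → A (Fin.suc i))))
    (trans (cong (λ c → ⟨ A Fin.zero ⟩ + c) (∣tabulate∣ (λ i → A (Fin.suc i)))) (sym (Σℓ-suc (λ i → ⟨ A i ⟩))))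
    where
    ∣∷∣ : ∀ b (S : Sub.Subset m) → Sub.∣ b ∷ᵥ S ∣ ≡ ⟨ b ⟩ + Sub.∣ S ∣
    ∣∷∣ true S = refl
    ∣∷∣ false S = refl

  cnt-tabulate : ∀ {m} (A p : Fin m → Bool) →
    length (filterᵇ (λ w → lookup (tabulate A) w ∧ p w) (verts m)) ≤ # (λ w → A w ∧ p w)
  cnt-tabulate {m} A p = ≤-trans (≤-reflexive (sym (cnt≡length-filterᵇ _ (verts m))))
    (cnt-mono (λ w e → trans (cong (_∧ p w) (sym (lookup∘tabulate A w))) e) (verts m))

  ∈-tabulate : ∀ {m} (A : Fin m → Bool) {v} → v Sub.∈ tabulate A → A v ≡ true
  ∈-tabulate A {v} m = trans (sym (lookup∘tabulate A v)) ([]=⇒lookup m)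

  extremal : ∀ {α k p n} (D : Digraph (2 * n)) → ⟦ suc k ⟧ ℚ.* α ≡ ⟦ suc p ⟧ → (A B : Fin (2 * n) → Bool) →
    suc k * n ≤ suc k * # A + n → suc k * # A ≤ suc k * n + n →
    suc k * n ≤ suc k * # B + n → suc k * # B ≤ suc k * n + n →
    (∀ a → A a ≡ true → suc k * # (λ w → B w ∧ E D a w) ≤ n) →
    (∀ b → B b ≡ true → suc k * # (λ w → A w ∧ E D w b) ≤ n) → Extremal α n D
  extremal {α} {k} {p} {n} D h A B a₁ a₂ b₁ b₂ dA dB =
    tabulate A , tabulate B , lower A a₁ , upper A a₂ , lower B b₁ , upper B b₂ ,
    (λ a m → sparse (cnt-tabulate B (E D a)) (dA a (∈-tabulate A m))) ,
    (λ b m → sparse (cnt-tabulate A (λ w → E D w b)) (dB b (∈-tabulate B m)))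
    where
    lower : ∀ S → suc k * n ≤ suc k * # S + n → (1ℚ ℚ.- α) ℚ.* ⟦ n ⟧ ℚ.≤ ⟦ Sub.∣ tabulate S ∣ ⟧
    lower S le = Rational.minus-≤ {α} (Rational.scaled-≤ {k} {p} {α} {n} {Sub.∣ tabulate S ∣} {n} h
      (subst (λ c → suc k * n ≤ suc k * c + n) (sym (∣tabulate∣ S)) le))
    upper : ∀ S → suc k * # S ≤ suc k * n + n → ⟦ Sub.∣ tabulate S ∣ ⟧ ℚ.≤ (1ℚ ℚ.+ α) ℚ.* ⟦ n ⟧
    upper S le = subst (⟦ Sub.∣ tabulate S ∣ ⟧ ℚ.≤_) (Rational.plus-≡ α ⟦ n ⟧) (Rational.scaled-≤ {k} {p} {α} {Sub.∣ tabulate S ∣} {n} {n} h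
      (subst (λ c → suc k * c ≤ suc k * n + n) (sym (∣tabulate∣ S)) le))
    sparse : ∀ {c d} → c ≤ d → suc k * d ≤ n → ⟦ c ⟧ ℚ.≤ α ℚ.* ⟦ n ⟧
    sparse {c} c≤ le = subst (⟦ c ⟧ ℚ.≤_) (ℚ.+-identityˡ _) (Rational.scaled-≤ {k} {p} {α} {c} {0} {n} h
      (≤-trans (*-monoʳ-≤ (suc k) c≤) (≤-trans le (m≤n+m n (suc k * 0)))))

  -- With ε = 1/(c + 1), the bound n ≤ (c + 1) u says that the defect εn is at most u.
  min-degree : ∀ c {ε u n d} → ⟦ suc c ⟧ ℚ.* ε ≡ ⟦ 1 ⟧ → n ≤ suc c * u → (1ℚ ℚ.- ε) ℚ.* ⟦ n ⟧ ℚ.≤ ⟦ d ⟧ → n ≤ d + u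
  min-degree c {ε} {u} {n} {d} h n≤ le = *-cancelˡ-≤ (suc c)
    (≤-trans (Rational.unscaled-≤ {c} {ε} {n} {d} {n} h (Rational.≤-minus {ε} le))
      (≤-trans (+-monoʳ-≤ (suc c * d) n≤) (≤-reflexive (sym (*-distribˡ-+ (suc c) d u)))))

  module Scale (m : ℕ) (0<m : 0 < m) where

    C M F unitₖ a₁ : ℕ
    C = 26 * m * m
    M = 4 * m * (4 * m)
    F = 6 * (suc (2 * C) * M)
    -- u = unitₖ κ, where κ is the floor of n / a₁.
    unitₖ = 2 * (suc (4 * C) * (F * 3))
    a₁ = C * unitₖ

    0<C : 0 < C
    0<C = *-mono-≤ (*-mono-≤ {1} {26} (s≤s z≤n) 0<m) 0<m

    0<M : 0 < M
    0<M = *-mono-≤ {1} {4 * m} (*-mono-≤ {1} {4} (s≤s z≤n) 0<m) (*-mono-≤ {1} {4} (s≤s z≤n) 0<m)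

    0<unitₖ : 0 < unitₖ
    0<unitₖ = *-mono-≤ {1} {2} (s≤s z≤n) (*-mono-≤ {1} {suc (4 * C)} (s≤s z≤n)
      (*-mono-≤ {1} {F} {1} {3} (*-mono-≤ {1} {6} (s≤s z≤n) (*-mono-≤ {1} {suc (2 * C)} (s≤s z≤n) 0<M)) (s≤s z≤n)))

    0<a₁ : 0 < a₁
    0<a₁ = *-mono-≤ 0<C 0<unitₖ

    -- `κ₀` is what `square-<` requires when n ≤ 2 a₁ κ, and `n₀` makes the floor of n / a₁ at least
    -- `κ₀`.
    κ₀ n₀ : ℕ
    κ₀ = 10 * (2 * a₁ * (2 * a₁))
    n₀ = κ₀ * a₁

    0<κ₀ : 0 < κ₀
    0<κ₀ = *-mono-≤ {1} {10} (s≤s z≤n) (*-mono-≤ {1} {2 * a₁} (*-mono-≤ {1} {2} (s≤s z≤n) 0<a₁) (*-mono-≤ {1} {2} (s≤s z≤n) 0<a₁))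

    -- Since κ ≥ 1, rounding n down to a multiple of a₁ loses at most a factor of two; this is the
    -- gap between `n-lower` and `n-upper`.
    scale : ∀ {n} → n₀ ≤ n → Σ ℕ λ κ → κ₀ ≤ κ × a₁ * κ ≤ n × n ≤ 2 * a₁ * κ
    scale {n} n₀≤ = κ , κ≥ , ≤-trans (≤-reflexive (*-comm a₁ κ)) (m/n*n≤m n a₁) , (begin
      n ≡⟨ m≡m%n+[m/n]*n n a₁ ⟩
      n % a₁ + κ * a₁ ≤⟨ +-monoˡ-≤ (κ * a₁) (<⇒≤ (m%n<n n a₁)) ⟩
      a₁ + κ * a₁ ≤⟨ +-monoˡ-≤ (κ * a₁) (≤-trans (≤-reflexive (sym (*-identityˡ a₁))) (*-monoˡ-≤ a₁ (≤-trans 0<κ₀ κ≥))) ⟩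
      κ * a₁ + κ * a₁ ≡⟨ id κ a₁ ⟩
      2 * a₁ * κ ∎)
      where
      open ≤-Reasoning
      instance
        a₁-nonZero : NonZero a₁
        a₁-nonZero = >-nonZero 0<a₁
      κ : ℕ
      κ = n / a₁
      κ≥ : κ₀ ≤ κ
      κ≥ = ≤-trans (≤-reflexive (sym (m*n/n≡m κ₀ a₁))) (/-monoˡ-≤ a₁ n₀≤)
      id : ∀ κ a → κ * a + κ * a ≡ 2 * a * κ
      id = solve-∀

  module Run (α : ℚ) (k p m : ℕ) (α≡ : ⟦ suc k ⟧ ℚ.* α ≡ ⟦ suc p ⟧) (m≡ : m ≡ 72 * (suc k * suc k)) (0<m : 0 < m) where

    open Scale m 0<m

    module _ (ε : ℚ) (ε≡ : ⟦ suc (2 * C) ⟧ ℚ.* ε ≡ ⟦ 1 ⟧) where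

      module Large {n′ : ℕ} (D : Digraph (2 * suc n′)) (¬ext : ¬ Extremal α (suc n′) D)
        (degree : MinSemiDeg≥ D ((1ℚ ℚ.- ε) ℚ.* ⟦ suc n′ ⟧))
        (κ : ℕ) (κ≥ : κ₀ ≤ κ) (lower : a₁ * κ ≤ suc n′) (upper : suc n′ ≤ 2 * a₁ * κ) where

        u t ι : ℕ
        u = unitₖ * κ
        t = pred (26 * m * u)
        ι = 3 * κ

        0<κ : 0 < κ
        0<κ = ≤-trans 0<κ₀ κ≥

        0<u : 0 < u
        0<u = *-mono-≤ 0<unitₖ 0<κ

        G≡ : suc t ≡ 26 * m * u
        G≡ = suc-pred (26 * m * u) {{>-nonZero (*-mono-≤ {1} {26 * m} (*-mono-≤ {1} {26} (s≤s z≤n) 0<m) 0<u)}}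

        u≡ : u ≡ 2 * (suc (4 * C) * (F * ι))
        u≡ = id (suc (4 * C)) F κ
          where
          id : ∀ q F κ → 2 * (q * (F * 3)) * κ ≡ 2 * (q * (F * (3 * κ)))
          id = solve-∀

        n-lower : C * u ≤ suc n′
        n-lower = ≤-trans (≤-reflexive (sym (*-assoc C unitₖ κ))) lower

        n-upper : suc n′ ≤ 2 * C * u
        n-upper = ≤-trans upper (≤-reflexive (id C unitₖ κ))
          where
          id : ∀ C w κ → 2 * (C * w) * κ ≡ 2 * C * (w * κ)
          id = solve-∀

        n≤ : suc n′ ≤ suc (2 * C) * u
        n≤ = ≤-trans n-upper (m≤n+m _ u)

        3≤ : 3 ≤ 2 * suc n′
        3≤ = ≤-trans (n≤1+n 3) (*-monoʳ-≤ 2 {2} {suc n′}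
          (≤-trans (*-mono-≤ {2} {C} {1} {u} (*-mono-≤ {2} {26 * m} {1} {m} (*-mono-≤ {2} {26} {1} {m} (s≤s (s≤s z≤n)) 0<m) 0<m) 0<u) n-lower))

        cycle : AntiDirHamCycle D
        cycle = Cycle.anti-directed-cycle (suc k) m u t ι (pred M) F m≡ G≡ (s≤s z≤n) 0<u (*-mono-≤ {1} {3} (s≤s z≤n) 0<κ)
          (sym (suc-pred M {{>-nonZero 0<M}})) (cong (λ z → 6 * (suc (2 * C) * z)) (sym (suc-pred M {{>-nonZero 0<M}}))) u≡
          n-lower n-upper (square-< {suc n′} {2 * a₁} upper κ≥ refl) D
          (λ v → subst (λ d → suc n′ ≤ d + u) (outdeg≡ D v) (min-degree (2 * C) {ε} ε≡ n≤ (proj₁ (degree v))))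
          (λ v → subst (λ d → suc n′ ≤ d + u) (indeg≡ D v) (min-degree (2 * C) {ε} ε≡ n≤ (proj₂ (degree v))))
          (λ A B a₁ a₂ b₁ b₂ dA dB → ¬ext (extremal {α} {k} {p} D α≡ A B a₁ a₂ b₁ b₂ dA dB)) 3≤

      run : ∀ n → n₀ ≤ n → (D : Digraph (2 * n)) → ¬ Extremal α n D → MinSemiDeg≥ D ((1ℚ ℚ.- ε) ℚ.* ⟦ n ⟧) → AntiDirHamCycle D
      run zero n₀≤ _ _ _ = ⊥-elim (1+n≰n (≤-trans (*-mono-≤ 0<κ₀ 0<a₁) n₀≤))
      run (suc n′) n₀≤ D ¬ext degree = large (scale n₀≤)
        where
        large : (Σ ℕ λ κ → κ₀ ≤ κ × a₁ * κ ≤ suc n′ × suc n′ ≤ 2 * a₁ * κ) → AntiDirHamCycle D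
        large (κ , κ≥ , lower , upper) = Large.cycle D ¬ext degree κ κ≥ lower upper

    conclusion : Σ ℚ λ ε → 0ℚ ℚ.< ε × Σ ℕ λ n₀ → (n : ℕ) → n₀ ≤ n → (D : Digraph (2 * n)) →
      ¬ Extremal α n D → MinSemiDeg≥ D ((1ℚ ℚ.- ε) ℚ.* ⟦ n ⟧) → AntiDirHamCycle D
    -- ε = 1/(2C + 1), because n ≤ 2C u for the unit u.
    conclusion = choose (Rational.unit-fraction (2 * C))
      where
      choose : (Σ ℚ λ ε → 0ℚ ℚ.< ε × ⟦ suc (2 * C) ⟧ ℚ.* ε ≡ ⟦ 1 ⟧) → Σ ℚ λ ε → 0ℚ ℚ.< ε × Σ ℕ λ n₀ →
        (n : ℕ) → n₀ ≤ n → (D : Digraph (2 * n)) → ¬ Extremal α n D → MinSemiDeg≥ D ((1ℚ ℚ.- ε) ℚ.* ⟦ n ⟧) → AntiDirHamCycle D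
      choose (ε , 0<ε , ε≡) = ε , 0<ε , n₀ , run ε ε≡

  main : (α : ℚ) → 0ℚ ℚ.< α → Σ ℚ λ ε → 0ℚ ℚ.< ε × Σ ℕ λ n₀ → (n : ℕ) → n₀ ≤ n → (D : Digraph (2 * n)) →
    ¬ Extremal α n D → MinSemiDeg≥ D ((1ℚ ℚ.- ε) ℚ.* ⟦ n ⟧) → AntiDirHamCycle D
  main α 0<α = choose (Rational.positive-fraction α 0<α)
    where
    choose : (Σ ℕ λ k → Σ ℕ λ p → ⟦ suc k ⟧ ℚ.* α ≡ ⟦ suc p ⟧) → _
    choose (k , p , α≡) = Run.conclusion α k p (72 * (suc k * suc k)) α≡ refl (s≤s z≤n)


open import Data.Nat using (ℕ; _≤_; _*_)
open import Data.Rational using (ℚ; _<_; 0ℚ; 1ℚ; _-_; _/_)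
open import Data.Integer using (+_)
open import Data.Product using (Σ; _×_)
open import Relation.Nullary using (¬_)

theorem3p1 : (α : ℚ) → 0ℚ < α → α < + 1 / 32 →
    Σ ℚ λ ε → 0ℚ < ε × Σ ℕ λ n₀ →
    (n : ℕ) → n₀ ≤ n → (D : Digraph (2 * n)) →
    ¬ Extremal α n D →
    MinSemiDeg≥ D ((1ℚ - ε) Data.Rational.* ⟦ n ⟧) →
    AntiDirHamCycle D
theorem3p1 α 0<α _ = AntiDirected.main α 0<α
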